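{- Let $P$ be a simplicial $k$-neighborly $d$-polytope with $k \le d/2$ and with $n \ge d+2$ vertices. Then for every $j$ with $0 \le j \le d-1$, \[ f_{j}(P) \ge \sum_{i=0}^{k} \left( \binom{d+1-i}{d-j} - \binom{i}{d-j}\right) \binom{n-d-2+i}{i}. \] In particular, \[ f_{d-1}(P) \ge \sum_{i=0}^{k} (d+1-2i) \binom{n-d-2+i}{i}. \]
   Context: A $d$-polytope is a $d$-dimensional convex polytope; $f_j(P)$ is the number of $j$-dimensional faces of $P$. $P$ is simplicial if every facet is a simplex. For $k \ge 1$, $P$ is $k$-neighborly if every set of $k$ vertices of $P$ is the vertex set of a face of $P$. Binomial coefficients $\binom{a}{b}$ are zero when $b > a$ or $b<0$.
   Formalization: The polytope P is assumed to have vertices with rational coordinates (and faces are cut out by rational linear inequalities), rather than arbitrary real coordinates. -}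

module Defs where

open import Data.Nat as ℕ using (ℕ; zero; suc; _∸_; _≤_; _<_)
open import Data.Nat.Combinatorics using (_C_)
open import Data.Fin using (Fin; zero; suc)
open import Data.Fin.Subset using (Subset; _∈_; _∉_; _⊆_; ∣_∣)
open import Data.Rational as ℚ using (ℚ; 0ℚ)
open import Data.Integer as ℤ using (ℤ; +_)
open import Data.Product using (Σ; _×_; ∃)
open import Data.List using (List)
open import Data.List.Membership.Propositional as L using ()
open import Data.List.Relation.Unary.Unique.Propositional using (Unique)
open import Function using (_∘_; _⇔_)
open import Relation.Binary.PropositionalEquality using (_≡_)

sumℚ : ∀ {n} → (Fin n → ℚ) → ℚ
sumℚ {zero}  f = 0ℚ
sumℚ {suc n} f = f zero ℚ.+ sumℚ (f ∘ suc)

sumℤ : ℕ → (ℕ → ℤ) → ℤ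
sumℤ zero    g = + 0
sumℤ (suc m) g = sumℤ m g ℤ.+ g m

Config : ℕ → ℕ → Set
Config d n = Fin n → Fin d → ℚ

_·_ : ∀ {d} → (Fin d → ℚ) → (Fin d → ℚ) → ℚ
x · y = sumℚ (λ t → x t ℚ.* y t)

AffIndep : ∀ {d n} → Config d n → Subset n → Set
AffIndep {d} {n} v S =
  (λ' : Fin n → ℚ) →
  (∀ i → i ∉ S → λ' i ≡ 0ℚ) →
  sumℚ λ' ≡ 0ℚ →
  (∀ (t : Fin d) → sumℚ (λ i → λ' i ℚ.* v i t) ≡ 0ℚ) →
  ∀ i → λ' i ≡ 0ℚ

-- S is the vertex set of a face of P = conv(v): there is a valid linear
-- inequality c·x ≤ b for P whose equality set among the points is exactly S.
IsFace : ∀ {d n} → Config d n → Subset n → Set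
IsFace {d} v S =
  Σ (Fin d → ℚ) λ c → Σ ℚ λ b →
    (∀ i → (c · v i) ℚ.≤ b) × (∀ i → (c · v i ≡ b) ⇔ (i ∈ S))

HasDim : ∀ {d n} → Config d n → Subset n → ℕ → Set
HasDim v S j =
  (Σ _ λ T → T ⊆ S × ∣ T ∣ ≡ suc j × AffIndep v T) ×
  (∀ T → T ⊆ S → AffIndep v T → ∣ T ∣ ≤ suc j)

IsJFace : ∀ {d n} → Config d n → ℕ → Subset n → Set
IsJFace v j S = IsFace v S × HasDim v S j

IsPolytopeWithVertices : ∀ {d n} → Config d n → Set
IsPolytopeWithVertices {d} {n} v =
  (Σ _ λ T → ∣ T ∣ ≡ suc d × AffIndep v T) ×
  (∀ i i' → v i ≡ v i' → i ≡ i') ×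
  (∀ (S : Subset n) → ∣ S ∣ ≡ 1 → IsFace v S)

Simplicial : ∀ {d n} → Config d n → Set
Simplicial {d} {n} v = ∀ (S : Subset n) → IsJFace v (d ∸ 1) S → AffIndep v S

Neighborly : ∀ {d n} → ℕ → Config d n → Set
Neighborly {d} {n} k v = ∀ (S : Subset n) → ∣ S ∣ ≡ k → IsFace v S

AtLeastJFaces : ∀ {d n} → Config d n → ℕ → ℤ → Set
AtLeastJFaces {d} {n} v j N =
  Σ (List (Subset n)) λ L →
    Unique L × (∀ S → S L.∈ L → IsJFace v j S) × (N ℤ.≤ + Data.List.length L)

boundJ : ℕ → ℕ → ℕ → ℕ → ℤ
boundJ d n k j = sumℤ (suc k) λ i →
  ((+ ((suc d ∸ i) C (d ∸ j))) ℤ.- (+ (i C (d ∸ j)))) ℤ.* (+ ((n ∸ (d ℕ.+ 2) ℕ.+ i) C i))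

boundFacet : ℕ → ℕ → ℕ → ℤ
boundFacet d n k = sumℤ (suc k) λ i →
  (+ (suc d ∸ 2 ℕ.* i)) ℤ.* (+ ((n ∸ (d ℕ.+ 2) ℕ.+ i) C i))

{-# OPTIONS --safe #-}
module Submission where

-- Order the facets by their values along a generic direction w (a line shelling); then every face lies in a unique
-- interval [R σ, σ], and h_m counts the facets with ∣R σ∣ = m.  Reversing w replaces R σ by σ ∖ R σ, hence h_m by h_{d−m}.
-- If all sets of at most k vertices are faces, then counting faces forces h_l = C(n−d−1+l, l) for l ≤ k.  As every f_j is a
-- combination of the h_m with binomial coefficients, it remains to see that h_m ≤ h_{m+1} for 2m + 1 ≤ d.
--
-- For this, following Papadakis–Petrotou and Karu–Xiao, take a generic matrix a over a field K of rational functions over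
-- 𝔽₂, let p_σ be the point supported on σ with Σ_j a_{sj} x_j = δ_{0s}, and let ψ(g) = Σ_σ wt_σ g(p_σ) with
-- wt_σ = 1/(det a_σ · ∏ p_σ).  Then ψ vanishes on polynomials of degree < d (terms cancel in pairs at ridges), and the
-- monomials x^{R σ} and x^{σ∖R σ} are triangular with respect to the pairing ψ(FG).  If h_m > h_{m+1}, there is a
-- nonzero combination F of the x^{R σ}, ∣R σ∣ = m, and a generic linear form ℓ with ψ(ℓFG) = 0 for all G of degree
-- d − m − 1.  With G = F x_I, differentiating in the coefficients of ℓ gives ψ(F² x_I) = 0, as squares are constants.
-- Differentiating once in each row of a, in the columns J, turns ψ(F² x_I) into ψ(F x_L)² where x_I x_J = x_L².
-- So F is orthogonal to everything of degree d − m, and triangularity gives F = 0.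

open import Algebra.Bundles using (CommutativeRing; RawRing)
import Algebra.Properties.Ring
import Algebra.Properties.Semiring.Sum
import Algebra.Solver.Ring
open import Algebra.Solver.Ring.AlmostCommutativeRing using (AlmostCommutativeRing; _-Raw-AlmostCommutative⟶_; Induced-equivalence)
import Algebra.Solver.Ring.NaturalCoefficients.Default
open import Data.Bool using (Bool; true; false; _∧_; _xor_; not; _∨_)
import Data.Bool.Properties as Boolₚ
open import Data.Empty as Empty using (⊥-elim)
open import Data.Fin as Fin using (Fin; zero; suc)
import Data.Fin.Properties as Finₚ
open import Data.Fin.Subset.Properties as Subsetₚ using (_∈?_)
import Data.Integer.Properties as ℤₚ
open import Data.List as List using (List; []; _∷_; _ʳ++_; foldr; length; map; _++_; tabulate; filter; concat; allFin)
import Data.List.Membership.DecPropositional as DecMembership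
open import Data.List.Membership.Propositional using () renaming (_∈_ to _∈ₗ_)
import Data.List.Membership.Propositional.Properties as Membershipₚ
import Data.List.Properties as Listₚ
open import Data.List.Relation.Binary.Permutation.Propositional as ↭ using (_↭_)
import Data.List.Relation.Binary.Permutation.Propositional.Properties as ↭ₚ
open import Data.List.Relation.Unary.All as All using (All; []; _∷_)
import Data.List.Relation.Unary.All.Properties
open import Data.List.Relation.Unary.AllPairs using ([]; _∷_)
open import Data.List.Relation.Unary.Any as Any using (here; there)
import Data.List.Relation.Unary.Any.Properties as Anyₚ
open import Data.List.Relation.Unary.Unique.Propositional using (Unique)
import Data.List.Relation.Unary.Unique.Propositional.Properties as Uniqueₚ
open import Data.Maybe using (just; nothing)
import Data.Nat.Properties as ℕₚ
open import Data.Product using (_,_; Σ; proj₁; _×_; ∃; proj₂; ∃₂)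
import Data.Rational.Properties as ℚₚ
open import Data.Sum as Sum using (_⊎_; inj₁; inj₂)
import Data.Unit as Unit
open import Data.Vec as Vec using (_∷_; lookup; _[_]%=_; [])
import Data.Vec.Properties as Vecₚ
open import Function using (_∘_; id; mk⇔; Equivalence)
open import Level using (0ℓ)
open import Relation.Binary.Definitions using (Decidable; WeaklyDecidable; tri<; tri≈; tri>)
open import Relation.Nullary using (¬_; Dec; yes; no; does)
open import Relation.Nullary.Decidable using (_×-dec_; ¬?; dec-true; dec-false)

-- Polynomial rings over 𝔽₂ and their derivations

-- Characteristic 2 serves three purposes. Signs disappear, so determinants are permanents and ridge
-- terms cancel without orientations; every derivation kills squares, which isolates single terms of
-- a sum; and a sum of squares is the square of the sum, so ψ(F x_L)² can be reached facet by facet.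
-- No quotient ring is formed: the face ring modulo linear forms enters only through functionals on
-- monomials, given as lists of vertices, and ψ is a weighted evaluation at one point per facet. The
-- numbers in the bound arise as follows. For i ≤ k, C(n-d-2+i, i) is the difference h_i - h_{i-1}.
-- Monotonicity therefore bounds h_e and h_{d-e}, for e ≤ d/2, below by the sum of these differences
-- over i ≤ min(k, e). The i-th difference thus counts for every e with i ≤ e ≤ d-i, and the sum of
-- C(e, d-1-j) over this window is C(d+1-i, d-j) - C(i, d-j).

module PolynomialRings where
  open import Data.Nat using (ℕ; zero; suc; z≤n; s≤s)
  import Data.Nat as ℕ
  open import Relation.Binary.PropositionalEquality using (_≡_)

  module Char2Solver (R : CommutativeRing 0ℓ 0ℓ)
    (x+x≈0 : ∀ x → CommutativeRing._≈_ R (CommutativeRing._+_ R x x) (CommutativeRing.0# R)) where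
    open CommutativeRing R

    -- Solver coefficients in 𝔽₂, with the identity as negation: normalisation then cancels `x + x`,
    -- which integer or natural coefficients would not do.
    bits : RawRing 0ℓ 0ℓ
    bits = record { Carrier = Bool ; _≈_ = _≡_ ; _+_ = _xor_ ; _*_ = _∧_ ; -_ = id ; 0# = false ; 1# = true }

    almost : AlmostCommutativeRing 0ℓ 0ℓ
    almost = record
      { Carrier = Carrier ; _≈_ = _≈_ ; _+_ = _+_ ; _*_ = _*_ ; -_ = id ; 0# = 0# ; 1# = 1#
      ; isAlmostCommutativeRing = record
        { isCommutativeSemiring = isCommutativeSemiring
        ; -‿cong = id ; -‿*-distribˡ = λ _ _ → refl ; -‿+-comm = λ _ _ → refl } }

    bit : Bool → Carrier
    bit false = 0#
    bit true  = 1#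

    bits⟶ : bits -Raw-AlmostCommutative⟶ almost
    bits⟶ = record
      { ⟦_⟧ = bit
      ; +-homo = λ { false y → sym (+-identityˡ _) ; true false → sym (+-identityʳ _) ; true true → sym (x+x≈0 1#) }
      ; *-homo = λ { false y → sym (zeroˡ _) ; true y → sym (*-identityˡ _) }
      ; -‿homo = λ _ → refl ; 0-homo = refl ; 1-homo = refl }

    private
      _bit≟_ : WeaklyDecidable (Induced-equivalence bits⟶)
      false bit≟ false = just refl
      false bit≟ true  = nothing
      true  bit≟ false = nothing
      true  bit≟ true  = just refl

    open Algebra.Solver.Ring bits almost bits⟶ _bit≟_ public
      using (solve; _:=_; _:+_; _:*_; con)

  record Derivation (R : CommutativeRing 0ℓ 0ℓ) : Set where
    open CommutativeRing R
    field
      ∂      : Carrier → Carrier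
      ∂-cong : ∀ {x y} → x ≈ y → ∂ x ≈ ∂ y
      ∂-+    : ∀ x y → ∂ (x + y) ≈ ∂ x + ∂ y
      ∂-*    : ∀ x y → ∂ (x * y) ≈ ∂ x * y + x * ∂ y

  record IsDomain₂ (R : CommutativeRing 0ℓ 0ℓ) : Set where
    open CommutativeRing R
    field
      x+x≈0    : ∀ x → x + x ≈ 0#
      _≟_      : Decidable _≈_
      integral : ∀ x y → x * y ≈ 0# → (x ≈ 0#) ⊎ (y ≈ 0#)
      1≉0      : ¬ (1# ≈ 0#)

  δ⟨_⟩ : (R : CommutativeRing 0ℓ 0ℓ) → ∀ {n} → Fin n → Fin n → CommutativeRing.Carrier R
  δ⟨ R ⟩ zero zero = CommutativeRing.1# R
  δ⟨ R ⟩ zero (suc j) = CommutativeRing.0# R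
  δ⟨ R ⟩ (suc i) zero = CommutativeRing.0# R
  δ⟨ R ⟩ (suc i) (suc j) = δ⟨ R ⟩ i j

  record Coordinates (R : CommutativeRing 0ℓ 0ℓ) (n : ℕ) : Set where
    open CommutativeRing R
    field
      x   : Fin n → Carrier
      ∂/  : Fin n → Derivation R
      ∂x  : ∀ i j → Derivation.∂ (∂/ i) (x j) ≈ δ⟨ R ⟩ i j

  module PolynomialExtension (R : CommutativeRing 0ℓ 0ℓ) (dom : IsDomain₂ R) where
    open CommutativeRing R
    open IsDomain₂ dom
    open Char2Solver R x+x≈0
    open import Relation.Binary.Reasoning.Setoid setoid

    Series : Set
    Series = ℕ → Carrier

    tail : Series → Series
    tail p n = p (suc n)

    _≋_ : Series → Series → Set
    p ≋ q = ∀ n → p n ≈ q n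

    _⊕_ : Series → Series → Series
    (p ⊕ q) n = p n + q n

    -- With r the tail of p, this is (p₀ + t·r)·q = p₀·q + t·(r·q) read coefficientwise.
    _⊛_ : Series → Series → Series
    (p ⊛ q) zero    = p 0 * q 0
    (p ⊛ q) (suc n) = p 0 * q (suc n) + (tail p ⊛ q) n

    const : Carrier → Series
    const a zero    = a
    const a (suc n) = 0#

    ⊛-cong : ∀ {p p′ q q′} → p ≋ p′ → q ≋ q′ → (p ⊛ q) ≋ (p′ ⊛ q′)
    ⊛-cong e f zero    = *-cong (e 0) (f 0)
    ⊛-cong e f (suc n) = +-cong (*-cong (e 0) (f (suc n))) (⊛-cong (e ∘ suc) f n)

    ⊛-sucʳ : ∀ p q n → (p ⊛ q) (suc n) ≈ (p ⊛ tail q) n + p (suc n) * q 0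
    ⊛-sucʳ p q zero = refl
    ⊛-sucʳ p q (suc n) = trans (+-congˡ (⊛-sucʳ (tail p) q n)) (sym (+-assoc _ _ _))

    ⊛-comm : ∀ p q → (p ⊛ q) ≋ (q ⊛ p)
    ⊛-comm p q zero = *-comm _ _
    ⊛-comm p q (suc n) = begin
      p 0 * q (suc n) + (tail p ⊛ q) n ≈⟨ +-cong (*-comm _ _) (⊛-comm (tail p) q n) ⟩
      q (suc n) * p 0 + (q ⊛ tail p) n ≈⟨ +-comm _ _ ⟩
      (q ⊛ tail p) n + q (suc n) * p 0 ≈⟨ ⊛-sucʳ q p n ⟨
      (q ⊛ p) (suc n) ∎

    -- The tail of a product is `p 0` times `tail q` plus `tail p ⊛ q`; associativity has to
    -- distribute over a sum of exactly this shape.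
    ⊛-linearˡ : ∀ a f g r → ((λ n → a * f n + g n) ⊛ r) ≋ (λ n → a * (f ⊛ r) n + (g ⊛ r) n)
    ⊛-linearˡ a f g r zero = solve 4 (λ a f g r → (a :* f :+ g) :* r := a :* (f :* r) :+ g :* r) refl _ _ _ _
    ⊛-linearˡ a f g r (suc n) = begin
      (a * f 0 + g 0) * r (suc n) + _ ≈⟨ +-congˡ (⊛-linearˡ a (tail f) (tail g) r n) ⟩
      (a * f 0 + g 0) * r (suc n) + (a * (tail f ⊛ r) n + (tail g ⊛ r) n)
        ≈⟨ solve 6 (λ a f g r u v → (a :* f :+ g) :* r :+ (a :* u :+ v) := a :* (f :* r :+ u) :+ (g :* r :+ v)) refl _ _ _ _ _ _ ⟩
      a * (f ⊛ r) (suc n) + (g ⊛ r) (suc n) ∎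

    ⊛-distribʳ : ∀ r p q → ((p ⊕ q) ⊛ r) ≋ ((p ⊛ r) ⊕ (q ⊛ r))
    ⊛-distribʳ r p q zero = distribʳ _ _ _
    ⊛-distribʳ r p q (suc n) = trans (+-congˡ (⊛-distribʳ r (tail p) (tail q) n))
      (solve 5 (λ p q r u v → (p :+ q) :* r :+ (u :+ v) := (p :* r :+ u) :+ (q :* r :+ v)) refl _ _ _ _ _)

    ⊛-assoc : ∀ p q r → ((p ⊛ q) ⊛ r) ≋ (p ⊛ (q ⊛ r))
    ⊛-assoc p q r zero = *-assoc _ _ _
    ⊛-assoc p q r (suc n) = begin
      (p 0 * q 0) * r (suc n) + (tail (p ⊛ q) ⊛ r) n
        ≈⟨ +-congˡ (⊛-linearˡ (p 0) (tail q) (tail p ⊛ q) r n) ⟩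
      (p 0 * q 0) * r (suc n) + (p 0 * (tail q ⊛ r) n + ((tail p ⊛ q) ⊛ r) n)
        ≈⟨ +-congˡ (+-congˡ (⊛-assoc (tail p) q r n)) ⟩
      (p 0 * q 0) * r (suc n) + (p 0 * (tail q ⊛ r) n + (tail p ⊛ (q ⊛ r)) n)
        ≈⟨ solve 5 (λ p q r u v → (p :* q) :* r :+ (p :* u :+ v) := p :* (q :* r :+ u) :+ v) refl _ _ _ _ _ ⟩
      (p ⊛ (q ⊛ r)) (suc n) ∎

    ⊛-zeroˡ : ∀ {p} q → p ≋ const 0# → (p ⊛ q) ≋ const 0#
    ⊛-zeroˡ q e zero = trans (*-congʳ (e 0)) (zeroˡ _)
    ⊛-zeroˡ q e (suc n) = trans (+-cong (trans (*-congʳ (e 0)) (zeroˡ _))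
      (⊛-zeroˡ q (λ { zero → e 1 ; (suc m) → e (suc (suc m)) }) n)) (trans (+-identityˡ _) (const-0 n))
      where
      const-0 : ∀ n → const 0# n ≈ 0#
      const-0 zero = refl
      const-0 (suc n) = refl

    const0 : ∀ n → const 0# n ≈ 0#
    const0 zero    = refl
    const0 (suc n) = refl

    ⊛-const : ∀ a q → (const a ⊛ q) ≋ (λ n → a * q n)
    ⊛-const a q zero = refl
    ⊛-const a q (suc n) = trans (+-congˡ (trans (⊛-zeroˡ q (λ m → sym (const0 m)) n) (const0 n))) (+-identityʳ _)

    VanishesFrom : ℕ → Series → Set
    VanishesFrom N p = ∀ n → N ℕ.≤ n → p n ≈ 0#

    ⊛-vanishes : ∀ N M p q → VanishesFrom N p → VanishesFrom M q → VanishesFrom (N ℕ.+ M) (p ⊛ q)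
    ⊛-vanishes zero M p q vp vq n _ = trans (⊛-zeroˡ q (λ m → trans (vp m z≤n) (sym (const0 m))) n) (const0 n)
    ⊛-vanishes (suc N) M p q vp vq (suc n) (s≤s le) = trans
      (+-cong (trans (*-congˡ (vq (suc n) (ℕₚ.≤-trans (ℕₚ.m≤n+m M N) (ℕₚ.m≤n⇒m≤1+n le)))) (zeroʳ _))
              (⊛-vanishes N M (tail p) q (λ m l → vp (suc m) (s≤s l)) vq n le)) (+-identityˡ _)

    -- `bound` is any bound on the degree, not the degree, and equality ignores it. It makes
    -- equality decidable and is what induction on the degree recurses on.
    record Poly : Set where
      constructor poly
      field
        coeff    : Series
        bound    : ℕ
        vanishes : VanishesFrom bound coeff
    open Poly

    private
      ⊕-vanishes : ∀ p q → VanishesFrom (bound p ℕ.⊔ bound q) (coeff p ⊕ coeff q)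
      ⊕-vanishes p q n le = trans (+-cong
        (vanishes p n (ℕₚ.≤-trans (ℕₚ.m≤m⊔n (bound p) (bound q)) le))
        (vanishes q n (ℕₚ.≤-trans (ℕₚ.m≤n⊔m (bound p) (bound q)) le))) (+-identityˡ _)

      constant : Carrier → Poly
      constant a = poly (const a) 1 (λ { (suc n) _ → refl })

    R[t] : CommutativeRing 0ℓ 0ℓ
    R[t] = record
      { Carrier = Poly
      ; _≈_ = λ p q → coeff p ≋ coeff q
      ; _+_ = λ p q → poly (coeff p ⊕ coeff q) (bound p ℕ.⊔ bound q) (⊕-vanishes p q)
      ; _*_ = λ p q → poly (coeff p ⊛ coeff q) (bound p ℕ.+ bound q)
                        (⊛-vanishes (bound p) (bound q) _ _ (vanishes p) (vanishes q))
      ; -_ = id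
      ; 0# = constant 0#
      ; 1# = constant 1#
      ; isCommutativeRing = record
        { isRing = record
          { +-isAbelianGroup = record
            { isGroup = record
              { isMonoid = record
                { isSemigroup = record
                  { isMagma = record
                    { isEquivalence = record
                      { refl = λ n → refl ; sym = λ e n → sym (e n) ; trans = λ e f n → trans (e n) (f n) }
                    ; ∙-cong = λ e f n → +-cong (e n) (f n) }
                  ; assoc = λ p q r n → +-assoc _ _ _ }
                ; identity = (λ p n → trans (+-congʳ (const0 n)) (+-identityˡ _))
                           , (λ p n → trans (+-congˡ (const0 n)) (+-identityʳ _)) }
              ; inverse = (λ p n → trans (x+x≈0 _) (sym (const0 n))) , (λ p n → trans (x+x≈0 _) (sym (const0 n)))
              ; ⁻¹-cong = id }
            ; comm = λ p q n → +-comm _ _ }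
          ; *-cong = ⊛-cong
          ; *-assoc = λ p q r → ⊛-assoc _ _ _
          ; *-identity = (λ p n → trans (⊛-const 1# _ n) (*-identityˡ _))
                       , (λ p n → trans (⊛-comm (coeff p) _ n) (trans (⊛-const 1# _ n) (*-identityˡ _)))
          ; distrib = (λ p q r n → trans (⊛-comm (coeff p) _ n) (trans (⊛-distribʳ (coeff p) _ _ n)
                          (+-cong (⊛-comm (coeff q) _ n) (⊛-comm (coeff r) _ n))))
                    , (λ p q r → ⊛-distribʳ (coeff p) _ _) }
        ; *-comm = λ p q → ⊛-comm _ _ } }

    private
      bounded-≟ : ∀ N p q → VanishesFrom N p → VanishesFrom N q → Dec (p ≋ q)
      bounded-≟ zero p q vp vq = yes (λ n → trans (vp n z≤n) (sym (vq n z≤n)))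
      bounded-≟ (suc N) p q vp vq with p 0 ≟ q 0
        | bounded-≟ N (tail p) (tail q) (λ m l → vp (suc m) (s≤s l)) (λ m l → vq (suc m) (s≤s l))
      ... | yes e | yes f = yes (λ { zero → e ; (suc n) → f n })
      ... | yes e | no ¬f = no (λ g → ¬f (g ∘ suc))
      ... | no ¬e | _     = no (λ g → ¬e (g 0))

      -- If both constant terms are nonzero, so is that of the product. Otherwise t is split off a
      -- factor whose constant term vanishes, and the bound of that factor drops.
      ⊛-integral : ∀ N M p q → VanishesFrom N p → VanishesFrom M q → (∀ n → (p ⊛ q) n ≈ 0#) →
                   (∀ n → p n ≈ 0#) ⊎ (∀ n → q n ≈ 0#)
      ⊛-integral zero M p q vp vq e = inj₁ (λ n → vp n z≤n)
      ⊛-integral (suc N) zero p q vp vq e = inj₂ (λ n → vq n z≤n)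
      ⊛-integral (suc N) (suc M) p q vp vq e with p 0 ≟ 0# | q 0 ≟ 0#
      ... | yes p0 | _ with ⊛-integral N (suc M) (tail p) q (λ m l → vp (suc m) (s≤s l)) vq
                            (λ n → trans (sym (trans (+-congʳ (trans (*-congʳ p0) (zeroˡ _))) (+-identityˡ _))) (e (suc n)))
      ... | inj₁ z = inj₁ (λ { zero → p0 ; (suc n) → z n })
      ... | inj₂ z = inj₂ z
      ⊛-integral (suc N) (suc M) p q vp vq e | no ¬p0 | yes q0
        with ⊛-integral (suc N) M p (tail q) vp (λ m l → vq (suc m) (s≤s l))
          (λ n → trans (sym (trans (⊛-sucʳ p q n) (trans (+-congˡ (trans (*-congˡ q0) (zeroʳ _))) (+-identityʳ _)))) (e (suc n)))
      ... | inj₁ z = inj₁ z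
      ... | inj₂ z = inj₂ (λ { zero → q0 ; (suc n) → z n })
      ⊛-integral (suc N) (suc M) p q vp vq e | no ¬p0 | no ¬q0 with integral _ _ (e 0)
      ... | inj₁ z = ⊥-elim (¬p0 z)
      ... | inj₂ z = ⊥-elim (¬q0 z)

    R[t]-isDomain : IsDomain₂ R[t]
    R[t]-isDomain = record
      { x+x≈0 = λ p n → trans (x+x≈0 _) (sym (const0 n))
      ; _≟_ = λ p q → bounded-≟ (bound p ℕ.⊔ bound q) (coeff p) (coeff q)
          (λ n le → vanishes p n (ℕₚ.≤-trans (ℕₚ.m≤m⊔n (bound p) (bound q)) le))
          (λ n le → vanishes q n (ℕₚ.≤-trans (ℕₚ.m≤n⊔m (bound p) (bound q)) le))
      ; integral = integral′
      ; 1≉0 = λ e → 1≉0 (e 0) }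
      where
      integral′ : ∀ p q → (coeff p ⊛ coeff q) ≋ const 0# → (coeff p ≋ const 0#) ⊎ (coeff q ≋ const 0#)
      integral′ p q e with ⊛-integral (bound p) (bound q) _ _ (vanishes p) (vanishes q) (λ n → trans (e n) (const0 n))
      ... | inj₁ z = inj₁ (λ n → trans (z n) (sym (const0 n)))
      ... | inj₂ z = inj₂ (λ n → trans (z n) (sym (const0 n)))

    module _ (D : Derivation R) where
      open Derivation D

      ∂-0 : ∂ 0# ≈ 0#
      ∂-0 = begin
        ∂ 0# ≈⟨ ∂-cong (zeroˡ 0#) ⟨
        ∂ (0# * 0#) ≈⟨ ∂-* _ _ ⟩
        ∂ 0# * 0# + 0# * ∂ 0# ≈⟨ +-cong (zeroʳ _) (zeroˡ _) ⟩
        0# + 0# ≈⟨ +-identityˡ _ ⟩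
        0# ∎

      ∂-1 : ∂ 1# ≈ 0#
      ∂-1 = begin
        ∂ 1# ≈⟨ ∂-cong (*-identityˡ 1#) ⟨
        ∂ (1# * 1#) ≈⟨ ∂-* _ _ ⟩
        ∂ 1# * 1# + 1# * ∂ 1# ≈⟨ +-cong (*-identityʳ _) (*-identityˡ _) ⟩
        ∂ 1# + ∂ 1# ≈⟨ x+x≈0 _ ⟩
        0# ∎

      ∂-⊛ : ∀ p q n → ∂ ((p ⊛ q) n) ≈ ((∂ ∘ p) ⊛ q) n + (p ⊛ (∂ ∘ q)) n
      ∂-⊛ p q zero = ∂-* _ _
      ∂-⊛ p q (suc n) = trans (∂-+ _ _) (trans (+-cong (∂-* _ _) (∂-⊛ (tail p) q n))
        (solve 4 (λ a b c d → (a :+ b) :+ (c :+ d) := (a :+ c) :+ (b :+ d)) refl _ _ _ _))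

      coefficientwise : Derivation R[t]
      coefficientwise = record
        { ∂ = λ p → poly (∂ ∘ coeff p) (bound p) (λ n le → trans (∂-cong (vanishes p n le)) ∂-0)
        ; ∂-cong = λ e n → ∂-cong (e n)
        ; ∂-+ = λ p q n → ∂-+ _ _
        ; ∂-* = λ p q n → ∂-⊛ _ _ n }

    -- With q the tail of p, p = p₀ + t·q gives dp/dt = q + t·dq/dt. Read coefficientwise, this
    -- avoids integer multiples.
    d/dt : Series → Series
    d/dt p zero    = p 1
    d/dt p (suc n) = p (suc (suc n)) + d/dt (tail p) n

    d/dt-cong : ∀ {p q} → p ≋ q → d/dt p ≋ d/dt q
    d/dt-cong e zero    = e 1
    d/dt-cong e (suc n) = +-cong (e (suc (suc n))) (d/dt-cong (e ∘ suc) n)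

    d/dt-+ : ∀ p q → d/dt (p ⊕ q) ≋ (d/dt p ⊕ d/dt q)
    d/dt-+ p q zero = refl
    d/dt-+ p q (suc n) = trans (+-congˡ (d/dt-+ (tail p) (tail q) n))
      (solve 4 (λ a b c d → (a :+ b) :+ (c :+ d) := (a :+ c) :+ (b :+ d)) refl _ _ _ _)

    d/dt-scale : ∀ a p → d/dt (λ n → a * p n) ≋ (λ n → a * d/dt p n)
    d/dt-scale a p zero = refl
    d/dt-scale a p (suc n) = trans (+-congˡ (d/dt-scale a (tail p) n)) (sym (distribˡ _ _ _))

    d/dt-vanishes : ∀ N p → VanishesFrom N p → VanishesFrom N (d/dt p)
    d/dt-vanishes N p v zero le = v 1 (ℕₚ.m≤n⇒m≤1+n le)
    d/dt-vanishes N p v (suc n) le = trans (+-cong (v _ (ℕₚ.m≤n⇒m≤1+n le))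
      (d/dt-vanishes (ℕ.pred N) (tail p) (λ m l → v (suc m) (lemma N m l)) n (ℕₚ.pred-mono-≤ le))) (+-identityˡ _)
      where
      lemma : ∀ N m → ℕ.pred N ℕ.≤ m → N ℕ.≤ suc m
      lemma zero m l = z≤n
      lemma (suc N) m l = s≤s l

    d/dt-⊛ : ∀ p q → d/dt (p ⊛ q) ≋ ((d/dt p ⊛ q) ⊕ (p ⊛ d/dt q))
    d/dt-⊛ p q zero = +-comm _ _
    d/dt-⊛ p q (suc n) = begin
      tail (tail (p ⊛ q)) n + d/dt (tail (p ⊛ q)) n
        ≈⟨ +-congˡ (trans (d/dt-+ (λ m → p 0 * q (suc m)) (tail p ⊛ q) n)
             (+-cong (d/dt-scale (p 0) (tail q) n) (d/dt-⊛ (tail p) q n))) ⟩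
      (p 0 * q (suc (suc n)) + (tail p ⊛ q) (suc n)) + (p 0 * d/dt (tail q) n + ((d/dt (tail p) ⊛ q) n + (tail p ⊛ d/dt q) n))
        ≈⟨ +-congʳ (+-congˡ refl) ⟩
      (p 0 * q (suc (suc n)) + (p 1 * q (suc n) + (tail (tail p) ⊛ q) n)) + (p 0 * d/dt (tail q) n + ((d/dt (tail p) ⊛ q) n + (tail p ⊛ d/dt q) n))
        ≈⟨ solve 8 (λ p0 q2 p1 q1 u dq v w →
             (p0 :* q2 :+ (p1 :* q1 :+ u)) :+ (p0 :* dq :+ (v :+ w))
               := (p1 :* q1 :+ (u :+ v)) :+ (p0 :* (q2 :+ dq) :+ w)) refl _ _ _ _ _ _ _ _ ⟩
      (p 1 * q (suc n) + ((tail (tail p) ⊛ q) n + (d/dt (tail p) ⊛ q) n)) + (p 0 * d/dt q (suc n) + (tail p ⊛ d/dt q) n)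
        ≈⟨ +-congʳ (+-congˡ (sym (⊛-distribʳ q (tail (tail p)) (d/dt (tail p)) n))) ⟩
      (d/dt p ⊛ q) (suc n) + (p ⊛ d/dt q) (suc n) ∎

    formal : Derivation R[t]
    formal = record
      { ∂ = λ p → poly (d/dt (coeff p)) (bound p) (d/dt-vanishes (bound p) _ (vanishes p))
      ; ∂-cong = d/dt-cong
      ; ∂-+ = λ p q → d/dt-+ _ _
      ; ∂-* = λ p q → d/dt-⊛ _ _ }

    private
      t : Poly
      t = poly (λ { 1 → 1# ; _ → 0# }) 2 (λ { (suc (suc n)) _ → refl ; 1 (s≤s ()) })

      dt-t : d/dt (coeff t) ≋ const 1#
      dt-t zero = refl
      dt-t (suc n) = trans (+-identityˡ _) (go n)
        where
        go : ∀ n → d/dt (tail (coeff t)) n ≈ 0#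
        go zero = refl
        go (suc n) = trans (+-identityˡ _) (go′ n)
          where
          go′ : ∀ n → d/dt (tail (tail (coeff t))) n ≈ 0#
          go′ n = d/dt-vanishes 0 _ (λ _ _ → refl) n z≤n

      dt-const : ∀ a → d/dt (const a) ≋ const 0#
      dt-const a zero = refl
      dt-const a (suc n) = trans (+-identityˡ _) (d/dt-vanishes 0 _ (λ _ _ → refl) n z≤n)

      const-δ : ∀ {n} (i j : Fin n) → const (δ⟨ R ⟩ i j) ≋ coeff (δ⟨ R[t] ⟩ i j)
      const-δ zero zero n = refl
      const-δ zero (suc j) n = refl
      const-δ (suc i) zero n = refl
      const-δ (suc i) (suc j) n = const-δ i j n

    adjoin : ∀ {n} → Coordinates R n → Coordinates R[t] (suc n)
    adjoin c = record
      { x = λ { zero → t ; (suc j) → constant (x j) }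
      ; ∂/ = λ { zero → formal ; (suc i) → coefficientwise (∂/ i) }
      ; ∂x = λ { zero zero → dt-t
               ; zero (suc j) → dt-const _
               ; (suc i) zero → λ { 0 → ∂-0 (∂/ i) ; 1 → ∂-1 (∂/ i) ; (suc (suc n)) → ∂-0 (∂/ i) }
               ; (suc i) (suc j) → λ { zero → trans (∂x i j) (const-δ i j 0)
                                     ; (suc n) → trans (∂-0 (∂/ i)) (const-δ i j (suc n)) } } }
      where open Coordinates c

open PolynomialRings

-- Rational functions over 𝔽₂ with their partial derivatives

module FractionFields where
  open import Data.Nat using (ℕ; zero; suc)
  open import Relation.Binary.PropositionalEquality as ≡ using (_≡_)

  record IsField (R : CommutativeRing 0ℓ 0ℓ) : Set where
    open CommutativeRing R
    infix 8 _⁻¹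
    infix 4 _≟_
    field
      _⁻¹     : Carrier → Carrier
      inverse : ∀ {x} → ¬ (x ≈ 0#) → x * x ⁻¹ ≈ 1#
      _≟_     : Decidable _≈_
      1≉0     : ¬ (1# ≈ 0#)

    *-cancelˡ : ∀ {x y z} → ¬ (x ≈ 0#) → x * y ≈ x * z → y ≈ z
    *-cancelˡ {x} {y} {z} nz e = trans (sym (lemma y)) (trans (*-congˡ e) (lemma z))
      where
      lemma : ∀ y → x ⁻¹ * (x * y) ≈ y
      lemma y = trans (sym (*-assoc _ _ _)) (trans (*-congʳ (trans (*-comm _ _) (inverse nz))) (*-identityˡ y))

    integral : ∀ {x y} → ¬ (x ≈ 0#) → x * y ≈ 0# → y ≈ 0#
    integral nz e = *-cancelˡ nz (trans e (sym (zeroʳ _)))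

    *-nonzero : ∀ {x y} → ¬ (x ≈ 0#) → ¬ (y ≈ 0#) → ¬ (x * y ≈ 0#)
    *-nonzero nx ny e = ny (integral nx e)

    ⁻¹-nonzero : ∀ {x} → ¬ (x ≈ 0#) → ¬ (x ⁻¹ ≈ 0#)
    ⁻¹-nonzero nx e = 1≉0 (trans (sym (inverse nx)) (trans (*-congˡ e) (zeroʳ _)))

  𝔽₂ : CommutativeRing 0ℓ 0ℓ
  𝔽₂ = Boolₚ.xor-∧-commutativeRing

  𝔽₂-isDomain : IsDomain₂ 𝔽₂
  𝔽₂-isDomain = record
    { x+x≈0 = λ { false → ≡.refl ; true → ≡.refl }
    ; _≟_ = Boolₚ._≟_
    ; integral = λ { false y e → inj₁ ≡.refl ; true y e → inj₂ e }
    ; 1≉0 = λ () }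

  Polynomials : ℕ → CommutativeRing 0ℓ 0ℓ
  Polynomials-isDomain : ∀ n → IsDomain₂ (Polynomials n)
  Polynomials zero    = 𝔽₂
  Polynomials (suc n) = PolynomialExtension.R[t] (Polynomials n) (Polynomials-isDomain n)
  Polynomials-isDomain zero    = 𝔽₂-isDomain
  Polynomials-isDomain (suc n) = PolynomialExtension.R[t]-isDomain (Polynomials n) (Polynomials-isDomain n)

  Polynomials-coordinates : ∀ n → Coordinates (Polynomials n) n
  Polynomials-coordinates zero    = record { x = λ () ; ∂/ = λ () ; ∂x = λ () }
  Polynomials-coordinates (suc n) =
    PolynomialExtension.adjoin (Polynomials n) (Polynomials-isDomain n) (Polynomials-coordinates n)

  module Fractions (R : CommutativeRing 0ℓ 0ℓ) (dom : IsDomain₂ R) where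
    open CommutativeRing R
    open IsDomain₂ dom
    open Char2Solver R x+x≈0
    open import Relation.Binary.Reasoning.Setoid setoid

    record Fraction : Set where
      constructor _/_∣_
      field
        num : Carrier
        den : Carrier
        den≉0 : ¬ (den ≈ 0#)
    open Fraction

    _~_ : Fraction → Fraction → Set
    p ~ q = num p * den q ≈ num q * den p

    private
      *-nz : ∀ {x y} → ¬ (x ≈ 0#) → ¬ (y ≈ 0#) → ¬ (x * y ≈ 0#)
      *-nz nx ny e with integral _ _ e
      ... | inj₁ z = nx z
      ... | inj₂ z = ny z

      cancel : ∀ {x y z} → ¬ (z ≈ 0#) → z * x ≈ z * y → x ≈ y
      cancel {x} {y} {z} nz e with integral z (x + y) (trans (distribˡ z x y) (trans (+-congʳ e) (x+x≈0 _)))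
      ... | inj₁ w = ⊥-elim (nz w)
      ... | inj₂ w = begin
        x ≈⟨ solve 2 (λ x y → x := (x :+ y) :+ y) refl x y ⟩
        (x + y) + y ≈⟨ +-congʳ w ⟩
        0# + y ≈⟨ +-identityˡ y ⟩
        y ∎

      ~-trans : ∀ p q r → p ~ q → q ~ r → p ~ r
      ~-trans (a / b ∣ nb) (c / d ∣ nd) (e / f ∣ nf) h k = cancel nd (begin
        d * (a * f) ≈⟨ solve 3 (λ a d f → d :* (a :* f) := (a :* d) :* f) refl a d f ⟩
        (a * d) * f ≈⟨ *-congʳ h ⟩
        (c * b) * f ≈⟨ solve 3 (λ a d f → (a :* d) :* f := (a :* f) :* d) refl c b f ⟩
        (c * f) * b ≈⟨ *-congʳ k ⟩
        (e * d) * b ≈⟨ solve 3 (λ e d b → (e :* d) :* b := d :* (e :* b)) refl e d b ⟩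
        d * (e * b) ∎)

      ⊕ : Fraction → Fraction → Fraction
      ⊕ (a / b ∣ nb) (c / d ∣ nd) = (a * d + c * b) / b * d ∣ *-nz nb nd

      ⊗ : Fraction → Fraction → Fraction
      ⊗ (a / b ∣ nb) (c / d ∣ nd) = (a * c) / b * d ∣ *-nz nb nd

      ⊕-cong : ∀ {p p′ q q′} → p ~ p′ → q ~ q′ → ⊕ p q ~ ⊕ p′ q′
      ⊕-cong {a / b ∣ _} {a′ / b′ ∣ _} {c / d ∣ _} {c′ / d′ ∣ _} h k = begin
        (a * d + c * b) * (b′ * d′)
          ≈⟨ solve 6 (λ a b c d b′ d′ → (a :* d :+ c :* b) :* (b′ :* d′) := (a :* b′) :* (d :* d′) :+ (c :* d′) :* (b :* b′)) refl a b c d b′ d′ ⟩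
        (a * b′) * (d * d′) + (c * d′) * (b * b′) ≈⟨ +-cong (*-congʳ h) (*-congʳ k) ⟩
        (a′ * b) * (d * d′) + (c′ * d) * (b * b′)
          ≈⟨ solve 6 (λ a b c d b′ d′ → (a :* b) :* (d :* d′) :+ (c :* d) :* (b :* b′) := (a :* d′ :+ c :* b′) :* (b :* d)) refl a′ b c′ d b′ d′ ⟩
        (a′ * d′ + c′ * b′) * (b * d) ∎

      ⊗-cong : ∀ {p p′ q q′} → p ~ p′ → q ~ q′ → ⊗ p q ~ ⊗ p′ q′
      ⊗-cong {a / b ∣ _} {a′ / b′ ∣ _} {c / d ∣ _} {c′ / d′ ∣ _} h k = begin
        (a * c) * (b′ * d′) ≈⟨ solve 4 (λ a c b d → (a :* c) :* (b :* d) := (a :* b) :* (c :* d)) refl a c b′ d′ ⟩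
        (a * b′) * (c * d′) ≈⟨ *-cong h k ⟩
        (a′ * b) * (c′ * d) ≈⟨ solve 4 (λ a c b d → (a :* b) :* (c :* d) := (a :* c) :* (b :* d)) refl a′ c′ b d ⟩
        (a′ * c′) * (b * d) ∎

    Frac : CommutativeRing 0ℓ 0ℓ
    Frac = record
      { Carrier = Fraction
      ; _≈_ = _~_
      ; _+_ = ⊕
      ; _*_ = ⊗
      ; -_ = id
      ; 0# = 0# / 1# ∣ 1≉0
      ; 1# = 1# / 1# ∣ 1≉0
      ; isCommutativeRing = record
        { isRing = record
          { +-isAbelianGroup = record
            { isGroup = record
              { isMonoid = record
                { isSemigroup = record
                  { isMagma = record
                    { isEquivalence = record
                      { refl = refl ; sym = sym ; trans = λ {p} {q} {r} → ~-trans p q r }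
                    ; ∙-cong = λ {p} {p′} {q} {q′} → ⊕-cong {p} {p′} {q} {q′} }
                  ; assoc = λ { (a / b ∣ _) (c / d ∣ _) (e / f ∣ _) →
                      solve 6 (λ a b c d e f → ((a :* d :+ c :* b) :* f :+ e :* (b :* d)) :* (b :* (d :* f))
                        := (a :* (d :* f) :+ (c :* f :+ e :* d) :* b) :* ((b :* d) :* f)) refl a b c d e f } }
                ; identity = (λ { (a / b ∣ _) → solve 2 (λ a b → (con false :* b :+ a :* con true) :* b := a :* (con true :* b)) refl a b })
                           , (λ { (a / b ∣ _) → solve 2 (λ a b → (a :* con true :+ con false :* b) :* b := a :* (b :* con true)) refl a b }) }
              ; inverse = (λ { (a / b ∣ _) → solve 2 (λ a b → (a :* b :+ a :* b) :* con true := con false :* (b :* b)) refl a b })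
                        , (λ { (a / b ∣ _) → solve 2 (λ a b → (a :* b :+ a :* b) :* con true := con false :* (b :* b)) refl a b })
              ; ⁻¹-cong = id }
            ; comm = λ { (a / b ∣ _) (c / d ∣ _) →
                solve 4 (λ a b c d → (a :* d :+ c :* b) :* (d :* b) := (c :* b :+ a :* d) :* (b :* d)) refl a b c d } }
          ; *-cong = λ {p} {p′} {q} {q′} → ⊗-cong {p} {p′} {q} {q′}
          ; *-assoc = λ { (a / b ∣ _) (c / d ∣ _) (e / f ∣ _) →
              solve 6 (λ a b c d e f → ((a :* c) :* e) :* (b :* (d :* f)) := (a :* (c :* e)) :* ((b :* d) :* f)) refl a b c d e f }
          ; *-identity = (λ { (a / b ∣ _) → solve 2 (λ a b → (con true :* a) :* b := a :* (con true :* b)) refl a b })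
                       , (λ { (a / b ∣ _) → solve 2 (λ a b → (a :* con true) :* b := a :* (b :* con true)) refl a b })
          ; distrib = (λ { (a / b ∣ _) (c / d ∣ _) (e / f ∣ _) →
                solve 6 (λ a b c d e f → (a :* (c :* f :+ e :* d)) :* ((b :* d) :* (b :* f))
                  := ((a :* c) :* (b :* f) :+ (a :* e) :* (b :* d)) :* (b :* (d :* f))) refl a b c d e f })
                    , (λ { (a / b ∣ _) (c / d ∣ _) (e / f ∣ _) →
                solve 6 (λ a b c d e f → ((c :* f :+ e :* d) :* a) :* ((d :* b) :* (f :* b))
                  := ((c :* a) :* (f :* b) :+ (e :* a) :* (d :* b)) :* ((d :* f) :* b)) refl a b c d e f }) }
        ; *-comm = λ { (a / b ∣ _) (c / d ∣ _) → solve 4 (λ a b c d → (a :* c) :* (d :* b) := (c :* a) :* (b :* d)) refl a b c d } } }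

    private
      num≈0 : ∀ {p} → p ~ (0# / 1# ∣ 1≉0) → num p ≈ 0#
      num≈0 e = trans (sym (*-identityʳ _)) (trans e (zeroˡ _))

      invert : Fraction → Fraction
      invert (a / b ∣ nb) with a ≟ 0#
      ... | yes _ = 0# / 1# ∣ 1≉0
      ... | no na = b / a ∣ na

      invert-inverse : ∀ p → ¬ (p ~ (0# / 1# ∣ 1≉0)) → ⊗ p (invert p) ~ (1# / 1# ∣ 1≉0)
      invert-inverse (a / b ∣ nb) nz with a ≟ 0#
      ... | yes z = ⊥-elim (nz (trans (*-identityʳ _) (trans z (sym (zeroˡ _)))))
      ... | no na = solve 2 (λ a b → (a :* b) :* con true := con true :* (b :* a)) refl a b

    Frac-isField : IsField Frac
    Frac-isField = record
      { _⁻¹ = invert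
      ; inverse = λ {p} → invert-inverse p
      ; _≟_ = λ p q → (num p * den q) ≟ (num q * den p)
      ; 1≉0 = λ e → 1≉0 (num≈0 {1# / 1# ∣ 1≉0} e) }

    Frac-char2 : ∀ p → ⊕ p p ~ (0# / 1# ∣ 1≉0)
    Frac-char2 (a / b ∣ _) = solve 2 (λ a b → (a :* b :+ a :* b) :* con true := con false :* (b :* b)) refl a b

    quotientRule : Derivation R → Derivation Frac
    quotientRule D = record
      { ∂ = λ { (a / b ∣ nb) → (∂ a * b + a * ∂ b) / b * b ∣ *-nz nb nb }
      ; ∂-cong = λ { {a / b ∣ nb} {c / d ∣ nd} → cong′ a b c d nb nd }
      ; ∂-+ = λ { (a / b ∣ _) (c / d ∣ _) → begin
          (∂ (a * d + c * b) * (b * d) + (a * d + c * b) * ∂ (b * d)) * ((b * b) * (d * d))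
            ≈⟨ *-congʳ (+-cong (*-congʳ (trans (∂-+ _ _) (+-cong (∂-* a d) (∂-* c b)))) (*-congˡ (∂-* b d))) ⟩
          (((∂ a * d + a * ∂ d) + (∂ c * b + c * ∂ b)) * (b * d) + (a * d + c * b) * (∂ b * d + b * ∂ d)) * ((b * b) * (d * d))
            ≈⟨ solve 8 (λ a b c d a′ b′ c′ d′ →
                 (((a′ :* d :+ a :* d′) :+ (c′ :* b :+ c :* b′)) :* (b :* d) :+ (a :* d :+ c :* b) :* (b′ :* d :+ b :* d′)) :* ((b :* b) :* (d :* d))
                 := ((a′ :* b :+ a :* b′) :* (d :* d) :+ (c′ :* d :+ c :* d′) :* (b :* b)) :* ((b :* d) :* (b :* d)))
                 refl a b c d (∂ a) (∂ b) (∂ c) (∂ d) ⟩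
          ((∂ a * b + a * ∂ b) * (d * d) + (∂ c * d + c * ∂ d) * (b * b)) * ((b * d) * (b * d)) ∎ }
      ; ∂-* = λ { (a / b ∣ _) (c / d ∣ _) → begin
          (∂ (a * c) * (b * d) + (a * c) * ∂ (b * d)) * (((b * b) * d) * (b * (d * d)))
            ≈⟨ *-congʳ (+-cong (*-congʳ (∂-* a c)) (*-congˡ (∂-* b d))) ⟩
          ((∂ a * c + a * ∂ c) * (b * d) + (a * c) * (∂ b * d + b * ∂ d)) * (((b * b) * d) * (b * (d * d)))
            ≈⟨ solve 8 (λ a b c d a′ b′ c′ d′ →
                 ((a′ :* c :+ a :* c′) :* (b :* d) :+ (a :* c) :* (b′ :* d :+ b :* d′)) :* (((b :* b) :* d) :* (b :* (d :* d)))
                 := (((a′ :* b :+ a :* b′) :* c) :* (b :* (d :* d)) :+ (a :* (c′ :* d :+ c :* d′)) :* ((b :* b) :* d)) :* ((b :* d) :* (b :* d)))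
                 refl a b c d (∂ a) (∂ b) (∂ c) (∂ d) ⟩
          (((∂ a * b + a * ∂ b) * c) * (b * (d * d)) + (a * (∂ c * d + c * ∂ d)) * ((b * b) * d)) * ((b * d) * (b * d)) ∎ } }
      where
      open Derivation D
      -- In characteristic 2 the left side is ∂(ad)·bd + ad·∂(bd), which involves the numerators
      -- only through the product ad; the right side is the same expression in cb.
      cong′ : ∀ a b c d → ¬ (b ≈ 0#) → ¬ (d ≈ 0#) → a * d ≈ c * b →
              (∂ a * b + a * ∂ b) * (d * d) ≈ (∂ c * d + c * ∂ d) * (b * b)
      cong′ a b c d nb nd h = begin
        (∂ a * b + a * ∂ b) * (d * d)
          ≈⟨ solve 6 (λ a b d a′ b′ d′ → (a′ :* b :+ a :* b′) :* (d :* d)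
               := (a′ :* d :+ a :* d′) :* (b :* d) :+ (a :* d) :* (b′ :* d :+ b :* d′)) refl a b d (∂ a) (∂ b) (∂ d) ⟩
        (∂ a * d + a * ∂ d) * (b * d) + (a * d) * (∂ b * d + b * ∂ d)
          ≈⟨ +-cong (*-congʳ (trans (sym (∂-* a d)) (trans (∂-cong h) (∂-* c b)))) (*-congʳ h) ⟩
        (∂ c * b + c * ∂ b) * (b * d) + (c * b) * (∂ b * d + b * ∂ d)
          ≈⟨ solve 6 (λ c b d c′ b′ d′ → (c′ :* b :+ c :* b′) :* (b :* d) :+ (c :* b) :* (b′ :* d :+ b :* d′)
               := (c′ :* d :+ c :* d′) :* (b :* b)) refl c b d (∂ c) (∂ b) (∂ d) ⟩
        (∂ c * d + c * ∂ d) * (b * b) ∎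

    extend : ∀ {n} → Coordinates R n → Coordinates Frac n
    extend c = record
      { x = λ j → x j / 1# ∣ 1≉0
      ; ∂/ = λ i → quotientRule (∂/ i)
      ; ∂x = λ i j → trans (*-congʳ (+-cong (*-congʳ (∂x i j)) (*-congˡ (∂1 (∂/ i))))) (∂x′ i j) }
      where
      open Coordinates c
      ∂1 : ∀ D → Derivation.∂ D 1# ≈ 0#
      ∂1 = PolynomialExtension.∂-1 R dom
      ∂x′ : ∀ {m} {y : Carrier} (i j : Fin m) →
            (δ⟨ R ⟩ i j * 1# + y * 0#) * den (δ⟨ Frac ⟩ i j) ≈ num (δ⟨ Frac ⟩ i j) * (1# * 1#)
      ∂x′ zero zero = solve 1 (λ y → (con true :* con true :+ y :* con false) :* con true := con true :* (con true :* con true)) refl _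
      ∂x′ zero (suc j) = solve 1 (λ y → (con false :* con true :+ y :* con false) :* con true := con false :* (con true :* con true)) refl _
      ∂x′ (suc i) zero = solve 1 (λ y → (con false :* con true :+ y :* con false) :* con true := con false :* (con true :* con true)) refl _
      ∂x′ (suc i) (suc j) = ∂x′ i j

open FractionFields

-- Finite sums and Gaussian elimination

module LinearSystems where
  open import Data.Fin.Subset using (Subset; _∈_; _∉_; ∣_∣)
  open import Data.Nat using (zero; suc; _<_; _≤_; s≤s; z≤n)
  open import Relation.Binary.PropositionalEquality as ≡ using (_≡_; _≢_)

  -- Addition of a singleton over 𝔽₂. One commuting involution serves for insertion, removal and,
  -- later, for the parities of exponents.
  toggle : ∀ {n} → Fin n → Subset n → Subset n
  toggle i C = C [ i ]%= not

  lookup-toggle : ∀ {n} (i : Fin n) C → lookup (toggle i C) i ≡ not (lookup C i)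
  lookup-toggle i C = Vecₚ.lookup∘updateAt i C

  lookup-toggle-≢ : ∀ {n} {i j : Fin n} C → j ≢ i → lookup (toggle i C) j ≡ lookup C j
  lookup-toggle-≢ {i = i} {j} C ne = Vecₚ.lookup∘updateAt′ j i ne C

  toggle-comm : ∀ {n} (i j : Fin n) C → toggle i (toggle j C) ≡ toggle j (toggle i C)
  toggle-comm zero    zero    (b ∷ C) = ≡.refl
  toggle-comm zero    (suc j) (b ∷ C) = ≡.refl
  toggle-comm (suc i) zero    (b ∷ C) = ≡.refl
  toggle-comm (suc i) (suc j) (b ∷ C) = ≡.cong (b ∷_) (toggle-comm i j C)

  toggle-involutive : ∀ {n} (i : Fin n) C → toggle i (toggle i C) ≡ C
  toggle-involutive zero    (b ∷ C) = ≡.cong (_∷ C) (Boolₚ.not-involutive b)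
  toggle-involutive (suc i) (b ∷ C) = ≡.cong (b ∷_) (toggle-involutive i C)

  ∣toggle∣ : ∀ {n} (i : Fin n) C → lookup C i ≡ true → ∣ C ∣ ≡ suc ∣ toggle i C ∣
  ∣toggle∣ zero    (true ∷ C) e = ≡.refl
  ∣toggle∣ (suc i) (true ∷ C) e = ≡.cong suc (∣toggle∣ i C e)
  ∣toggle∣ (suc i) (false ∷ C) e = ∣toggle∣ i C e

  ∈-toggle⁻ : ∀ {n} {i j : Fin n} {C} → j ≢ i → j ∈ toggle i C → j ∈ C
  ∈-toggle⁻ {i = i} {j} {C} ne m =
    Vecₚ.lookup⇒[]= j C (≡.trans (≡.sym (lookup-toggle-≢ C ne)) (Vecₚ.[]=⇒lookup m))

  ∈-toggle⁺ : ∀ {n} {i j : Fin n} {C} → j ≢ i → j ∈ C → j ∈ toggle i C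
  ∈-toggle⁺ {i = i} {j} {C} ne m =
    Vecₚ.lookup⇒[]= j _ (≡.trans (lookup-toggle-≢ C ne) (Vecₚ.[]=⇒lookup m))

  ∉-toggle : ∀ {n} {i : Fin n} {C} → i ∈ C → i ∉ toggle i C
  ∉-toggle {i = i} {C} m m′ with ≡.trans (≡.sym (Vecₚ.[]=⇒lookup m′))
    (≡.trans (lookup-toggle i C) (≡.cong not (Vecₚ.[]=⇒lookup m)))
  ... | ()

  nonempty : ∀ {n} (C : Subset n) → 0 < ∣ C ∣ → ∃ λ i → i ∈ C
  nonempty (true ∷ C) _ = zero , Vec.here
  nonempty (false ∷ C) lt with nonempty C lt
  ... | i , m = suc i , Vec.there m

  module Sums (R : CommutativeRing 0ℓ 0ℓ) where
    open CommutativeRing R hiding (zero)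
    private module Σₛ = Algebra.Properties.Semiring.Sum semiring
    open import Relation.Binary.Reasoning.Setoid setoid

    -- Abstract so that unification can read the summand off a sum.
    abstract
      sum : ∀ {n} → (Fin n → Carrier) → Carrier
      sum = Σₛ.sum

      sum-[] : ∀ {f : Fin 0 → Carrier} → sum f ≈ 0#
      sum-[] = refl

      sum-∷ : ∀ {n} {f : Fin (suc n) → Carrier} → sum f ≈ f zero + sum (f ∘ suc)
      sum-∷ = refl

      ∑-distrib-+ : ∀ {n} (f g : Fin n → Carrier) → sum (λ i → f i + g i) ≈ sum f + sum g
      ∑-distrib-+ = Σₛ.∑-distrib-+

      ∑-comm : ∀ {m n} (f : Fin m → Fin n → Carrier) → sum (λ i → sum (λ j → f i j)) ≈ sum (λ j → sum (λ i → f i j))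
      ∑-comm = Σₛ.∑-comm

      *-distribˡ-sum : ∀ {n} x (f : Fin n → Carrier) → x * sum f ≈ sum (λ i → x * f i)
      *-distribˡ-sum = Σₛ.*-distribˡ-sum

      *-distribʳ-sum : ∀ {n} x (f : Fin n → Carrier) → sum f * x ≈ sum (λ i → f i * x)
      *-distribʳ-sum = Σₛ.*-distribʳ-sum

      sum-cong : ∀ {n} {f g : Fin n → Carrier} → (∀ i → f i ≈ g i) → sum f ≈ sum g
      sum-cong {zero}  e = refl
      sum-cong {suc n} e = +-cong (e zero) (sum-cong (e ∘ suc))

      sum-zero : ∀ {n} {f : Fin n → Carrier} → (∀ i → f i ≈ 0#) → sum f ≈ 0#
      sum-zero {n} e = trans (sum-cong e) (Σₛ.sum-replicate-zero n)

    δ : ∀ {n} → Fin n → Fin n → Carrier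
    δ = δ⟨ R ⟩

    δ-refl : ∀ {n} (i : Fin n) → δ i i ≡ 1#
    δ-refl zero    = ≡.refl
    δ-refl (suc i) = δ-refl i

    δ-≢ : ∀ {n} {i j : Fin n} → i ≢ j → δ i j ≡ 0#
    δ-≢ {i = zero} {zero} ne = ⊥-elim (ne ≡.refl)
    δ-≢ {i = zero} {suc j} ne = ≡.refl
    δ-≢ {i = suc i} {zero} ne = ≡.refl
    δ-≢ {i = suc i} {suc j} ne = δ-≢ (ne ∘ ≡.cong suc)

    δ-sym : ∀ {n} (i j : Fin n) → δ i j ≡ δ j i
    δ-sym zero zero = ≡.refl
    δ-sym zero (suc j) = ≡.refl
    δ-sym (suc i) zero = ≡.refl
    δ-sym (suc i) (suc j) = δ-sym i j

    sum-δ : ∀ {n} (i : Fin n) (f : Fin n → Carrier) → sum (λ j → δ i j * f j) ≈ f i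
    sum-δ zero    f = trans sum-∷ (trans (+-cong (*-identityˡ _) (sum-zero (λ j → zeroˡ (f (suc j))))) (+-identityʳ _))
    sum-δ (suc i) f = trans sum-∷ (trans (+-cong (zeroˡ _) (sum-δ i (f ∘ suc))) (+-identityˡ _))

    sum-single : ∀ {n} (i : Fin n) {f : Fin n → Carrier} → (∀ j → j ≢ i → f j ≈ 0#) → sum f ≈ f i
    sum-single i {f} e = trans (sum-cong g) (sum-δ i f)
      where
      g : ∀ j → f j ≈ δ i j * f j
      g j with i Finₚ.≟ j
      ... | yes ≡.refl = trans (sym (*-identityˡ _)) (*-congʳ (reflexive (≡.sym (δ-refl i))))
      ... | no ne = trans (e j (ne ∘ ≡.sym)) (sym (trans (*-congʳ (reflexive (δ-≢ ne))) (zeroˡ _)))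

  module HomogeneousSystems (R : CommutativeRing 0ℓ 0ℓ) (isField : IsField R) where
    open CommutativeRing R hiding (zero)
    open IsField isField
    open Sums R
    open Algebra.Properties.Ring ring using (-‿distribˡ-*)
    open Algebra.Solver.Ring.NaturalCoefficients.Default commutativeSemiring
      using (solve; _:=_; _:+_; _:*_)
    open import Relation.Binary.Reasoning.Setoid setoid

    Solves : ∀ {n M} → Subset n → (Fin M → Fin n → Carrier) → (Fin n → Carrier) → Set
    Solves S A x = (∀ i → i ∉ S → x i ≈ 0#) × (∀ m → sum (λ i → x i * A m i) ≈ 0#)

    Nontrivial OnlyTrivial : ∀ {n M} → Subset n → (Fin M → Fin n → Carrier) → Set
    Nontrivial S A  = Σ (Fin _ → Carrier) λ x → Solves S A x × ∃ λ i → ¬ (x i ≈ 0#)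
    OnlyTrivial S A = ∀ x → Solves S A x → ∀ i → x i ≈ 0#

    -- Gaussian elimination, one equation at a time. An equation with a nonzero coefficient inside
    -- `S` removes one unknown; any other equation is void on `S`. Hence fewer equations than
    -- unknowns force a nontrivial solution, and linear independence is decidable.
    elimination : ∀ {n} M (S : Subset n) (A : Fin M → Fin n → Carrier) →
      Nontrivial S A ⊎ (OnlyTrivial S A × ∣ S ∣ ≤ M)
    elimination zero S A with ∣ S ∣ in eq
    ... | zero = inj₂ ((λ x sol i → proj₁ sol i (λ i∈S → ℕₚ.0≢1+n (≡.trans (≡.sym eq) (∣toggle∣ i S (Vecₚ.[]=⇒lookup i∈S))))) , z≤n)
    ... | suc _ with nonempty S (≡.subst (0 <_) (≡.sym eq) (s≤s z≤n))
    ... | k , k∈S = inj₁ (δ k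
      , ((λ i i∉S → reflexive (δ-≢ {i = k} {i} λ { ≡.refl → i∉S k∈S })) , λ ())
      , k , λ e → 1≉0 (trans (reflexive (≡.sym (δ-refl k))) e))
    elimination {n} (suc M) S A with Finₚ.any? (λ i → (i ∈? S) ×-dec ¬? (A zero i ≟ 0#))
    ... | no none = Sum.map
      (λ { (x , (supp , eqs) , nz) → x , (supp , λ { zero → sum-zero (first x supp) ; (suc m) → eqs m }) , nz })
      (λ { (triv , le) → (λ { x (supp , eqs) → triv x (supp , eqs ∘ suc) }) , ℕₚ.m≤n⇒m≤1+n le })
      (elimination M S (A ∘ suc))
      where
      first : ∀ x → (∀ i → i ∉ S → x i ≈ 0#) → ∀ i → x i * A zero i ≈ 0#
      first x supp i with i ∈? S | A zero i ≟ 0#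
      ... | no i∉S | _ = trans (*-congʳ (supp i i∉S)) (zeroˡ _)
      ... | yes _ | yes z = trans (*-congˡ z) (zeroʳ _)
      ... | yes i∈S | no ¬z = ⊥-elim (none (i , i∈S , ¬z))
    ... | yes (k , k∈S , pivot) = Sum.map nontrivial (λ { (triv , le) → onlyTrivial triv , smaller le }) (elimination M (toggle k S) B)
      where
      r = A zero k ⁻¹
      -- The remaining equations after subtracting multiples of equation zero, so that column `k` of
      -- `B` vanishes.
      B : Fin M → Fin n → Carrier
      B m i = A (suc m) i + - (A (suc m) k * r) * A zero i
      smaller : ∣ toggle k S ∣ ≤ M → ∣ S ∣ ≤ suc M
      smaller le = ≡.subst (_≤ suc M) (≡.sym (∣toggle∣ k S (Vecₚ.[]=⇒lookup k∈S))) (s≤s le)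
      reduce : ∀ y m → sum (λ i → y i * B m i) ≈ sum (λ i → y i * A (suc m) i) + - (A (suc m) k * r) * sum (λ i → y i * A zero i)
      reduce y m = begin
        sum (λ i → y i * B m i) ≈⟨ sum-cong (λ i → distribˡ _ _ _) ⟩
        sum (λ i → y i * A (suc m) i + y i * (- (A (suc m) k * r) * A zero i)) ≈⟨ ∑-distrib-+ _ _ ⟩
        sum (λ i → y i * A (suc m) i) + sum (λ i → y i * (- (A (suc m) k * r) * A zero i)) ≈⟨ +-congˡ (trans
            (sum-cong (λ i → solve 3 (λ a y b → y :* (a :* b) := a :* (y :* b)) refl _ _ _)) (sym (*-distribˡ-sum _ _))) ⟩
        sum (λ i → y i * A (suc m) i) + - (A (suc m) k * r) * sum (λ i → y i * A zero i) ∎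
      split : ∀ y c (f : Fin n → Carrier) → sum (λ i → (y i + c * δ k i) * f i) ≈ sum (λ i → y i * f i) + c * f k
      split y c f = begin
        sum (λ i → (y i + c * δ k i) * f i) ≈⟨ sum-cong (λ i → solve 4 (λ y c d f → (y :+ c :* d) :* f := y :* f :+ c :* (d :* f)) refl _ _ _ _) ⟩
        sum (λ i → y i * f i + c * (δ k i * f i)) ≈⟨ ∑-distrib-+ _ _ ⟩
        sum (λ i → y i * f i) + sum (λ i → c * (δ k i * f i)) ≈⟨ +-congˡ (sym (*-distribˡ-sum c _)) ⟩
        sum (λ i → y i * f i) + c * sum (λ i → δ k i * f i) ≈⟨ +-congˡ (*-congˡ (sum-δ k f)) ⟩
        sum (λ i → y i * f i) + c * f k ∎
      unchanged : ∀ {y : Fin n → Carrier} {c i} → k ≢ i → y i + c * δ k i ≈ y i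
      unchanged ne = trans (+-congˡ (trans (*-congˡ (reflexive (δ-≢ ne))) (zeroʳ _))) (+-identityʳ _)
      undo : ∀ x s → - (x * r * s) ≈ - (x * r) * s
      undo x s = -‿distribˡ-* _ _
      divide : ∀ s → - (r * s) * A zero k ≈ - s
      divide s = trans (sym (-‿distribˡ-* _ _)) (-‿cong (trans (solve 3 (λ r s a → r :* s :* a := a :* r :* s) refl _ _ _)
                                       (trans (*-congʳ (inverse pivot)) (*-identityˡ s))))
      nontrivial : Nontrivial (toggle k S) B → Nontrivial S A
      nontrivial (y , (y-supp , y-eqs) , (i , yi≉0)) = x , (supp , eqs)
        , i , λ e → yi≉0 (trans (sym (unchanged {y} (λ { ≡.refl → yi≉0 (y-supp k (∉-toggle k∈S)) }))) e)
        where
        s = sum (λ i → y i * A zero i)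
        -- The value at `k`, where `y` vanishes, is chosen so as to solve equation zero.
        c = - (r * s)
        x : Fin n → Carrier
        x i = y i + c * δ k i
        supp : ∀ i → i ∉ S → x i ≈ 0#
        supp i i∉S = trans (unchanged {y} (λ { ≡.refl → i∉S k∈S }))
          (y-supp i (λ m → i∉S (∈-toggle⁻ (λ { ≡.refl → i∉S k∈S }) m)))
        eqs : ∀ m → sum (λ i → x i * A m i) ≈ 0#
        eqs zero = trans (split y c (A zero)) (trans (+-congˡ (divide s)) (-‿inverseʳ s))
        eqs (suc m) = begin
          sum (λ i → x i * A (suc m) i) ≈⟨ split y c (A (suc m)) ⟩
          sum (λ i → y i * A (suc m) i) + c * A (suc m) k ≈⟨ +-congˡ (trans (sym (-‿distribˡ-* _ _))
              (trans (-‿cong (solve 3 (λ r s a → r :* s :* a := a :* r :* s) refl _ _ _)) (undo _ s))) ⟩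
          sum (λ i → y i * A (suc m) i) + - (A (suc m) k * r) * s ≈⟨ reduce y m ⟨
          sum (λ i → y i * B m i) ≈⟨ y-eqs m ⟩
          0# ∎
      onlyTrivial : OnlyTrivial (toggle k S) B → OnlyTrivial S A
      onlyTrivial triv x (supp , eqs) = zero-everywhere
        where
        c = - x k
        y : Fin n → Carrier
        y i = x i + c * δ k i
        y-k : y k ≈ 0#
        y-k = trans (+-congˡ (trans (*-congˡ (reflexive (δ-refl k))) (*-identityʳ _))) (-‿inverseʳ _)
        y-supp : ∀ i → i ∉ toggle k S → y i ≈ 0#
        y-supp i i∉ with i Finₚ.≟ k
        ... | yes ≡.refl = y-k
        ... | no i≢k = trans (unchanged {x} (i≢k ∘ ≡.sym)) (supp i (λ i∈S → i∉ (∈-toggle⁺ i≢k i∈S)))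
        value : ∀ m → sum (λ i → y i * A m i) ≈ c * A m k
        value m = trans (split x c (A m)) (trans (+-congʳ (eqs m)) (+-identityˡ _))
        y-eqs : ∀ m → sum (λ i → y i * B m i) ≈ 0#
        y-eqs m = begin
          sum (λ i → y i * B m i) ≈⟨ reduce y m ⟩
          sum (λ i → y i * A (suc m) i) + - (A (suc m) k * r) * sum (λ i → y i * A zero i) ≈⟨ +-cong (value (suc m)) (*-congˡ (value zero)) ⟩
          c * A (suc m) k + - (A (suc m) k * r) * (c * A zero k) ≈⟨ +-congˡ (trans (sym (-‿distribˡ-* _ _)) (-‿cong (trans
              (solve 4 (λ a r c p → (a :* r) :* (c :* p) := (p :* r) :* (c :* a)) refl _ _ _ _) (trans (*-congʳ (inverse pivot)) (*-identityˡ _))))) ⟩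
          c * A (suc m) k + - (c * A (suc m) k) ≈⟨ -‿inverseʳ _ ⟩
          0# ∎
        y≈0 : ∀ i → y i ≈ 0#
        y≈0 = triv y (y-supp , y-eqs)
        c≈0 : c ≈ 0#
        c≈0 = integral pivot (trans (*-comm _ _) (trans (sym (value zero)) (sum-zero (λ i → trans (*-congʳ (y≈0 i)) (zeroˡ _)))))
        zero-everywhere : ∀ i → x i ≈ 0#
        zero-everywhere i = trans (sym (trans (+-congˡ (trans (*-congʳ c≈0) (zeroˡ _))) (+-identityʳ _))) (y≈0 i)

    nontrivial-solution : ∀ {n} M (S : Subset n) → M < ∣ S ∣ → (A : Fin M → Fin n → Carrier) → Nontrivial S A
    nontrivial-solution M S lt A with elimination M S A
    ... | inj₁ sol = sol
    ... | inj₂ (_ , le) = ⊥-elim (ℕₚ.<⇒≱ lt le)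

open LinearSystems

-- Determinants in characteristic 2, computed as permanents

module Permanents where
  open import Data.Fin.Subset using (Subset; ∣_∣)
  open import Data.Nat using (ℕ; zero; suc)
  open import Relation.Binary.PropositionalEquality as ≡ using (_≡_; _≢_)

  toggles : ∀ {n} → Subset n → List (Fin n) → Subset n
  toggles = foldr toggle

  toggle-toggles : ∀ {n} (i : Fin n) C J → toggle i (toggles C J) ≡ toggles (toggle i C) J
  toggle-toggles i C []      = ≡.refl
  toggle-toggles i C (j ∷ J) = ≡.trans (toggle-comm i j _) (≡.cong (toggle j) (toggle-toggles i C J))

  toggles-twice : ∀ {n} C (J : List (Fin n)) → toggles (toggles C J) J ≡ C
  toggles-twice C []      = ≡.refl
  toggles-twice C (j ∷ J) = ≡.trans (≡.cong (toggle j) (≡.sym (toggle-toggles j _ J)))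
    (≡.trans (toggle-involutive j _) (toggles-twice C J))

  toggles-ʳ++ : ∀ {n} C (J I : List (Fin n)) → toggles C (J ʳ++ I) ≡ toggles (toggles C I) J
  toggles-ʳ++ C []      I = ≡.refl
  toggles-ʳ++ C (j ∷ J) I = ≡.trans (toggles-ʳ++ C J (j ∷ I)) (≡.sym (toggle-toggles j _ J))

  elems : ∀ {n} → Subset n → List (Fin n)
  elems []          = []
  elems (true ∷ C)  = zero ∷ map suc (elems C)
  elems (false ∷ C) = map suc (elems C)

  -- Dropping the head of the list is removing the least element, so derivatives along `elems C` can
  -- be taken column by column.
  elems-first : ∀ {n} {k} (C : Subset n) → ∣ C ∣ ≡ suc k →
    ∃ λ j → lookup C j ≡ true × elems C ≡ j ∷ elems (toggle j C)
  elems-first (true ∷ C)  e = zero , ≡.refl , ≡.refl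
  elems-first (false ∷ C) e with elems-first C e
  ... | j , j∈C , f = suc j , j∈C , ≡.cong (map suc) f

  module Char2 (R : CommutativeRing 0ℓ 0ℓ) (isField : IsField R)
    (x+x≈0 : ∀ x → CommutativeRing._≈_ R (CommutativeRing._+_ R x x) (CommutativeRing.0# R)) where
    open CommutativeRing R hiding (zero)
    open IsField isField
    open Sums R
    open Char2Solver R x+x≈0
    open Derivation
    open import Relation.Binary.Reasoning.Setoid setoid

    +-move : ∀ {x y z} → x + y ≈ z → y ≈ x + z
    +-move {x} {y} {z} e = trans (solve 2 (λ x y → y := x :+ (x :+ y)) refl x y) (+-congˡ e)

    +-zero⇒≈ : ∀ {x y} → x + y ≈ 0# → x ≈ y
    +-zero⇒≈ {x} {y} e = trans (solve 2 (λ x y → x := (x :+ y) :+ y) refl x y) (trans (+-congʳ e) (+-identityˡ y))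

    module _ (D : Derivation R) where
      ∂-zero : ∂ D 0# ≈ 0#
      ∂-zero = begin
        ∂ D 0# ≈⟨ ∂-cong D (zeroˡ 0#) ⟨
        ∂ D (0# * 0#) ≈⟨ ∂-* D _ _ ⟩
        ∂ D 0# * 0# + 0# * ∂ D 0# ≈⟨ +-cong (zeroʳ _) (zeroˡ _) ⟩
        0# + 0# ≈⟨ +-identityˡ _ ⟩
        0# ∎

      ∂-square : ∀ x → ∂ D (x * x) ≈ 0#
      ∂-square x = trans (∂-* D x x) (solve 2 (λ x y → y :* x :+ x :* y := con false) refl x (∂ D x))

      ∂-one : ∂ D 1# ≈ 0#
      ∂-one = trans (∂-cong D (sym (*-identityˡ 1#))) (∂-square 1#)

      ∂-square-* : ∀ c x → ∂ D ((c * c) * x) ≈ (c * c) * ∂ D x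
      ∂-square-* c x = trans (∂-* D _ _) (trans (+-congʳ (trans (*-congʳ (∂-square c)) (zeroˡ _))) (+-identityˡ _))

      ∂-const-* : ∀ {c x} → ∂ D c ≈ 0# → ∂ D (c * x) ≈ c * ∂ D x
      ∂-const-* e = trans (∂-* D _ _) (trans (+-congʳ (trans (*-congʳ e) (zeroˡ _))) (+-identityˡ _))

      ∂-sum : ∀ {n} (f : Fin n → Carrier) → ∂ D (sum f) ≈ sum (λ i → ∂ D (f i))
      ∂-sum {zero}  f = trans (∂-cong D sum-[]) (trans ∂-zero (sym sum-[]))
      ∂-sum {suc n} f = trans (∂-cong D sum-∷) (trans (∂-+ D _ _) (trans (+-congˡ (∂-sum (f ∘ suc))) (sym sum-∷)))

      ∂-δ : ∀ {n} (i j : Fin n) → ∂ D (δ i j) ≈ 0#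
      ∂-δ zero zero = ∂-one
      ∂-δ zero (suc j) = ∂-zero
      ∂-δ (suc i) zero = ∂-zero
      ∂-δ (suc i) (suc j) = ∂-δ i j

      ∂-cancel : ∀ {x y d} → ¬ (x ≈ 0#) → x * y ≈ d → ∂ D x ≈ 0# → ∂ D d ≈ 0# → ∂ D y ≈ 0#
      ∂-cancel {x} {y} {d} nz e ex ed = integral nz (begin
        x * ∂ D y ≈⟨ ∂-const-* ex ⟨
        ∂ D (x * y) ≈⟨ ∂-cong D e ⟩
        ∂ D d ≈⟨ ed ⟩
        0# ∎)

    combination : ∀ {n} → (Fin n → Carrier) → (Fin n → Derivation R) → Derivation R
    combination c E = record
      { ∂ = λ x → sum (λ s → c s * ∂ (E s) x)
      ; ∂-cong = λ e → sum-cong (λ s → *-congˡ (∂-cong (E s) e))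
      ; ∂-+ = λ x y → trans (sum-cong (λ s → trans (*-congˡ (∂-+ (E s) x y)) (distribˡ _ _ _))) (∑-distrib-+ _ _)
      ; ∂-* = λ x y → trans (sum-cong (λ s → trans (*-congˡ (∂-* (E s) x y))
            (solve 5 (λ c dx y x dy → c :* (dx :* y :+ x :* dy) := (c :* dx) :* y :+ x :* (c :* dy)) refl (c s) _ _ _ _)))
          (trans (∑-distrib-+ _ _) (+-cong (sym (*-distribʳ-sum y _)) (sym (*-distribˡ-sum x _)))) }

    ⟦_⟧ : Bool → Carrier
    ⟦ true ⟧  = 1#
    ⟦ false ⟧ = 0#

    ind : ∀ {n} → Subset n → Fin n → Carrier
    ind C i = ⟦ lookup C i ⟧

    ind-toggle : ∀ {n} (i : Fin n) C j → ind (toggle i C) j ≈ ind C j + δ i j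
    ind-toggle zero (true ∷ C) zero = sym (x+x≈0 1#)
    ind-toggle zero (false ∷ C) zero = sym (+-identityˡ 1#)
    ind-toggle zero (b ∷ C) (suc j) = sym (+-identityʳ _)
    ind-toggle (suc i) (b ∷ C) zero = sym (+-identityʳ _)
    ind-toggle (suc i) (b ∷ C) (suc j) = ind-toggle i C j

    ∂-ind : ∀ {n} D (C : Subset n) i → ∂ D (ind C i) ≈ 0#
    ∂-ind D C i with lookup C i
    ... | true  = ∂-one D
    ... | false = ∂-zero D

    -- The sum, over all injections of the rows into C, of the products of the chosen entries:
    -- for as many rows as columns this is the permanent, which in characteristic 2 is the determinant.
    perm : ∀ {A : Set} {n} → (A → Fin n → Carrier) → List A → Subset n → Carrier
    perm X []       C = 1#
    perm X (r ∷ rs) C = sum (λ i → ind C i * (X r i * perm X rs (toggle i C)))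

    rowSum : ∀ {n} → (Fin n → Carrier) → Subset n → Carrier
    rowSum x C = sum (λ i → ind C i * x i)

    rowSum-toggle : ∀ {n} (x : Fin n → Carrier) i C → rowSum x (toggle i C) ≈ rowSum x C + x i
    rowSum-toggle x i C = begin
      sum (λ j → ind (toggle i C) j * x j) ≈⟨ sum-cong (λ j → trans (*-congʳ (ind-toggle i C j)) (distribʳ _ _ _)) ⟩
      sum (λ j → ind C j * x j + δ i j * x j) ≈⟨ ∑-distrib-+ _ _ ⟩
      rowSum x C + sum (λ j → δ i j * x j) ≈⟨ +-congˡ (sum-δ i x) ⟩
      rowSum x C + x i ∎

    module _ {A : Set} {n : ℕ} (X : A → Fin n → Carrier) where

      -- Expanding two rows sums over ordered pairs of columns. The factor
      -- `ind C i * ind (toggle i C) j` is symmetric in i and j and vanishes for i = j.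
      perm-swap : ∀ r s rs C → perm X (r ∷ s ∷ rs) C ≈ perm X (s ∷ r ∷ rs) C
      perm-swap r s rs C = begin
        sum (λ i → ind C i * (X r i * sum (λ j → ind (toggle i C) j * (X s j * perm X rs (toggle j (toggle i C))))))
          ≈⟨ sum-cong (λ i → trans (*-congˡ (*-distribˡ-sum _ _)) (*-distribˡ-sum _ _)) ⟩
        sum (λ i → sum (λ j → ind C i * (X r i * (ind (toggle i C) j * (X s j * perm X rs (toggle j (toggle i C)))))))
          ≈⟨ ∑-comm _ ⟩
        sum (λ j → sum (λ i → ind C i * (X r i * (ind (toggle i C) j * (X s j * perm X rs (toggle j (toggle i C)))))))
          ≈⟨ sum-cong (λ j → sum-cong (λ i → begin
               ind C i * (X r i * (ind (toggle i C) j * (X s j * perm X rs (toggle j (toggle i C)))))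
                 ≈⟨ solve 5 (λ a b c d e → a :* (b :* (c :* (d :* e))) := (a :* c) :* (d :* (b :* e))) refl _ _ _ _ _ ⟩
               (ind C i * ind (toggle i C) j) * (X s j * (X r i * perm X rs (toggle j (toggle i C))))
                 ≈⟨ *-cong (symmetric i j) (*-congˡ (*-congˡ (reflexive (≡.cong (perm X rs) (toggle-comm j i C))))) ⟩
               (ind C j * ind (toggle j C) i) * (X s j * (X r i * perm X rs (toggle i (toggle j C))))
                 ≈⟨ solve 5 (λ a b c d e → (a :* c) :* (d :* (b :* e)) := a :* (d :* (c :* (b :* e)))) refl _ _ _ _ _ ⟩
               ind C j * (X s j * (ind (toggle j C) i * (X r i * perm X rs (toggle i (toggle j C))))) ∎)) ⟩
        sum (λ j → sum (λ i → ind C j * (X s j * (ind (toggle j C) i * (X r i * perm X rs (toggle i (toggle j C)))))))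
          ≈⟨ sum-cong (λ j → trans (*-congˡ (*-distribˡ-sum _ _)) (*-distribˡ-sum _ _)) ⟨
        perm X (s ∷ r ∷ rs) C ∎
        where
        symmetric : ∀ i j → ind C i * ind (toggle i C) j ≈ ind C j * ind (toggle j C) i
        symmetric i j with i Finₚ.≟ j
        ... | yes ≡.refl = refl
        ... | no i≢j = trans (*-comm _ _) (*-cong
          (reflexive (≡.cong ⟦_⟧ (lookup-toggle-≢ C (i≢j ∘ ≡.sym))))
          (reflexive (≡.cong ⟦_⟧ (≡.sym (lookup-toggle-≢ C i≢j)))))

      ∂-perm : ∀ D r rs C → ∂ D (perm X (r ∷ rs) C) ≈
        sum (λ i → ind C i * (∂ D (X r i) * perm X rs (toggle i C) + X r i * ∂ D (perm X rs (toggle i C))))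
      ∂-perm D r rs C = trans (∂-sum D _) (sum-cong (λ i →
        trans (∂-const-* D (∂-ind D C i)) (*-congˡ (∂-* D _ _))))

      perm-constant : ∀ D rs → All (λ r → ∀ i → ∂ D (X r i) ≈ 0#) rs → ∀ C → ∂ D (perm X rs C) ≈ 0#
      perm-constant D []       []       C = ∂-one D
      perm-constant D (r ∷ rs) (e ∷ es) C = trans (∂-perm D r rs C) (sum-zero (λ i →
        trans (*-congˡ (trans (+-cong (trans (*-congʳ (e i)) (zeroˡ _)) (trans (*-congˡ (perm-constant D rs es _)) (zeroʳ _))) (+-identityˡ _))) (zeroʳ _)))

      module _ (D : Derivation R) (i : Fin n) (y : A → Carrier) (DX : ∀ r k → ∂ D (X r k) ≈ δ i k * y r) where

        -- Such a derivation acts on column `i` alone, writing `y` in its place; what does not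
        -- involve that column is constant.
        replace-absent : ∀ rs C → lookup C i ≡ false → ∂ D (perm X rs C) ≈ 0#
        replace-absent []       C e = ∂-one D
        replace-absent (r ∷ rs) C e = trans (∂-perm D r rs C) (sum-zero term)
          where
          term : ∀ k → ind C k * (∂ D (X r k) * perm X rs (toggle k C) + X r k * ∂ D (perm X rs (toggle k C))) ≈ 0#
          term k with i Finₚ.≟ k
          ... | yes ≡.refl = trans (*-congʳ (reflexive (≡.cong ⟦_⟧ e))) (zeroˡ _)
          ... | no i≢k = trans (*-congˡ (trans (+-cong
              (trans (*-congʳ (trans (DX r k) (trans (*-congʳ (reflexive (δ-≢ i≢k))) (zeroˡ _)))) (zeroˡ _))
              (trans (*-congˡ (replace-absent rs (toggle k C) (≡.trans (lookup-toggle-≢ C i≢k) e))) (zeroʳ _)))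
              (+-identityˡ _))) (zeroʳ _)

        ∂-perm-column : ∀ r rs C → lookup C i ≡ true → ∂ D (perm X (r ∷ rs) C) ≈
          y r * perm X rs (toggle i C) + sum (λ k → ind C k * (X r k * ∂ D (perm X rs (toggle k C))))
        ∂-perm-column r rs C i∈C = begin
          ∂ D (perm X (r ∷ rs) C) ≈⟨ ∂-perm D r rs C ⟩
          sum (λ k → ind C k * (∂ D (X r k) * perm X rs (toggle k C) + X r k * ∂ D (perm X rs (toggle k C))))
            ≈⟨ sum-cong (λ k → trans (*-congˡ (+-congʳ (*-congʳ (DX r k))))
                 (solve 5 (λ c d y q w → c :* (d :* y :* q :+ w) := d :* (c :* (y :* q)) :+ c :* w) refl _ _ _ _ _)) ⟩
          sum (λ k → δ i k * (ind C k * (y r * perm X rs (toggle k C))) + ind C k * (X r k * ∂ D (perm X rs (toggle k C))))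
            ≈⟨ ∑-distrib-+ _ _ ⟩
          sum (λ k → δ i k * (ind C k * (y r * perm X rs (toggle k C)))) + sum (λ k → ind C k * (X r k * ∂ D (perm X rs (toggle k C))))
            ≈⟨ +-congʳ (trans (sum-δ i _) (trans (*-congʳ (reflexive (≡.cong ⟦_⟧ i∈C))) (*-identityˡ _))) ⟩
          y r * perm X rs (toggle i C) + sum (λ k → ind C k * (X r k * ∂ D (perm X rs (toggle k C)))) ∎

      module _ (D : Derivation R) (i : Fin n) (DX : ∀ r k → ∂ D (X r k) ≈ δ i k * X r i) where

        -- A Euler operator: a square permanent is linear in each of its columns. With fewer rows
        -- than columns some injections would miss column `i`.
        replace-same : ∀ rs C → length rs ≡ ∣ C ∣ → lookup C i ≡ true → ∂ D (perm X rs C) ≈ perm X rs C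
        replace-same [] C len i∈C with ≡.trans len (∣toggle∣ i C i∈C)
        ... | ()
        replace-same (r ∷ rs) C len i∈C = begin
          ∂ D (perm X (r ∷ rs) C) ≈⟨ ∂-perm-column D i (λ s → X s i) DX r rs C i∈C ⟩
          X r i * perm X rs (toggle i C) + sum (λ k → ind C k * (X r k * ∂ D (perm X rs (toggle k C))))
            ≈⟨ +-congˡ (trans (sum-cong term) (∑-distrib-+ _ _)) ⟩
          X r i * perm X rs (toggle i C) + (perm X (r ∷ rs) C + sum (λ k → δ i k * (X r k * perm X rs (toggle k C))))
            ≈⟨ +-congˡ (+-congˡ (sum-δ i _)) ⟩
          X r i * perm X rs (toggle i C) + (perm X (r ∷ rs) C + X r i * perm X rs (toggle i C))
            ≈⟨ solve 2 (λ x y → x :+ (y :+ x) := y) refl _ _ ⟩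
          perm X (r ∷ rs) C ∎
          where
          -- The left side lacks the term k = i of the expansion of the permanent. It is added a
          -- second time on the right, where it cancels the first summand above.
          term : ∀ k → ind C k * (X r k * ∂ D (perm X rs (toggle k C))) ≈
                       ind C k * (X r k * perm X rs (toggle k C)) + δ i k * (X r k * perm X rs (toggle k C))
          term k with i Finₚ.≟ k
          ... | yes ≡.refl = begin
            ind C i * (X r i * ∂ D (perm X rs (toggle i C)))
              ≈⟨ *-congˡ (*-congˡ (replace-absent D i (λ s → X s i) DX rs (toggle i C) (≡.trans (lookup-toggle i C) (≡.cong not i∈C)))) ⟩
            ind C i * (X r i * 0#) ≈⟨ solve 3 (λ c x y → c :* (x :* con false) := con true :* (x :* y) :+ con true :* (x :* y)) refl _ _ _ ⟩
            1# * (X r i * perm X rs (toggle i C)) + 1# * (X r i * perm X rs (toggle i C))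
              ≈⟨ +-cong (*-congʳ (reflexive (≡.cong ⟦_⟧ (≡.sym i∈C)))) (*-congʳ (reflexive (≡.sym (δ-refl i)))) ⟩
            ind C i * (X r i * perm X rs (toggle i C)) + δ i i * (X r i * perm X rs (toggle i C)) ∎
          ... | no i≢k with lookup C k in eq
          ... | true = trans (*-congˡ (*-congˡ (replace-same rs (toggle k C)
                           (ℕₚ.suc-injective (≡.trans len (∣toggle∣ k C eq))) (≡.trans (lookup-toggle-≢ C i≢k) i∈C))))
                         (sym (trans (+-congˡ (trans (*-congʳ (reflexive (δ-≢ i≢k))) (zeroˡ _))) (+-identityʳ _)))
          ... | false = trans (zeroˡ _) (sym (trans (+-cong (zeroˡ _) (trans (*-congʳ (reflexive (δ-≢ i≢k))) (zeroˡ _))) (+-identityˡ _)))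

      module _ (D : Derivation R) {i j : Fin n} (i≢j : i ≢ j) (DX : ∀ r k → ∂ D (X r k) ≈ δ i k * X r j) where

        -- A copy of column `j` stands in position `i`, and the true column `j` is not in `C`; so
        -- the permanent is that of `C` with `i` traded for `j`.
        replace-outside : ∀ rs C → length rs ≡ ∣ C ∣ → lookup C i ≡ true → lookup C j ≡ false →
          ∂ D (perm X rs C) ≈ perm X rs (toggle i (toggle j C))
        replace-outside [] C len i∈C _ with ≡.trans len (∣toggle∣ i C i∈C)
        ... | ()
        replace-outside (r ∷ rs) C len i∈C j∉C = begin
          ∂ D (perm X (r ∷ rs) C) ≈⟨ ∂-perm-column D i (λ s → X s j) DX r rs C i∈C ⟩
          X r j * perm X rs (toggle i C) + sum (λ k → ind C k * (X r k * ∂ D (perm X rs (toggle k C))))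
            ≈⟨ +-congˡ (trans (sum-cong term) (∑-distrib-+ _ _)) ⟩
          X r j * perm X rs (toggle i C) + (perm X (r ∷ rs) C′ + sum (λ k → δ j k * (X r k * perm X rs (toggle i C))))
            ≈⟨ +-congˡ (+-congˡ (sum-δ j _)) ⟩
          X r j * perm X rs (toggle i C) + (perm X (r ∷ rs) C′ + X r j * perm X rs (toggle i C))
            ≈⟨ solve 2 (λ x y → x :+ (y :+ x) := y) refl _ _ ⟩
          perm X (r ∷ rs) C′ ∎
          where
          C′ = toggle i (toggle j C)
          j∈C′ : lookup C′ j ≡ true
          j∈C′ = ≡.trans (lookup-toggle-≢ (toggle j C) (i≢j ∘ ≡.sym)) (≡.trans (lookup-toggle j C) (≡.cong not j∉C))
          i∉C′ : lookup C′ i ≡ false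
          i∉C′ = ≡.trans (lookup-toggle i (toggle j C)) (≡.cong not (≡.trans (lookup-toggle-≢ C i≢j) i∈C))
          removed : toggle j C′ ≡ toggle i C
          removed = ≡.trans (toggle-comm j i _) (≡.cong (toggle i) (toggle-involutive j C))
          term : ∀ k → ind C k * (X r k * ∂ D (perm X rs (toggle k C))) ≈
                       ind C′ k * (X r k * perm X rs (toggle k C′)) + δ j k * (X r k * perm X rs (toggle i C))
          term k with i Finₚ.≟ k | j Finₚ.≟ k
          ... | yes ≡.refl | _ = begin
            ind C i * (X r i * ∂ D (perm X rs (toggle i C)))
              ≈⟨ *-congˡ (*-congˡ (replace-absent D i (λ s → X s j) DX rs (toggle i C) (≡.trans (lookup-toggle i C) (≡.cong not i∈C)))) ⟩
            ind C i * (X r i * 0#) ≈⟨ solve 4 (λ c x y w → c :* (x :* con false) := con false :* (x :* y) :+ con false :* w) refl _ _ _ _ ⟩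
            0# * (X r i * perm X rs (toggle i C′)) + 0# * (X r i * perm X rs (toggle i C))
              ≈⟨ +-cong (*-congʳ (reflexive (≡.cong ⟦_⟧ (≡.sym i∉C′)))) (*-congʳ (reflexive (≡.sym (δ-≢ (i≢j ∘ ≡.sym))))) ⟩
            ind C′ i * (X r i * perm X rs (toggle i C′)) + δ j i * (X r i * perm X rs (toggle i C)) ∎
          ... | no _ | yes ≡.refl = begin
            ind C j * (X r j * ∂ D (perm X rs (toggle j C))) ≈⟨ trans (*-congʳ (reflexive (≡.cong ⟦_⟧ j∉C))) (zeroˡ _) ⟩
            0# ≈⟨ solve 1 (λ w → con false := con true :* w :+ con true :* w) refl _ ⟩
            1# * (X r j * perm X rs (toggle i C)) + 1# * (X r j * perm X rs (toggle i C))
              ≈⟨ +-cong (*-cong (reflexive (≡.cong ⟦_⟧ (≡.sym j∈C′))) (*-congˡ (reflexive (≡.cong (perm X rs) (≡.sym removed)))))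
                        (*-congʳ (reflexive (≡.sym (δ-refl j)))) ⟩
            ind C′ j * (X r j * perm X rs (toggle j C′)) + δ j j * (X r j * perm X rs (toggle i C)) ∎
          ... | no i≢k | no j≢k = trans other (sym (trans (+-congˡ (trans (*-congʳ (reflexive (δ-≢ j≢k))) (zeroˡ _))) (+-identityʳ _)))
            where
            same : lookup C′ k ≡ lookup C k
            same = ≡.trans (lookup-toggle-≢ (toggle j C) (i≢k ∘ ≡.sym)) (lookup-toggle-≢ C (j≢k ∘ ≡.sym))
            shuffle : toggle i (toggle j (toggle k C)) ≡ toggle k C′
            shuffle = ≡.trans (≡.cong (toggle i) (toggle-comm j k C)) (toggle-comm i k _)
            other : ind C k * (X r k * ∂ D (perm X rs (toggle k C))) ≈ ind C′ k * (X r k * perm X rs (toggle k C′))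
            other with lookup C k in eq
            ... | true = *-cong (reflexive (≡.cong ⟦_⟧ (≡.sym (≡.trans same eq)))) (*-congˡ (trans
              (replace-outside rs (toggle k C) (ℕₚ.suc-injective (≡.trans len (∣toggle∣ k C eq)))
                (≡.trans (lookup-toggle-≢ C i≢k) i∈C) (≡.trans (lookup-toggle-≢ C j≢k) j∉C))
              (reflexive (≡.cong (perm X rs) shuffle))))
            ... | false = trans (zeroˡ _) (sym (trans (*-congʳ (reflexive (≡.cong ⟦_⟧ (≡.trans same eq)))) (zeroˡ _)))

        -- A determinant with two equal columns. In the expansion along the first row, the two terms
        -- that use one of the equal columns coincide and cancel; the other minors still contain
        -- both columns and vanish by induction.
        replace-inside : ∀ rs C → length rs ≡ ∣ C ∣ → lookup C i ≡ true → lookup C j ≡ true → ∂ D (perm X rs C) ≈ 0#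
        replace-inside [] C len i∈C _ with ≡.trans len (∣toggle∣ i C i∈C)
        ... | ()
        replace-inside (r ∷ rs) C len i∈C j∈C = begin
          ∂ D (perm X (r ∷ rs) C) ≈⟨ ∂-perm-column D i (λ s → X s j) DX r rs C i∈C ⟩
          X r j * perm X rs (toggle i C) + sum (λ k → ind C k * (X r k * ∂ D (perm X rs (toggle k C))))
            ≈⟨ +-congˡ (trans (sum-cong term) (sum-δ j _)) ⟩
          X r j * perm X rs (toggle i C) + X r j * perm X rs (toggle i C) ≈⟨ x+x≈0 _ ⟩
          0# ∎
          where
          term : ∀ k → ind C k * (X r k * ∂ D (perm X rs (toggle k C))) ≈ δ j k * (X r k * perm X rs (toggle i C))
          term k with j Finₚ.≟ k | i Finₚ.≟ k
          ... | yes ≡.refl | _ = *-cong (trans (reflexive (≡.cong ⟦_⟧ j∈C)) (reflexive (≡.sym (δ-refl j)))) (*-congˡ (trans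
            (replace-outside rs (toggle j C) (ℕₚ.suc-injective (≡.trans len (∣toggle∣ j C j∈C)))
                (≡.trans (lookup-toggle-≢ C i≢j) i∈C) (≡.trans (lookup-toggle j C) (≡.cong not j∈C)))
            (reflexive (≡.cong (perm X rs ∘ toggle i) (toggle-involutive j C)))))
          ... | no j≢k | yes ≡.refl = trans (*-congˡ (trans (*-congˡ
              (replace-absent D i (λ s → X s j) DX rs (toggle i C) (≡.trans (lookup-toggle i C) (≡.cong not i∈C)))) (zeroʳ _)))
              (trans (zeroʳ _) (sym (trans (*-congʳ (reflexive (δ-≢ j≢k))) (zeroˡ _))))
          ... | no j≢k | no i≢k = trans zeroTerm (sym (trans (*-congʳ (reflexive (δ-≢ j≢k))) (zeroˡ _)))
            where
            zeroTerm : ind C k * (X r k * ∂ D (perm X rs (toggle k C))) ≈ 0#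
            zeroTerm with lookup C k in eq
            ... | true = trans (*-congˡ (trans (*-congˡ (replace-inside rs (toggle k C)
                    (ℕₚ.suc-injective (≡.trans len (∣toggle∣ k C eq)))
                    (≡.trans (lookup-toggle-≢ C i≢k) i∈C) (≡.trans (lookup-toggle-≢ C j≢k) j∈C))) (zeroʳ _))) (zeroʳ _)
            ... | false = zeroˡ _

      -- Adding a row t to the injections recorded by perm amounts to one more logarithmic derivative.
      perm-log-derivative : ∀ D l t (q : Carrier) →
        (∀ s i → ∂ D (X s i) ≈ q * (X t i * (X s l + X s i))) → ∀ T C →
        q * (rowSum (X t) (toggle l C) * perm X T C) + ∂ D (perm X T C) ≈ q * perm X (t ∷ T) (toggle l C)
      perm-log-derivative D l t q DX [] C = begin
        q * (rowSum (X t) C′ * 1#) + ∂ D 1# ≈⟨ +-cong (*-congˡ (*-identityʳ _)) (∂-one D) ⟩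
        q * rowSum (X t) C′ + 0# ≈⟨ +-identityʳ _ ⟩
        q * rowSum (X t) C′ ≈⟨ *-congˡ (sum-cong (λ i → *-congˡ (sym (*-identityʳ _)))) ⟩
        q * perm X (t ∷ []) C′ ∎
        where C′ = toggle l C
      perm-log-derivative D l t q DX (s ∷ T) C = begin
        q * (Y * perm X (s ∷ T) C) + ∂ D (perm X (s ∷ T) C)
          ≈⟨ +-cong (trans (*-congˡ (*-distribˡ-sum _ _)) (*-distribˡ-sum _ _)) (∂-perm D s T C) ⟩
        sum (λ i → q * (Y * (ind C i * (X s i * p i)))) + sum (λ i → ind C i * (∂ D (X s i) * p i + X s i * ∂ D (p i)))
          ≈⟨ ∑-distrib-+ _ _ ⟨
        sum (λ i → q * (Y * (ind C i * (X s i * p i))) + ind C i * (∂ D (X s i) * p i + X s i * ∂ D (p i)))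
          ≈⟨ sum-cong (λ i → trans (+-congˡ (*-congˡ (+-cong (*-congʳ (DX s i)) (*-congˡ (step i)))))
               (solve 8 (λ q Y c z p t l u →
                 q :* (Y :* (c :* (z :* p))) :+ c :* ((q :* (t :* (l :+ z))) :* p :+ z :* (q :* ((Y :+ t) :* p) :+ q :* u))
                 := q :* (l :* (c :* (t :* p)) :+ c :* (z :* u))) refl q Y (ind C i) (X s i) (p i) (X t i) (X s l) (u i))) ⟩
        sum (λ i → q * (X s l * (ind C i * (X t i * p i)) + ind C i * (X s i * u i)))
          ≈⟨ trans (sym (*-distribˡ-sum _ _)) (*-congˡ (∑-distrib-+ _ _)) ⟩
        q * (sum (λ i → X s l * (ind C i * (X t i * p i))) + sum (λ i → ind C i * (X s i * u i)))
          ≈⟨ *-congˡ (trans (+-comm _ _) (+-congˡ (trans (sym (*-distribˡ-sum _ _)) (*-congˡ (reflexive (≡.cong (perm X (t ∷ T)) (≡.sym (toggle-involutive l C)))))))) ⟩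
        q * (sum (λ i → ind C i * (X s i * u i)) + X s l * u l)
          ≈⟨ *-congˡ (trans (+-congˡ (sym (sum-δ l (λ i → X s i * u i)))) (sym (∑-distrib-+ _ _))) ⟩
        q * sum (λ i → ind C i * (X s i * u i) + δ l i * (X s i * u i))
          ≈⟨ *-congˡ (sum-cong (λ i → trans (sym (distribʳ _ _ _)) (*-congʳ (sym (ind-toggle l C i))))) ⟩
        q * perm X (s ∷ t ∷ T) C′ ≈⟨ *-congˡ (perm-swap s t T C′) ⟩
        q * perm X (t ∷ s ∷ T) C′ ∎
        where
        C′ = toggle l C
        Y = rowSum (X t) C′
        p : Fin n → Carrier
        p i = perm X T (toggle i C)
        u : Fin n → Carrier
        u i = perm X (t ∷ T) (toggle i C′)
        -- The induction hypothesis for `toggle i C`, solved for the derivative; toggling `i` shifts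
        -- the row sum by `X t i`.
        step : ∀ i → ∂ D (p i) ≈ q * ((Y + X t i) * p i) + q * u i
        step i = trans (+-move (perm-log-derivative D l t q DX T (toggle i C)))
          (+-cong (*-congˡ (*-congʳ (trans (reflexive (≡.cong (rowSum (X t)) (toggle-comm l i C))) (rowSum-toggle (X t) i C′))))
                  (*-congˡ (reflexive (≡.cong (perm X (t ∷ T)) (toggle-comm l i C)))))

open Permanents

-- Minors, inverses and iterated derivatives of a generic matrix

module GenericMatrices where
  open import Data.Fin.Subset using (Subset; ∣_∣; ⊤)
  open import Data.Nat using (ℕ; zero; suc)
  open import Relation.Binary.PropositionalEquality as ≡ using (_≡_; _≢_)

  elems-∈ : ∀ {n} {i : Fin n} (C : Subset n) → i ∈ₗ elems C → lookup C i ≡ true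
  elems-∈ (true ∷ C) (here ≡.refl) = ≡.refl
  elems-∈ (true ∷ C) (there m) with Membershipₚ.∈-map⁻ suc m
  ... | j , j∈ , ≡.refl = elems-∈ C j∈
  elems-∈ (false ∷ C) m with Membershipₚ.∈-map⁻ suc m
  ... | j , j∈ , ≡.refl = elems-∈ C j∈

  ∈-elems : ∀ {n} (i : Fin n) (C : Subset n) → lookup C i ≡ true → i ∈ₗ elems C
  ∈-elems zero    (true ∷ C)  e = here ≡.refl
  ∈-elems (suc i) (true ∷ C)  e = there (Membershipₚ.∈-map⁺ suc (∈-elems i C e))
  ∈-elems (suc i) (false ∷ C) e = Membershipₚ.∈-map⁺ suc (∈-elems i C e)

  length-elems : ∀ {n} (C : Subset n) → length (elems C) ≡ ∣ C ∣
  length-elems []          = ≡.refl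
  length-elems (true ∷ C)  = ≡.cong suc (≡.trans (Listₚ.length-map suc (elems C)) (length-elems C))
  length-elems (false ∷ C) = ≡.trans (Listₚ.length-map suc (elems C)) (length-elems C)

  module Monomials (R : CommutativeRing 0ℓ 0ℓ) where
    open CommutativeRing R hiding (zero)
    open import Relation.Binary.Reasoning.Setoid setoid

    monomial : ∀ {n} → (Fin n → Carrier) → List (Fin n) → Carrier
    monomial p []      = 1#
    monomial p (i ∷ L) = p i * monomial p L

    private
      swap-* : ∀ x y z → x * (y * z) ≈ y * (x * z)
      swap-* x y z = trans (sym (*-assoc x y z)) (trans (*-congʳ (*-comm x y)) (*-assoc y x z))

    module _ {n} (p : Fin n → Carrier) where
      monomial-++ : ∀ L M → monomial p (L ++ M) ≈ monomial p L * monomial p M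
      monomial-++ []      M = sym (*-identityˡ _)
      monomial-++ (i ∷ L) M = trans (*-congˡ (monomial-++ L M)) (sym (*-assoc _ _ _))

      monomial-ʳ++ : ∀ L M → monomial p (L ʳ++ M) ≈ monomial p L * monomial p M
      monomial-ʳ++ []      M = sym (*-identityˡ _)
      monomial-ʳ++ (i ∷ L) M = trans (monomial-ʳ++ L (i ∷ M)) (trans (swap-* _ _ _) (sym (*-assoc _ _ _)))

      monomial-↭ : ∀ {L M} → L ↭ M → monomial p L ≈ monomial p M
      monomial-↭ _↭_.refl = refl
      monomial-↭ (_↭_.prep i e) = *-congˡ (monomial-↭ e)
      monomial-↭ (_↭_.swap i j e) = trans (swap-* _ _ _) (*-congˡ (*-congˡ (monomial-↭ e)))
      monomial-↭ (_↭_.trans e f) = trans (monomial-↭ e) (monomial-↭ f)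

      monomial-zero : ∀ {L i} → i ∈ₗ L → p i ≈ 0# → monomial p L ≈ 0#
      monomial-zero (here ≡.refl) e = trans (*-congʳ e) (zeroˡ _)
      monomial-zero (there m)     e = trans (*-congˡ (monomial-zero m e)) (zeroʳ _)

    monomial-map : ∀ {n} (p : Fin (suc n) → Carrier) L → monomial p (map suc L) ≡ monomial (p ∘ suc) L
    monomial-map p []      = ≡.refl
    monomial-map p (i ∷ L) = ≡.cong (p (suc i) *_) (monomial-map p L)

    monomial-toggle : ∀ {n} (p : Fin n → Carrier) i C → lookup C i ≡ true →
      monomial p (elems C) ≈ p i * monomial p (elems (toggle i C))
    monomial-toggle p zero    (true ∷ C)  e = refl
    monomial-toggle p (suc i) (true ∷ C)  e = begin
      p zero * monomial p (map suc (elems C)) ≡⟨ ≡.cong (p zero *_) (monomial-map p (elems C)) ⟩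
      p zero * monomial (p ∘ suc) (elems C) ≈⟨ *-congˡ (monomial-toggle (p ∘ suc) i C e) ⟩
      p zero * (p (suc i) * monomial (p ∘ suc) (elems (toggle i C))) ≈⟨ swap-* _ _ _ ⟩
      p (suc i) * (p zero * monomial (p ∘ suc) (elems (toggle i C))) ≡⟨ ≡.cong (λ m → p (suc i) * (p zero * m)) (≡.sym (monomial-map p (elems (toggle i C)))) ⟩
      p (suc i) * (p zero * monomial p (map suc (elems (toggle i C)))) ∎
    monomial-toggle p (suc i) (false ∷ C) e = begin
      monomial p (map suc (elems C)) ≡⟨ monomial-map p (elems C) ⟩
      monomial (p ∘ suc) (elems C) ≈⟨ monomial-toggle (p ∘ suc) i C e ⟩
      p (suc i) * monomial (p ∘ suc) (elems (toggle i C)) ≡⟨ ≡.cong (p (suc i) *_) (≡.sym (monomial-map p (elems (toggle i C)))) ⟩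
      p (suc i) * monomial p (map suc (elems (toggle i C))) ∎

  module LeftInverses (R : CommutativeRing 0ℓ 0ℓ) (isField : IsField R)
    (x+x≈0 : ∀ x → CommutativeRing._≈_ R (CommutativeRing._+_ R x x) (CommutativeRing.0# R)) where
    open CommutativeRing R hiding (zero)
    open IsField isField
    open Sums R
    open Char2Solver R x+x≈0
    open Char2 R isField x+x≈0
    open HomogeneousSystems R isField
    open import Relation.Binary.Reasoning.Setoid setoid

    -- The d equations Σ_j y_j a_sj = x₀ δ_rs have d + 1 unknowns x₀ and y on σ, hence a nontrivial
    -- solution. Applying `W` gives y = x₀ W_r, so x₀ is nonzero and can be cancelled.
    left⇒right : ∀ {d n} (σ : Subset n) → ∣ σ ∣ ≡ d → (a : Fin d → Fin n → Carrier) (W : Fin n → Fin d → Carrier) →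
      (∀ i s → lookup σ i ≡ false → W i s ≈ 0#) →
      (∀ i j → lookup σ j ≡ true → sum (λ s → W i s * a s j) ≈ δ i j) →
      ∀ t r → sum (λ j → a t j * W j r) ≈ δ r t
    left⇒right {d} {n} σ size a W outside WU t r = answer
      where
      A : Fin d → Fin (suc n) → Carrier
      A s zero    = δ r s
      A s (suc j) = a s j
      solution = nontrivial-solution d (true ∷ σ) (ℕₚ.≤-reflexive (≡.cong suc (≡.sym size))) A
      x = proj₁ solution
      nz = proj₂ (proj₂ solution)
      x₀ = x zero
      y : Fin n → Carrier
      y j = x (suc j)
      y-outside : ∀ j → lookup σ j ≡ false → y j ≈ 0#
      y-outside j e = proj₁ (proj₁ (proj₂ solution)) (suc j) (λ { (Vec.there m) → lemma (≡.trans (≡.sym (Vecₚ.[]=⇒lookup m)) e) })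
        where
        lemma : ¬ (true ≡ false)
        lemma ()
      relation : ∀ s → sum (λ j → y j * a s j) ≈ x₀ * δ r s
      relation s = sym (+-zero⇒≈ (trans (sym sum-∷) (proj₂ (proj₁ (proj₂ solution)) s)))
      solve-y : ∀ i → lookup σ i ≡ true → y i ≈ x₀ * W i r
      solve-y i i∈σ = begin
        y i ≈⟨ sum-δ i y ⟨
        sum (λ j → δ i j * y j) ≈⟨ sum-cong term ⟩
        sum (λ j → sum (λ s → W i s * (y j * a s j))) ≈⟨ ∑-comm _ ⟩
        sum (λ s → sum (λ j → W i s * (y j * a s j))) ≈⟨ sum-cong (λ s → trans (sym (*-distribˡ-sum _ _)) (*-congˡ (relation s))) ⟩
        sum (λ s → W i s * (x₀ * δ r s)) ≈⟨ sum-cong (λ s → solve 3 (λ w x e → w :* (x :* e) := e :* (x :* w)) refl _ _ _) ⟩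
        sum (λ s → δ r s * (x₀ * W i s)) ≈⟨ sum-δ r _ ⟩
        x₀ * W i r ∎
        where
        term : ∀ j → δ i j * y j ≈ sum (λ s → W i s * (y j * a s j))
        term j with lookup σ j in eq
        ... | true = trans (*-congʳ (sym (WU i j eq))) (trans (*-distribʳ-sum _ _)
          (sum-cong (λ s → solve 3 (λ w u y → (w :* u) :* y := w :* (y :* u)) refl _ _ _)))
        ... | false = trans (trans (*-congˡ (y-outside j eq)) (zeroʳ _))
          (sym (sum-zero (λ s → trans (*-congˡ (trans (*-congʳ (y-outside j eq)) (zeroˡ _))) (zeroʳ _))))
      y-formula : ∀ j → y j ≈ x₀ * W j r
      y-formula j with lookup σ j in eq
      ... | true = solve-y j eq
      ... | false = trans (y-outside j eq) (sym (trans (*-congˡ (outside j r eq)) (zeroʳ _)))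
      x₀≉0 : ¬ (x₀ ≈ 0#)
      x₀≉0 e with nz
      ... | zero , ne = ne e
      ... | suc j , ne = ne (trans (y-formula j) (trans (*-congʳ e) (zeroˡ _)))
      answer : sum (λ j → a t j * W j r) ≈ δ r t
      answer = *-cancelˡ x₀≉0 (begin
        x₀ * sum (λ j → a t j * W j r) ≈⟨ *-distribˡ-sum _ _ ⟩
        sum (λ j → x₀ * (a t j * W j r)) ≈⟨ sum-cong (λ j → trans
          (solve 3 (λ x a w → x :* (a :* w) := (x :* w) :* a) refl _ _ _) (*-congʳ (sym (y-formula j)))) ⟩
        sum (λ j → y j * a t j) ≈⟨ relation t ⟩
        x₀ * δ r t ∎)

  module GenericMatrix (R : CommutativeRing 0ℓ 0ℓ) (isField : IsField R)
    (x+x≈0 : ∀ x → CommutativeRing._≈_ R (CommutativeRing._+_ R x x) (CommutativeRing.0# R))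
    (d′ n : ℕ) (a : Fin (suc d′) → Fin n → CommutativeRing.Carrier R)
    (∂a : Fin (suc d′) → Fin n → Derivation R)
    (∂a-a : ∀ s j t k → CommutativeRing._≈_ R (Derivation.∂ (∂a s j) (a t k))
      (CommutativeRing._*_ R (δ⟨ R ⟩ s t) (δ⟨ R ⟩ j k))) where
    open CommutativeRing R hiding (zero)
    open IsField isField
    open Sums R
    open Char2Solver R x+x≈0
    open Char2 R isField x+x≈0
    open Monomials R
    open Derivation
    open import Relation.Binary.Reasoning.Setoid setoid

    listSum : ∀ {n} → (Fin n → Carrier) → List (Fin n) → Carrier
    listSum x []      = 0#
    listSum x (i ∷ L) = x i + listSum x L

    listSum-map : ∀ {n} (x : Fin (suc n) → Carrier) L → listSum x (map suc L) ≡ listSum (x ∘ suc) L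
    listSum-map x []      = ≡.refl
    listSum-map x (i ∷ L) = ≡.cong (x (suc i) +_) (listSum-map x L)

    listSum-elems : ∀ {n} (x : Fin n → Carrier) C → listSum x (elems C) ≈ rowSum x C
    listSum-elems x [] = sym sum-[]
    listSum-elems x (true ∷ C) = trans (+-cong (sym (*-identityˡ _))
      (trans (reflexive (listSum-map x (elems C))) (listSum-elems (x ∘ suc) C))) (sym sum-∷)
    listSum-elems x (false ∷ C) = trans (trans (trans (reflexive (listSum-map x (elems C))) (listSum-elems (x ∘ suc) C))
      (sym (trans (+-congʳ (zeroˡ _)) (+-identityˡ _)))) (sym sum-∷)

    rowSum-toggles : ∀ {n} (x : Fin n → Carrier) C L → rowSum x (toggles C L) ≈ rowSum x C + listSum x L
    rowSum-toggles x C []      = sym (+-identityʳ _)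
    rowSum-toggles x C (i ∷ L) = trans (rowSum-toggle x i (toggles C L)) (trans (+-congʳ (rowSum-toggles x C L))
      (solve 3 (λ a b c → (a :+ b) :+ c := a :+ (c :+ b)) refl _ _ _))

    d : ℕ
    d = suc d′

    Diff : List (Fin d) → List (Fin n) → Carrier → Carrier
    Diff []       _        x = x
    Diff (r ∷ rs) []       x = x
    Diff (r ∷ rs) (j ∷ js) x = Diff rs js (∂ (∂a r j) x)

    Diff-cong : ∀ rs js {x y} → x ≈ y → Diff rs js x ≈ Diff rs js y
    Diff-cong []       js       e = e
    Diff-cong (r ∷ rs) []       e = e
    Diff-cong (r ∷ rs) (j ∷ js) e = Diff-cong rs js (∂-cong (∂a r j) e)

    Diff-sum : ∀ rs js {m} (f : Fin m → Carrier) → Diff rs js (sum f) ≈ sum (λ i → Diff rs js (f i))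
    Diff-sum []       js       f = refl
    Diff-sum (r ∷ rs) []       f = refl
    Diff-sum (r ∷ rs) (j ∷ js) f = trans (Diff-cong rs js (∂-sum (∂a r j) f)) (Diff-sum rs js _)

    Diff-square-* : ∀ rs js c x → Diff rs js ((c * c) * x) ≈ (c * c) * Diff rs js x
    Diff-square-* []       js       c x = refl
    Diff-square-* (r ∷ rs) []       c x = refl
    Diff-square-* (r ∷ rs) (j ∷ js) c x = trans (Diff-cong rs js (∂-square-* (∂a r j) c x)) (Diff-square-* rs js c _)

    Diff-zero : ∀ rs js → Diff rs js 0# ≈ 0#
    Diff-zero []       js       = refl
    Diff-zero (r ∷ rs) []       = refl
    Diff-zero (r ∷ rs) (j ∷ js) = trans (Diff-cong rs js (∂-zero (∂a r j))) (Diff-zero rs js)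

    -- The variable a_rj occurs in row r only, and differentiating by it deletes row r and column j.
    -- Repeating this down to nothing extracts the coefficient 1 of a single term, which is how
    -- generic minors are seen to be nonzero.
    Diff-perm : ∀ rs C → Unique rs → length rs ≡ ∣ C ∣ → Diff rs (elems C) (perm a rs C) ≈ 1#
    Diff-perm []       C _ _ = refl
    Diff-perm (r ∷ rs) C (r∉rs ∷ unique) len with elems-first C (≡.sym len)
    ... | j , j∈C , eq = begin
      Diff (r ∷ rs) (elems C) (perm a (r ∷ rs) C) ≡⟨ ≡.cong (λ js → Diff (r ∷ rs) js (perm a (r ∷ rs) C)) eq ⟩
      Diff rs (elems (toggle j C)) (∂ (∂a r j) (perm a (r ∷ rs) C)) ≈⟨ Diff-cong rs _ derivative ⟩
      Diff rs (elems (toggle j C)) (perm a rs (toggle j C))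
        ≈⟨ Diff-perm rs (toggle j C) unique (ℕₚ.suc-injective (≡.trans len (∣toggle∣ j C j∈C))) ⟩
      1# ∎
      where
      constant : All (λ s → ∀ k → ∂ (∂a r j) (a s k) ≈ 0#) rs
      constant = All.map (λ {s} r≢s k → trans (∂a-a r j s k) (trans (*-congʳ (reflexive (δ-≢ r≢s))) (zeroˡ _))) r∉rs
      derivative : ∂ (∂a r j) (perm a (r ∷ rs) C) ≈ perm a rs (toggle j C)
      derivative = begin
        ∂ (∂a r j) (perm a (r ∷ rs) C) ≈⟨ ∂-perm a (∂a r j) r rs C ⟩
        sum (λ i → ind C i * (∂ (∂a r j) (a r i) * perm a rs (toggle i C) + a r i * ∂ (∂a r j) (perm a rs (toggle i C))))
          ≈⟨ sum-cong (λ i → trans (*-congˡ (+-cong (*-congʳ (trans (∂a-a r j r i) (trans (*-congʳ (reflexive (δ-refl r))) (*-identityˡ _))))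
               (*-congˡ (perm-constant a (∂a r j) rs constant (toggle i C)))))
               (solve 4 (λ c e p x → c :* (e :* p :+ x :* con false) := e :* (c :* p)) refl _ _ _ _)) ⟩
        sum (λ i → δ j i * (ind C i * perm a rs (toggle i C))) ≈⟨ sum-δ j _ ⟩
        ind C j * perm a rs (toggle j C) ≈⟨ trans (*-congʳ (reflexive (≡.cong ⟦_⟧ j∈C))) (*-identityˡ _) ⟩
        perm a rs (toggle j C) ∎

    perm≉0 : ∀ rs C → Unique rs → length rs ≡ ∣ C ∣ → ¬ (perm a rs C ≈ 0#)
    perm≉0 rs C unique len e = 1≉0 (trans (sym (Diff-perm rs C unique len)) (trans (Diff-cong rs _ e) (Diff-zero rs _)))

    lastRows rows : List (Fin d)
    lastRows = tabulate suc
    rows     = zero ∷ lastRows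

    rows-unique : Unique rows
    rows-unique = Uniqueₚ.allFin⁺ d

    lastRows-unique : Unique lastRows
    lastRows-unique with rows-unique
    ... | _ ∷ u = u

    length-rows : length rows ≡ d
    length-rows = Listₚ.length-tabulate {n = d} id

    module Facet (σ : Subset n) (size : ∣ σ ∣ ≡ d) where

      Q : Carrier
      Q = perm a rows σ

      Q≉0 : ¬ (Q ≈ 0#)
      Q≉0 = perm≉0 rows σ rows-unique (≡.trans length-rows (≡.sym size))

      -- Cofactors over the determinant, the cofactor of a_si being ∂Q/∂a_si. Thus `W` is the
      -- inverse of the block of `a` on σ, extended by zero.
      W : Fin n → Fin d → Carrier
      W i s = ∂ (∂a s i) Q * Q ⁻¹

      QW : ∀ i s → W i s * Q ≈ ∂ (∂a s i) Q
      QW i s = trans (*-assoc _ _ _) (trans (*-congˡ (trans (*-comm _ _) (inverse Q≉0))) (*-identityʳ _))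

      W-outside : ∀ i s → lookup σ i ≡ false → W i s ≈ 0#
      W-outside i s i∉σ = trans (*-congʳ (replace-absent a (∂a s i) i (λ t → δ s t)
        (λ t k → trans (∂a-a s i t k) (*-comm _ _)) rows σ i∉σ)) (zeroˡ _)

      -- The derivation Σ_s a_sj ∂_si replaces column i by column j, so that this is Cramer's rule.
      WU : ∀ i j → lookup σ j ≡ true → sum (λ s → W i s * a s j) ≈ δ i j
      WU i j j∈σ = *-cancelˡ Q≉0 (begin
        Q * sum (λ s → W i s * a s j) ≈⟨ *-distribˡ-sum _ _ ⟩
        sum (λ s → Q * (W i s * a s j)) ≈⟨ sum-cong (λ s → trans
          (solve 3 (λ q w x → q :* (w :* x) := x :* (w :* q)) refl _ _ _) (*-congˡ (QW i s))) ⟩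
        ∂ E Q ≈⟨ replaced ⟩
        Q * δ i j ∎)
        where
        E : Derivation R
        E = combination (λ s → a s j) (λ s → ∂a s i)
        E-a : ∀ t k → ∂ E (a t k) ≈ δ i k * a t j
        E-a t k = begin
          sum (λ s → a s j * ∂ (∂a s i) (a t k)) ≈⟨ sum-cong (λ s → trans (*-congˡ (trans (∂a-a s i t k) (*-congʳ (reflexive (δ-sym s t)))))
              (solve 3 (λ a e f → a :* (e :* f) := e :* (f :* a)) refl _ _ _)) ⟩
          sum (λ s → δ t s * (δ i k * a s j)) ≈⟨ sum-δ t _ ⟩
          δ i k * a t j ∎
        len : length rows ≡ ∣ σ ∣
        len = ≡.trans length-rows (≡.sym size)
        replaced : ∂ E Q ≈ Q * δ i j
        replaced with i Finₚ.≟ j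
        ... | yes ≡.refl = trans (replace-same a E i E-a rows σ len j∈σ)
          (sym (trans (*-congˡ (reflexive (δ-refl i))) (*-identityʳ _)))
        ... | no i≢j with lookup σ i in eq
        ... | true = trans (replace-inside a E i≢j E-a rows σ len eq j∈σ) (sym (trans (*-congˡ (reflexive (δ-≢ i≢j))) (zeroʳ _)))
        ... | false = trans (replace-absent a E i (λ t → a t j) E-a rows σ eq) (sym (trans (*-congˡ (reflexive (δ-≢ i≢j))) (zeroʳ _)))

      UW : ∀ t r → sum (λ j → a t j * W j r) ≈ δ r t
      UW = LeftInverses.left⇒right R isField x+x≈0 σ size a W W-outside WU

      -- Differentiating W·A = 1 gives ∂W·A = W·∂A; multiplication by W on the right turns this into
      -- ∂W = W·∂A·W, the usual formula without its sign.
      ∂-W : ∀ D i t → ∂ D (W i t) ≈ sum (λ k → sum (λ s → W i s * ∂ D (a s k)) * W k t)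
      ∂-W D i t = begin
        ∂ D (W i t) ≈⟨ sum-δ t _ ⟨
        sum (λ s → δ t s * ∂ D (W i s)) ≈⟨ sum-cong (λ s → trans (*-congʳ (sym (UW s t))) (*-distribʳ-sum _ _)) ⟩
        sum (λ s → sum (λ k → (a s k * W k t) * ∂ D (W i s))) ≈⟨ ∑-comm _ ⟩
        sum (λ k → sum (λ s → (a s k * W k t) * ∂ D (W i s))) ≈⟨ sum-cong term ⟩
        sum (λ k → sum (λ s → W i s * ∂ D (a s k)) * W k t) ∎
        where
        term : ∀ k → sum (λ s → (a s k * W k t) * ∂ D (W i s)) ≈ sum (λ s → W i s * ∂ D (a s k)) * W k t
        term k with lookup σ k in eq
        ... | true = begin
          sum (λ s → (a s k * W k t) * ∂ D (W i s))
            ≈⟨ sum-cong (λ s → solve 3 (λ a w e → (a :* w) :* e := (e :* a) :* w) refl _ _ _) ⟩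
          sum (λ s → (∂ D (W i s) * a s k) * W k t) ≈⟨ *-distribʳ-sum _ _ ⟨
          sum (λ s → ∂ D (W i s) * a s k) * W k t ≈⟨ *-congʳ (+-zero⇒≈ (begin
              sum (λ s → ∂ D (W i s) * a s k) + sum (λ s → W i s * ∂ D (a s k)) ≈⟨ ∑-distrib-+ _ _ ⟨
              sum (λ s → ∂ D (W i s) * a s k + W i s * ∂ D (a s k)) ≈⟨ sum-cong (λ s → sym (∂-* D _ _)) ⟩
              sum (λ s → ∂ D (W i s * a s k)) ≈⟨ ∂-sum D _ ⟨
              ∂ D (sum (λ s → W i s * a s k)) ≈⟨ ∂-cong D (WU i k eq) ⟩
              ∂ D (δ i k) ≈⟨ ∂-δ D i k ⟩
              0# ∎)) ⟩
          sum (λ s → W i s * ∂ D (a s k)) * W k t ∎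
        ... | false = trans (sum-zero (λ s → trans (*-congʳ (trans (*-congˡ (W-outside k t eq)) (zeroʳ _))) (zeroˡ _)))
          (sym (trans (*-congˡ (W-outside k t eq)) (zeroʳ _)))

      W-constant : ∀ D → (∀ s k → ∂ D (a s k) ≈ 0#) → ∀ i t → ∂ D (W i t) ≈ 0#
      W-constant D e i t = trans (∂-W D i t) (sum-zero (λ k → trans (*-congʳ (sum-zero (λ s → trans (*-congˡ (e s k)) (zeroʳ _)))) (zeroˡ _)))

      ∂a-W : ∀ s j i t → ∂ (∂a s j) (W i t) ≈ W i s * W j t
      ∂a-W s j i t = begin
        ∂ (∂a s j) (W i t) ≈⟨ ∂-W (∂a s j) i t ⟩
        sum (λ k → sum (λ r → W i r * ∂ (∂a s j) (a r k)) * W k t) ≈⟨ sum-cong (λ k → *-congʳ (begin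
            sum (λ r → W i r * ∂ (∂a s j) (a r k)) ≈⟨ sum-cong (λ r → trans (*-congˡ (∂a-a s j r k))
              (solve 3 (λ w e f → w :* (e :* f) := e :* (f :* w)) refl _ _ _)) ⟩
            sum (λ r → δ s r * (δ j k * W i r)) ≈⟨ sum-δ s _ ⟩
            δ j k * W i s ∎)) ⟩
        sum (λ k → (δ j k * W i s) * W k t) ≈⟨ sum-cong (λ k → *-assoc _ _ _) ⟩
        sum (λ k → δ j k * (W i s * W k t)) ≈⟨ sum-δ j _ ⟩
        W i s * W j t ∎

      -- The coordinates of the point supported on σ at which θ₀ = 1 and the other θ_s vanish.
      p : Fin n → Carrier
      p i = W i zero

      p-outside : ∀ i → lookup σ i ≡ false → p i ≈ 0#
      p-outside i = W-outside i zero

      -- Cramer's rule: the right side is a minor of the rows other than zero. It depends only on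
      -- the ridge opposite `i`, which makes the two facets at a ridge comparable, and it is
      -- nonzero, so no coordinate of `p` on σ vanishes.
      pQ : ∀ i → lookup σ i ≡ true → p i * Q ≈ perm a lastRows (toggle i σ)
      pQ i i∈σ = trans (QW i zero) (begin
        ∂ (∂a zero i) Q ≈⟨ ∂-perm a (∂a zero i) zero lastRows σ ⟩
        sum (λ k → ind σ k * (∂ (∂a zero i) (a zero k) * perm a lastRows (toggle k σ) + a zero k * ∂ (∂a zero i) (perm a lastRows (toggle k σ))))
          ≈⟨ sum-cong (λ k → trans (*-congˡ (+-cong (*-congʳ (trans (∂a-a zero i zero k) (*-identityˡ _)))
               (*-congˡ (perm-constant a (∂a zero i) lastRows (constant lastRows lastRows-nonzero) (toggle k σ)))))
               (solve 4 (λ c e p x → c :* (e :* p :+ x :* con false) := e :* (c :* p)) refl _ _ _ _)) ⟩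
        sum (λ k → δ i k * (ind σ k * perm a lastRows (toggle k σ))) ≈⟨ sum-δ i _ ⟩
        ind σ i * perm a lastRows (toggle i σ) ≈⟨ trans (*-congʳ (reflexive (≡.cong ⟦_⟧ i∈σ))) (*-identityˡ _) ⟩
        perm a lastRows (toggle i σ) ∎)
        where
        lastRows-nonzero : All (zero ≢_) lastRows
        lastRows-nonzero with rows-unique
        ... | z ∷ _ = z
        constant : ∀ rs → All (zero ≢_) rs → All (λ s → ∀ k → ∂ (∂a zero i) (a s k) ≈ 0#) rs
        constant rs = All.map (λ {s} ne k → trans (∂a-a zero i s k) (trans (*-congʳ (reflexive (δ-≢ ne))) (zeroˡ _)))

      p≉0 : ∀ i → lookup σ i ≡ true → ¬ (p i ≈ 0#)
      p≉0 i i∈σ e = perm≉0 lastRows (toggle i σ) lastRows-unique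
        (ℕₚ.suc-injective (≡.trans length-rows (≡.trans (≡.sym size) (∣toggle∣ i σ i∈σ))))
        (trans (sym (pQ i i∈σ)) (trans (*-congʳ e) (zeroˡ _)))

      mon : List (Fin n) → Carrier
      mon = monomial p

      mon-outside : ∀ {L i} → i ∈ₗ L → lookup σ i ≡ false → mon L ≈ 0#
      mon-outside m e = monomial-zero p m (p-outside _ e)

      mon≉0 : ∀ L → (∀ {i} → i ∈ₗ L → lookup σ i ≡ true) → ¬ (mon L ≈ 0#)
      mon≉0 []      _ = 1≉0
      mon≉0 (i ∷ L) m = *-nonzero (p≉0 i (m (here ≡.refl))) (mon≉0 L (m ∘ there))

      π : Carrier
      π = mon (elems σ)

      π≉0 : ¬ (π ≈ 0#)
      π≉0 = mon≉0 (elems σ) (elems-∈ σ)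

      wt : Carrier
      wt = (π * Q) ⁻¹

      wt-π-Q : wt * (π * Q) ≈ 1#
      wt-π-Q = trans (*-comm _ _) (inverse (*-nonzero π≉0 Q≉0))

      wt≉0 : ¬ (wt ≈ 0#)
      wt≉0 = ⁻¹-nonzero (*-nonzero π≉0 Q≉0)

      module _ (D : Derivation R) (Da : ∀ s k → ∂ D (a s k) ≈ 0#) where
        mon-constant : ∀ L → ∂ D (mon L) ≈ 0#
        mon-constant []      = ∂-one D
        mon-constant (i ∷ L) = trans (∂-const-* D (W-constant D Da i zero)) (trans (*-congˡ (mon-constant L)) (zeroʳ _))

        wt-constant : ∂ D wt ≈ 0#
        wt-constant = ∂-cancel D (*-nonzero π≉0 Q≉0) (inverse (*-nonzero π≉0 Q≉0))
          (trans (∂-const-* D (mon-constant (elems σ))) (trans (*-congˡ (perm-constant a D rows (All.universal Da rows) σ)) (zeroʳ _)))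
          (∂-one D)

      -- The factor in ∂p_i/∂a_sj = p_i z_si p_j: up to p_j, the logarithmic derivative of p_i.
      -- Monomials then differentiate into sums of entries of `z`.
      z : Fin d → Fin n → Carrier
      z s i = W i s * p i ⁻¹

      W-z : ∀ i s → W i s ≈ p i * z s i
      W-z i s with lookup σ i in eq
      ... | true = sym (trans (solve 3 (λ p w r → p :* (w :* r) := (p :* r) :* w) refl _ _ _)
                        (trans (*-congʳ (inverse (p≉0 i eq))) (*-identityˡ _)))
      ... | false = trans (W-outside i s eq) (sym (trans (*-congʳ (p-outside i eq)) (zeroˡ _)))

      z-outside : ∀ s i → lookup σ i ≡ false → z s i ≈ 0#
      z-outside s i e = trans (*-congʳ (W-outside i s e)) (zeroˡ _)

      ∂a-p : ∀ s j i → ∂ (∂a s j) (p i) ≈ (p i * z s i) * p j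
      ∂a-p s j i = trans (∂a-W s j i zero) (*-congʳ (W-z i s))

      -- Differentiate `W i s = p i * z s i`, whose derivative is `W i t * W l s`, and divide by
      -- `p i`. The outcome is the hypothesis of `perm-log-derivative` with `q = p l`.
      ∂a-z : ∀ t l s i → ∂ (∂a t l) (z s i) ≈ p l * (z t i * (z s l + z s i))
      ∂a-z t l s i with lookup σ i in eq
      ... | true = *-cancelˡ (p≉0 i eq) (begin
        p i * ∂ (∂a t l) (z s i) ≈⟨ +-move (begin
          ∂ (∂a t l) (p i) * z s i + p i * ∂ (∂a t l) (z s i) ≈⟨ ∂-* (∂a t l) _ _ ⟨
          ∂ (∂a t l) (p i * z s i) ≈⟨ ∂-cong (∂a t l) (sym (W-z i s)) ⟩
          ∂ (∂a t l) (W i s) ≈⟨ ∂a-W t l i s ⟩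
          W i t * W l s ≈⟨ *-cong (W-z i t) (W-z l s) ⟩
          (p i * z t i) * (p l * z s l) ∎) ⟩
        ∂ (∂a t l) (p i) * z s i + (p i * z t i) * (p l * z s l) ≈⟨ +-congʳ (*-congʳ (∂a-p t l i)) ⟩
        ((p i * z t i) * p l) * z s i + (p i * z t i) * (p l * z s l)
          ≈⟨ solve 5 (λ pi zti pl zsi zsl → ((pi :* zti) :* pl) :* zsi :+ (pi :* zti) :* (pl :* zsl)
               := pi :* (pl :* (zti :* (zsl :+ zsi)))) refl (p i) (z t i) (p l) (z s i) (z s l) ⟩
        p i * (p l * (z t i * (z s l + z s i))) ∎)
      ... | false = trans (∂-cong (∂a t l) (z-outside s i eq)) (trans (∂-zero (∂a t l))
        (sym (trans (*-congˡ (trans (*-congʳ (z-outside t i eq)) (zeroˡ _))) (zeroʳ _))))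

      ∂a-mon : ∀ s j L → ∂ (∂a s j) (mon L) ≈ p j * (mon L * listSum (z s) L)
      ∂a-mon s j [] = trans (∂-one (∂a s j)) (sym (trans (*-congˡ (zeroʳ _)) (zeroʳ _)))
      ∂a-mon s j (i ∷ L) = begin
        ∂ (∂a s j) (p i * mon L) ≈⟨ ∂-* (∂a s j) _ _ ⟩
        ∂ (∂a s j) (p i) * mon L + p i * ∂ (∂a s j) (mon L) ≈⟨ +-cong (*-congʳ (∂a-p s j i)) (*-congˡ (∂a-mon s j L)) ⟩
        ((p i * z s i) * p j) * mon L + p i * (p j * (mon L * listSum (z s) L))
          ≈⟨ solve 5 (λ p z q m l → ((p :* z) :* q) :* m :+ p :* (q :* (m :* l)) := q :* ((p :* m) :* (z :+ l))) refl _ _ _ _ _ ⟩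
        p j * ((p i * mon L) * (z s i + listSum (z s) L)) ∎

      listSum-z : ∀ s → listSum (z s) (elems σ) ≈ rowSum (z s) ⊤
      listSum-z s = trans (listSum-elems (z s) σ) (sum-cong term)
        where
        term : ∀ i → ind σ i * z s i ≈ ind ⊤ i * z s i
        term i with lookup σ i in eq
        ... | true = *-congʳ (reflexive (≡.cong ⟦_⟧ (≡.sym (Vecₚ.lookup-replicate i true))))
        ... | false = trans (zeroˡ _) (sym (trans (*-congˡ (z-outside s i eq)) (zeroʳ _)))

      -- In characteristic 2 a function and its reciprocal have the same logarithmic derivative. The
      -- product of coordinates contributes the row sum of `z s`, the determinant contributes
      -- `z s j`.
      ∂a-wt : ∀ s j → ∂ (∂a s j) wt ≈ wt * (p j * (rowSum (z s) ⊤ + z s j))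
      ∂a-wt s j = *-cancelˡ (*-nonzero π≉0 Q≉0) (begin
        (π * Q) * ∂ D wt ≈⟨ *-comm _ _ ⟩
        ∂ D wt * (π * Q) ≈⟨ +-zero⇒≈ (trans (sym (∂-* D _ _)) (trans (∂-cong D wt-π-Q) (∂-one D))) ⟩
        wt * ∂ D (π * Q) ≈⟨ *-congˡ (trans (∂-* D _ _) (+-cong (*-congʳ (trans (∂a-mon s j (elems σ)) (*-congˡ (*-congˡ (listSum-z s)))))
                                (*-congˡ (trans (sym (QW j s)) (*-congʳ (W-z j s)))))) ⟩
        wt * ((p j * (π * rowSum (z s) ⊤)) * Q + π * ((p j * z s j) * Q))
          ≈⟨ solve 6 (λ w p π y q z → w :* ((p :* (π :* y)) :* q :+ π :* ((p :* z) :* q)) := (π :* q) :* (w :* (p :* (y :+ z)))) refl _ _ _ _ _ _ ⟩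
        (π * Q) * (wt * (p j * (rowSum (z s) ⊤ + z s j))) ∎)
        where D = ∂a s j

      -- On σ, the vertices with odd exponent in mon L divided by π; logarithmic derivatives see
      -- exponents only modulo 2. Since `z` vanishes outside σ, the count may start from `⊤`, and
      -- the set is the same for all facets.
      parity : List (Fin n) → Subset n
      parity = toggles ⊤

      weighted : List (Fin n) → List (Fin d) → Carrier
      weighted L T = (wt * mon L) * perm z T (parity L)

      -- The factor `wt * mon L` has logarithmic derivative `p l` times the row sum of `z t` over
      -- `parity (l ∷ L)`, and `perm-log-derivative` absorbs that row sum into the permanent as a
      -- new row. So the family `weighted` is closed under all these derivatives.
      ∂a-weighted : ∀ t l L T → ∂ (∂a t l) (weighted L T) ≈ weighted (l ∷ L) (t ∷ T)
      ∂a-weighted t l L T = begin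
        ∂ D ((wt * mon L) * P) ≈⟨ ∂-* D _ _ ⟩
        ∂ D (wt * mon L) * P + (wt * mon L) * ∂ D P ≈⟨ +-congʳ (*-congʳ (begin
            ∂ D (wt * mon L) ≈⟨ ∂-* D _ _ ⟩
            ∂ D wt * mon L + wt * ∂ D (mon L) ≈⟨ +-cong (*-congʳ (∂a-wt t l)) (*-congˡ (∂a-mon t l L)) ⟩
            (wt * (p l * (rowSum (z t) ⊤ + z t l))) * mon L + wt * (p l * (mon L * listSum (z t) L))
              ≈⟨ solve 6 (λ w p y z m l → (w :* (p :* (y :+ z))) :* m :+ w :* (p :* (m :* l)) := (w :* m) :* (p :* ((y :+ l) :+ z))) refl _ _ _ _ _ _ ⟩
            (wt * mon L) * (p l * ((rowSum (z t) ⊤ + listSum (z t) L) + z t l))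
              ≈⟨ *-congˡ (*-congˡ (trans (+-congʳ (sym (rowSum-toggles (z t) ⊤ L))) (sym (rowSum-toggle (z t) l (parity L))))) ⟩
            (wt * mon L) * (p l * y) ∎)) ⟩
        ((wt * mon L) * (p l * y)) * P + (wt * mon L) * ∂ D P
          ≈⟨ solve 5 (λ w p y q e → (w :* (p :* y)) :* q :+ w :* e := w :* (p :* (y :* q) :+ e)) refl _ _ _ _ _ ⟩
        (wt * mon L) * (p l * (y * P) + ∂ D P) ≈⟨ *-congˡ (perm-log-derivative z D l t (p l) (∂a-z t l) T (parity L)) ⟩
        (wt * mon L) * (p l * perm z (t ∷ T) (parity (l ∷ L)))
          ≈⟨ solve 4 (λ w m p q → (w :* m) :* (p :* q) := (w :* (p :* m)) :* q) refl _ _ _ _ ⟩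
        weighted (l ∷ L) (t ∷ T) ∎
        where
        D = ∂a t l
        P = perm z T (parity L)
        y = rowSum (z t) (parity (l ∷ L))

      Diff-weighted : ∀ rs js L T → length js ≡ length rs → Diff rs js (weighted L T) ≈ weighted (js ʳ++ L) (rs ʳ++ T)
      Diff-weighted []       []       L T e = refl
      Diff-weighted (r ∷ rs) (j ∷ js) L T e = trans (Diff-cong rs js (∂a-weighted r j L T))
        (Diff-weighted rs js (j ∷ L) (r ∷ T) (ℕₚ.suc-injective e))

      private
        κ : Carrier
        κ = perm z (rows ʳ++ []) ⊤

      Diff-full : ∀ J I → length J ≡ d → toggles (parity I) J ≡ ⊤ → Diff rows J (wt * mon I) ≈ (wt * (mon J * mon I)) * κ
      Diff-full J I len par = begin
        Diff rows J (wt * mon I) ≈⟨ Diff-cong rows J (sym (*-identityʳ _)) ⟩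
        Diff rows J (weighted I []) ≈⟨ Diff-weighted rows J I [] (≡.trans len (≡.sym length-rows)) ⟩
        weighted (J ʳ++ I) (rows ʳ++ []) ≈⟨ *-cong (*-congˡ (monomial-ʳ++ p J I))
            (reflexive (≡.cong (perm z (rows ʳ++ [])) (≡.trans (toggles-ʳ++ ⊤ J I) par))) ⟩
        (wt * (mon J * mon I)) * κ ∎

      -- Differentiating Q = Q² · wt · π down to the constant 1 evaluates the full permanent of z.
      κ≈wt : κ ≈ wt
      κ≈wt = begin
        κ ≈⟨ trans (sym (*-identityˡ _)) (*-congʳ (sym one²)) ⟩
        ((wt * (π * Q)) * (wt * (π * Q))) * κ
          ≈⟨ solve 4 (λ w π q k → ((w :* (π :* q)) :* (w :* (π :* q))) :* k := w :* ((q :* q) :* ((w :* (π :* π)) :* k))) refl _ _ _ _ ⟩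
        wt * ((Q * Q) * ((wt * (π * π)) * κ))
          ≈⟨ *-congˡ (*-congˡ (sym (Diff-full (elems σ) (elems σ) (≡.trans (length-elems σ) size) (toggles-twice ⊤ (elems σ))))) ⟩
        wt * ((Q * Q) * Diff rows (elems σ) (wt * π)) ≈⟨ *-congˡ (sym (Diff-square-* rows (elems σ) Q _)) ⟩
        wt * Diff rows (elems σ) ((Q * Q) * (wt * π)) ≈⟨ *-congˡ (Diff-cong rows (elems σ) (begin
           (Q * Q) * (wt * π) ≈⟨ solve 3 (λ q w π → (q :* q) :* (w :* π) := q :* (w :* (π :* q))) refl _ _ _ ⟩
           Q * (wt * (π * Q)) ≈⟨ *-congˡ wt-π-Q ⟩
           Q * 1# ≈⟨ *-identityʳ _ ⟩
           Q ∎)) ⟩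
        wt * Diff rows (elems σ) Q ≈⟨ *-congˡ (Diff-perm rows σ rows-unique (≡.trans length-rows (≡.sym size))) ⟩
        wt * 1# ≈⟨ *-identityʳ _ ⟩
        wt ∎
        where
        one² : (wt * (π * Q)) * (wt * (π * Q)) ≈ 1#
        one² = trans (*-cong wt-π-Q wt-π-Q) (*-identityˡ _)

      -- The parity hypothesis says that all exponents in x_J x_I are even, so the full permanent of
      -- `z` appears, and it equals `wt`. The right side is then the square of wt·x_L with x_L² =
      -- x_J x_I.
      Diff-wt-mon : ∀ J I → length J ≡ d → toggles (parity I) J ≡ ⊤ → Diff rows J (wt * mon I) ≈ (wt * wt) * (mon J * mon I)
      Diff-wt-mon J I len par = trans (Diff-full J I len par) (trans (*-congˡ κ≈wt)
        (solve 2 (λ w m → (w :* m) :* w := (w :* w) :* m) refl _ _))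

      -- The ridge monomial lacks from π only the factor `p i`, and `p i * Q` is the minor of the
      -- ridge. Hence the weighted ridge monomial is the inverse of a quantity that does not mention
      -- σ.
      ridge-term : ∀ i → lookup σ i ≡ true → (wt * mon (elems (toggle i σ))) * perm a lastRows (toggle i σ) ≈ 1#
      ridge-term i i∈σ = begin
        (wt * mon (elems (toggle i σ))) * perm a lastRows (toggle i σ) ≈⟨ *-congˡ (sym (pQ i i∈σ)) ⟩
        (wt * mon (elems (toggle i σ))) * (p i * Q) ≈⟨ solve 4 (λ w m p q → (w :* m) :* (p :* q) := w :* ((p :* m) :* q)) refl _ _ _ _ ⟩
        wt * ((p i * mon (elems (toggle i σ))) * Q) ≈⟨ *-congˡ (*-congʳ (sym (monomial-toggle p i σ i∈σ))) ⟩
        wt * (π * Q) ≈⟨ wt-π-Q ⟩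
        1# ∎

      -- The linear form Σ_s W_is θ_s. On σ it reduces to x_i, so it expresses x_i through variables
      -- outside σ and a constant.
      coefficient : Fin n → Fin n → Carrier
      coefficient i j = sum (λ s → W i s * a s j)

      coefficient-relation : ∀ i (x : Fin n → Carrier) → (∀ s → sum (λ j → a s j * x j) ≈ δ zero s) →
        sum (λ j → coefficient i j * x j) ≈ p i
      coefficient-relation i x e = begin
        sum (λ j → coefficient i j * x j) ≈⟨ sum-cong (λ j → *-distribʳ-sum _ _) ⟩
        sum (λ j → sum (λ s → (W i s * a s j) * x j)) ≈⟨ ∑-comm _ ⟩
        sum (λ s → sum (λ j → (W i s * a s j) * x j)) ≈⟨ sum-cong (λ s → trans (sum-cong (λ j → *-assoc _ _ _)) (sym (*-distribˡ-sum _ _))) ⟩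
        sum (λ s → W i s * sum (λ j → a s j * x j)) ≈⟨ sum-cong (λ s → trans (*-congˡ (e s)) (*-comm _ _)) ⟩
        sum (λ s → δ zero s * W i s) ≈⟨ sum-δ zero _ ⟩
        p i ∎

open GenericMatrices

-- Shellings and the injectivity of a generic linear form

module Shellings where
  open import Data.Fin.Subset using (Subset; ∣_∣; ⊤)
  open import Data.Nat as ℕ using (ℕ; zero; suc; _<_; _≤_; s≤s; z≤n; _∸_)
  open import Relation.Binary.PropositionalEquality as ≡ using (_≡_; _≢_)

  infix 4 _⊑_
  _⊑_ : ∀ {n} → Subset n → Subset n → Set
  A ⊑ B = ∀ i → lookup A i ≡ true → lookup B i ≡ true

  true≢false : ¬ (true ≡ false)
  true≢false ()

  does⁻ : ∀ {P : Set} (P? : Dec P) → does P? ≡ true → P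
  does⁻ (yes x) _ = x

  _⊑?_ : ∀ {n} (A B : Subset n) → Dec (A ⊑ B)
  A ⊑? B = Finₚ.all? (λ i → implies (lookup A i) (lookup B i))
    where
    implies : ∀ x y → Dec (x ≡ true → y ≡ true)
    implies false y    = yes (λ ())
    implies true true  = yes (λ _ → ≡.refl)
    implies true false = no (λ f → true≢false (≡.sym (f ≡.refl)))

  ⊑-toggle : ∀ {n} {A B : Subset n} {i} → lookup A i ≡ false → A ⊑ B → A ⊑ toggle i B
  ⊑-toggle {A = A} {B} {i} i∉A A⊑B j j∈A with i Finₚ.≟ j
  ... | yes ≡.refl = ⊥-elim (true≢false (≡.trans (≡.sym j∈A) i∉A))
  ... | no i≢j = ≡.trans (lookup-toggle-≢ B (i≢j ∘ ≡.sym)) (A⊑B j j∈A)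

  toggle-⊑ : ∀ {n} {C : Subset n} {i} → lookup C i ≡ true → toggle i C ⊑ C
  toggle-⊑ {C = C} {i} i∈C j e with i Finₚ.≟ j
  ... | yes ≡.refl = i∈C
  ... | no i≢j = ≡.trans (≡.sym (lookup-toggle-≢ C (i≢j ∘ ≡.sym))) e

  ⊑-witness : ∀ {n} (A B : Subset n) → ∣ A ∣ < ∣ B ∣ → ∃ λ i → lookup B i ≡ true × lookup A i ≡ false
  ⊑-witness (true ∷ A)  (true ∷ B)  (s≤s lt) with ⊑-witness A B lt
  ... | i , i∈B , i∉A = suc i , i∈B , i∉A
  ⊑-witness (true ∷ A)  (false ∷ B) lt with ⊑-witness A B (ℕₚ.<-trans (ℕₚ.n<1+n _) lt)
  ... | i , i∈B , i∉A = suc i , i∈B , i∉A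
  ⊑-witness (false ∷ A) (true ∷ B)  lt = zero , ≡.refl , ≡.refl
  ⊑-witness (false ∷ A) (false ∷ B) lt with ⊑-witness A B lt
  ... | i , i∈B , i∉A = suc i , i∈B , i∉A

  ⊑⇒∣∣≤ : ∀ {n} (A B : Subset n) → A ⊑ B → ∣ A ∣ ≤ ∣ B ∣
  ⊑⇒∣∣≤ [] [] s = z≤n
  ⊑⇒∣∣≤ (true ∷ A) (true ∷ B) s = s≤s (⊑⇒∣∣≤ A B (s ∘ suc))
  ⊑⇒∣∣≤ (true ∷ A) (false ∷ B) s with s zero ≡.refl
  ... | ()
  ⊑⇒∣∣≤ (false ∷ A) (true ∷ B) s = ℕₚ.m≤n⇒m≤1+n (⊑⇒∣∣≤ A B (s ∘ suc))
  ⊑⇒∣∣≤ (false ∷ A) (false ∷ B) s = ⊑⇒∣∣≤ A B (s ∘ suc)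

  ⊑-equal : ∀ {n} (A B : Subset n) → A ⊑ B → ∣ A ∣ ≡ ∣ B ∣ → A ≡ B
  ⊑-equal [] [] s e = ≡.refl
  ⊑-equal (true ∷ A) (true ∷ B) s e = ≡.cong (true ∷_) (⊑-equal A B (s ∘ suc) (ℕₚ.suc-injective e))
  ⊑-equal (true ∷ A) (false ∷ B) s e with s zero ≡.refl
  ... | ()
  ⊑-equal (false ∷ A) (true ∷ B) s e = ⊥-elim (ℕₚ.<-irrefl e (s≤s (⊑⇒∣∣≤ A B (s ∘ suc))))
  ⊑-equal (false ∷ A) (false ∷ B) s e = ≡.cong (false ∷_) (⊑-equal A B (s ∘ suc) e)

  support : ∀ {n} → List (Fin n) → Subset n
  support L = Vec.tabulate (λ i → does (DecMembership._∈?_ Finₚ._≟_ i L))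

  ∈-support : ∀ {n} {i : Fin n} {L} → i ∈ₗ L → lookup (support L) i ≡ true
  ∈-support {i = i} {L} m = ≡.trans (Vecₚ.lookup∘tabulate _ i) (dec-true (DecMembership._∈?_ Finₚ._≟_ i L) m)

  support-∈ : ∀ {n} {i : Fin n} {L} → lookup (support L) i ≡ true → i ∈ₗ L
  support-∈ {i = i} {L} e = does⁻ (DecMembership._∈?_ Finₚ._≟_ i L) (≡.trans (≡.sym (Vecₚ.lookup∘tabulate _ i)) e)

  elems-unique : ∀ {n} (C : Subset n) → Unique (elems C)
  elems-unique []          = []
  elems-unique (true ∷ C)  = All.tabulate (λ m e → fresh m e) ∷ Uniqueₚ.map⁺ Finₚ.suc-injective (elems-unique C)
    where
    fresh : ∀ {j} → j ∈ₗ map suc (elems C) → zero ≢ j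
    fresh m ≡.refl with Membershipₚ.∈-map⁻ suc m
    ... | _ , _ , ()
  elems-unique (false ∷ C) = Uniqueₚ.map⁺ Finₚ.suc-injective (elems-unique C)

  extract : ∀ {A : Set} (K L : List A) → Unique K → (∀ {i} → i ∈ₗ K → i ∈ₗ L) → ∃ λ B → L ↭ K ++ B
  extract []      L _ _ = L , ↭.refl
  extract (k ∷ K) L (k∉K ∷ unique) sub with Membershipₚ.∈-∃++ (sub (here ≡.refl))
  ... | xs , ys , ≡.refl with extract K (xs ++ ys) unique remaining
    where
    remaining : ∀ {i} → i ∈ₗ K → i ∈ₗ xs ++ ys
    remaining {i} m with Membershipₚ.∈-++⁻ xs (sub (there m))
    ... | inj₁ m′ = Membershipₚ.∈-++⁺ˡ m′
    ... | inj₂ (here ≡.refl) = ⊥-elim (All.lookup k∉K m ≡.refl)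
    ... | inj₂ (there m′) = Membershipₚ.∈-++⁺ʳ xs m′
  ... | B , perm = B , ↭.trans (↭ₚ.shift k xs ys) (↭.prep k perm)

  -- The combinatorics of a shelling of a simplicial sphere together with the reversed shelling:
  -- σ contributes the faces between R σ and σ, respectively between S σ = σ ∖ R σ and σ.
  record Shelling (d n : ℕ) : Set where
    field
      N : ℕ
      facet R S : Fin N → Subset n
      facet-size : ∀ σ → ∣ facet σ ∣ ≡ d
      R⊑ : ∀ σ → R σ ⊑ facet σ
      S⊑ : ∀ σ → S σ ⊑ facet σ
      R⊎S : ∀ σ i → lookup (facet σ) i ≡ true → (lookup (R σ) i ≡ true) ⊎ (lookup (S σ) i ≡ true)
      R+S : ∀ σ → ∣ R σ ∣ ℕ.+ ∣ S σ ∣ ≡ d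
      bound : ℕ
      rank : Fin N → ℕ
      rank≤ : ∀ σ → rank σ ≤ bound
      R-order : ∀ σ τ → R σ ⊑ facet τ → σ ≡ τ ⊎ rank τ < rank σ
      S-order : ∀ σ τ → S σ ⊑ facet τ → σ ≡ τ ⊎ rank σ < rank τ
      R-covers : ∀ F τ → F ⊑ facet τ → ∃ λ σ → R σ ⊑ F × F ⊑ facet σ
      S-covers : ∀ F τ → F ⊑ facet τ → ∃ λ σ → S σ ⊑ F × F ⊑ facet σ
      ridge : ∀ σ i → lookup (facet σ) i ≡ true → ∃₂ λ τ j → τ ≢ σ × lookup (facet τ) j ≡ true ×
        toggle j (facet τ) ≡ toggle i (facet σ) × (∀ ρ → toggle i (facet σ) ⊑ facet ρ → ρ ≡ σ ⊎ ρ ≡ τ)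

    -- h m = ∣ level m ∣
    level : ℕ → Subset N
    level m = Vec.tabulate (λ σ → does (∣ R σ ∣ ℕ.≟ m))

    level-∈ : ∀ m σ → lookup (level m) σ ≡ true → ∣ R σ ∣ ≡ m
    level-∈ m σ e = does⁻ (∣ R σ ∣ ℕ.≟ m) (≡.trans (≡.sym (Vecₚ.lookup∘tabulate _ σ)) e)

    ∈-level : ∀ m σ → ∣ R σ ∣ ≡ m → lookup (level m) σ ≡ true
    ∈-level m σ e = ≡.trans (Vecₚ.lookup∘tabulate _ σ) (dec-true (∣ R σ ∣ ℕ.≟ m) e)

  reverse-shelling : ∀ {d n} → Shelling d n → Shelling d n
  reverse-shelling sh = record
    { N = N ; facet = facet ; R = S ; S = R ; facet-size = facet-size ; R⊑ = S⊑ ; S⊑ = R⊑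
    ; R⊎S = λ σ i m → Sum.swap (R⊎S σ i m)
    ; R+S = λ σ → ≡.trans (ℕₚ.+-comm ∣ S σ ∣ ∣ R σ ∣) (R+S σ)
    ; bound = bound ; rank = λ σ → bound ∸ rank σ ; rank≤ = λ σ → ℕₚ.m∸n≤m bound (rank σ)
    ; R-order = λ σ τ s → Sum.map id (λ lt → ℕₚ.∸-monoʳ-< lt (rank≤ τ)) (S-order σ τ s)
    ; S-order = λ σ τ s → Sum.map id (λ lt → ℕₚ.∸-monoʳ-< lt (rank≤ σ)) (R-order σ τ s)
    ; R-covers = S-covers ; S-covers = R-covers ; ridge = ridge }
    where open Shelling sh

  module Lefschetz (K : CommutativeRing 0ℓ 0ℓ) (isField : IsField K)
    (x+x≈0 : ∀ x → CommutativeRing._≈_ K (CommutativeRing._+_ K x x) (CommutativeRing.0# K))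
    (d′ n : ℕ) (a : Fin (suc d′) → Fin n → CommutativeRing.Carrier K) (b : Fin n → CommutativeRing.Carrier K)
    (∂a : Fin (suc d′) → Fin n → Derivation K) (∂b : Fin n → Derivation K)
    (∂a-a : ∀ s j t k → CommutativeRing._≈_ K (Derivation.∂ (∂a s j) (a t k))
      (CommutativeRing._*_ K (δ⟨ K ⟩ s t) (δ⟨ K ⟩ j k)))
    (∂b-a : ∀ j t k → CommutativeRing._≈_ K (Derivation.∂ (∂b j) (a t k)) (CommutativeRing.0# K))
    (∂b-b : ∀ j k → CommutativeRing._≈_ K (Derivation.∂ (∂b j) (b k)) (δ⟨ K ⟩ j k))
    (shelling : Shelling (suc d′) n) where
    open CommutativeRing K hiding (zero)
    open IsField isField
    open Sums K
    open Char2Solver K x+x≈0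
    open Char2 K isField x+x≈0
    open Monomials K
    open HomogeneousSystems K isField
    open Derivation
    open GenericMatrix K isField x+x≈0 d′ n a ∂a ∂a-a
    open Shelling shelling
    open import Relation.Binary.Reasoning.Setoid setoid

    module At (τ : Fin N) = Facet (facet τ) (facet-size τ)
    open At using (p; wt; mon; coefficient)

    ψ : (Fin N → Carrier) → Carrier
    ψ g = sum (λ τ → wt τ * g τ)

    ψ-cong : ∀ {f g} → (∀ τ → f τ ≈ g τ) → ψ f ≈ ψ g
    ψ-cong e = sum-cong (λ τ → *-congˡ (e τ))

    ψ-sum : ∀ {m} (c : Fin m → Carrier) (g : Fin m → Fin N → Carrier) →
      ψ (λ τ → sum (λ j → c j * g j τ)) ≈ sum (λ j → c j * ψ (g j))
    ψ-sum c g = begin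
      sum (λ τ → wt τ * sum (λ j → c j * g j τ)) ≈⟨ sum-cong (λ τ → *-distribˡ-sum _ _) ⟩
      sum (λ τ → sum (λ j → wt τ * (c j * g j τ))) ≈⟨ ∑-comm _ ⟩
      sum (λ j → sum (λ τ → wt τ * (c j * g j τ))) ≈⟨ sum-cong (λ j → trans (sum-cong (λ τ →
        solve 3 (λ w c g → w :* (c :* g) := c :* (w :* g)) refl _ _ _)) (sym (*-distribˡ-sum _ _))) ⟩
      sum (λ j → c j * ψ (g j)) ∎

    -- The linear functionals on the face ring modulo θ₀ - 1 and θ_s for s ≥ 1, given by their
    -- values on monomials. The relation θ₀ = 1 is inhomogeneous, so degrees form a filtration only.
    record Functional (φ : List (Fin n) → Carrier) : Set where
      field
        φ-↭    : ∀ {L M} → L ↭ M → φ L ≈ φ M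
        φ-rel  : ∀ σ i L → sum (λ j → coefficient σ i j * φ (j ∷ L)) ≈ p σ i * φ L
        φ-face : ∀ L → (∀ τ → ¬ (support L ⊑ facet τ)) → φ L ≈ 0#

    outside-facet : ∀ L τ → ¬ (support L ⊑ facet τ) → mon τ L ≈ 0#
    outside-facet L τ notFace with Finₚ.any? (λ i → DecMembership._∈?_ Finₚ._≟_ i L ×-dec′ lookup (facet τ) i)
      where
      _×-dec′_ : ∀ {P : Set} → Dec P → (b : Bool) → Dec (P × b ≡ false)
      yes x ×-dec′ false = yes (x , ≡.refl)
      yes x ×-dec′ true  = no λ ()
      no ¬x ×-dec′ b     = no (¬x ∘ proj₁)
    ... | yes (i , i∈L , i∉τ) = At.mon-outside τ i∈L i∉τ
    ... | no none = ⊥-elim (notFace (λ i i∈L → Boolₚ.¬-not (λ e → none (i , support-∈ i∈L , e))))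

    -- Evaluation at each single point satisfies the linear relations by `UW` and kills monomials
    -- leaving that facet. The weights are arbitrary, so multiplication by ℓ and F can be absorbed
    -- into `g`.
    ψ-functional : ∀ (g : Fin N → Carrier) → Functional (λ L → ψ (λ τ → g τ * mon τ L))
    ψ-functional g = record
      { φ-↭ = λ e → ψ-cong (λ τ → *-congˡ (monomial-↭ (p τ) e))
      ; φ-rel = λ σ i L → begin
          sum (λ j → coefficient σ i j * ψ (λ τ → g τ * mon τ (j ∷ L))) ≈⟨ ψ-sum _ _ ⟨
          ψ (λ τ → sum (λ j → coefficient σ i j * (g τ * (p τ j * mon τ L)))) ≈⟨ ψ-cong (λ τ → begin
              sum (λ j → coefficient σ i j * (g τ * (p τ j * mon τ L)))
                ≈⟨ sum-cong (λ j → solve 4 (λ c g p m → c :* (g :* (p :* m)) := (c :* p) :* (g :* m)) refl _ _ _ _) ⟩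
              sum (λ j → (coefficient σ i j * p τ j) * (g τ * mon τ L)) ≈⟨ *-distribʳ-sum _ _ ⟨
              sum (λ j → coefficient σ i j * p τ j) * (g τ * mon τ L)
                ≈⟨ *-congʳ (At.coefficient-relation σ i (p τ) (λ s → At.UW τ s zero)) ⟩
              p σ i * (g τ * mon τ L) ∎) ⟩
          ψ (λ τ → p σ i * (g τ * mon τ L)) ≈⟨ trans (sum-cong (λ τ → solve 3 (λ w p g → w :* (p :* g) := p :* (w :* g)) refl _ _ _)) (sym (*-distribˡ-sum _ _)) ⟩
          p σ i * ψ (λ τ → g τ * mon τ L) ∎
      ; φ-face = λ L e → sum-zero (λ τ → trans (*-congˡ (trans (*-congˡ (outside-facet L τ (e τ))) (zeroʳ _))) (zeroʳ _)) }

    module _ {φ : List (Fin n) → Carrier} (functional : Functional φ) (e : ℕ)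
      (base : ∀ τ → ∣ S τ ∣ ≤ e → φ (elems (S τ)) ≈ 0#) where
      open Functional functional

      private
        Claim : Fin N → Set
        Claim σ = ∀ L → length L ≤ e → S σ ⊑ support L → support L ⊑ facet σ → φ L ≈ 0#

        -- Trading a variable of σ ∖ S σ for variables outside σ leads to facets of larger rank.
        straighten-at : ∀ σ → (∀ σ′ → rank σ < rank σ′ → Claim σ′) → ∀ B → length (elems (S σ) ++ B) ≤ e →
          (∀ {i} → i ∈ₗ B → lookup (facet σ) i ≡ true) → φ (elems (S σ) ++ B) ≈ 0#
        straighten-at σ IH [] len _ = trans (reflexive (≡.cong φ (Listₚ.++-identityʳ _)))
          (base σ (≡.subst (_≤ e) (≡.trans (≡.cong length (Listₚ.++-identityʳ (elems (S σ)))) (length-elems (S σ))) len))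
        straighten-at σ IH (i ∷ B) len sub = begin
          φ (elems (S σ) ++ i ∷ B) ≈⟨ φ-↭ (↭ₚ.shift i (elems (S σ)) B) ⟩
          φ (i ∷ L) ≈⟨ sum-δ i (λ j → φ (j ∷ L)) ⟨
          sum (λ j → δ i j * φ (j ∷ L)) ≈⟨ sum-cong term ⟨
          sum (λ j → coefficient σ i j * φ (j ∷ L)) ≈⟨ φ-rel σ i L ⟩
          p σ i * φ L ≈⟨ *-congˡ (straighten-at σ IH B (ℕₚ.≤-trans (ℕₚ.n≤1+n _) len′) (sub ∘ there)) ⟩
          p σ i * 0# ≈⟨ zeroʳ _ ⟩
          0# ∎
          where
          L = elems (S σ) ++ B
          len′ : suc (length L) ≤ e
          len′ = ≡.subst (_≤ e) (↭ₚ.↭-length (↭ₚ.shift i (elems (S σ)) B)) len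
          escape : ∀ j → lookup (facet σ) j ≡ false → φ (j ∷ L) ≈ 0#
          escape j j∉σ with Finₚ.any? (λ τ → support (j ∷ L) ⊑? facet τ)
          ... | no none = φ-face (j ∷ L) (λ τ s → none (τ , s))
          ... | yes (τ , s) with S-covers (support (j ∷ L)) τ s
          ... | σ′ , lower , upper with S-order σ σ′ (λ k k∈S → upper k (∈-support (there (Membershipₚ.∈-++⁺ˡ (∈-elems k (S σ) k∈S)))))
          ... | inj₁ ≡.refl = ⊥-elim (true≢false (≡.trans (≡.sym (upper j (∈-support {i = j} {j ∷ L} (here ≡.refl)))) j∉σ))
          ... | inj₂ lt = IH σ′ lt (j ∷ L) len′ lower upper
          term : ∀ j → coefficient σ i j * φ (j ∷ L) ≈ δ i j * φ (j ∷ L)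
          term j with lookup (facet σ) j in eq
          ... | true = *-congʳ (At.WU σ i j eq)
          ... | false = trans (trans (*-congˡ (escape j eq)) (zeroʳ _)) (sym (trans (*-congˡ (escape j eq)) (zeroʳ _)))

        -- Ranks grow along the recursion and never exceed `bound`.
        claim : ∀ fuel σ → bound ∸ rank σ < fuel → Claim σ
        claim (suc fuel) σ (s≤s lt) L len lower upper with extract (elems (S σ)) L (elems-unique (S σ))
                                                          (λ m → support-∈ (lower _ (elems-∈ (S σ) m)))
        ... | B , L↭ = trans (φ-↭ L↭) (straighten-at σ
          (λ σ′ lt′ → claim fuel σ′ (ℕₚ.<-≤-trans (ℕₚ.∸-monoʳ-< lt′ (rank≤ σ′)) lt)) B
          (≡.subst (_≤ e) (↭ₚ.↭-length L↭) len)
          (λ m → upper _ (∈-support (↭ₚ.∈-resp-↭ (↭.↭-sym L↭) (Membershipₚ.∈-++⁺ʳ (elems (S σ)) m)))))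

      -- The monomials x^{S τ} of degree at most `e` span: a monomial supported on a face lies
      -- between some S σ and σ, and rewriting its variables beyond S σ leads to shorter monomials
      -- or to intervals of facets of larger rank.
      straightening : ∀ L → length L ≤ e → φ L ≈ 0#
      straightening L len with Finₚ.any? (λ τ → support L ⊑? facet τ)
      ... | no none = φ-face L (λ τ s → none (τ , s))
      ... | yes (τ , s) with S-covers (support L) τ s
      ... | σ , lower , upper = claim (suc (bound ∸ rank σ)) σ ℕₚ.≤-refl L len lower upper

    ψ₁ : List (Fin n) → Carrier
    ψ₁ L = ψ (λ τ → 1# * mon τ L)

    ψ₁-functional : Functional ψ₁
    ψ₁-functional = ψ-functional (λ _ → 1#)

    open Functional ψ₁-functional

    -- Only the two facets through the ridge contribute, and by `ridge-term` each contributes the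
    -- inverse of the same minor.
    ridge-sum : ∀ σ i → lookup (facet σ) i ≡ true → ψ₁ (elems (toggle i (facet σ))) ≈ 0#
    ridge-sum σ i i∈σ with ridge σ i i∈σ
    ... | τ , j , τ≢σ , j∈τ , ρ≡ , only = begin
      sum g ≈⟨ sum-cong split ⟩
      sum (λ μ → δ σ μ * g μ + δ τ μ * g μ) ≈⟨ ∑-distrib-+ _ _ ⟩
      sum (λ μ → δ σ μ * g μ) + sum (λ μ → δ τ μ * g μ) ≈⟨ +-cong (sum-δ σ g) (sum-δ τ g) ⟩
      g σ + g τ ≈⟨ +-congʳ equal ⟩
      g τ + g τ ≈⟨ x+x≈0 _ ⟩
      0# ∎
      where
      ρ = toggle i (facet σ)
      g : Fin N → Carrier
      g μ = wt μ * (1# * mon μ (elems ρ))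
      normal : ∀ μ → g μ ≈ wt μ * mon μ (elems ρ)
      normal μ = *-congˡ (*-identityˡ _)
      P = perm a lastRows ρ
      gσ : g σ * P ≈ 1#
      gσ = trans (*-congʳ (normal σ)) (At.ridge-term σ i i∈σ)
      gτ : g τ * P ≈ 1#
      gτ = trans (*-congʳ (normal τ)) (≡.subst (λ ρ → (wt τ * mon τ (elems ρ)) * perm a lastRows ρ ≈ 1#) ρ≡ (At.ridge-term τ j j∈τ))
      equal : g σ ≈ g τ
      equal = *-cancelˡ {x = P} (λ z → 1≉0 (trans (sym gσ) (trans (*-congˡ z) (zeroʳ _))))
        (trans (*-comm _ _) (trans gσ (trans (sym gτ) (*-comm _ _))))
      split : ∀ μ → g μ ≈ δ σ μ * g μ + δ τ μ * g μ
      split μ with σ Finₚ.≟ μ | τ Finₚ.≟ μ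
      ... | yes ≡.refl | yes ≡.refl = ⊥-elim (τ≢σ ≡.refl)
      ... | yes ≡.refl | no ne = sym (trans (+-cong (trans (*-congʳ (reflexive (δ-refl σ))) (*-identityˡ _))
          (trans (*-congʳ (reflexive (δ-≢ ne))) (zeroˡ _))) (+-identityʳ _))
      ... | no ne | yes ≡.refl = sym (trans (+-cong (trans (*-congʳ (reflexive (δ-≢ ne))) (zeroˡ _))
          (trans (*-congʳ (reflexive (δ-refl τ))) (*-identityˡ _))) (+-identityˡ _))
      ... | no ne₁ | no ne₂ = trans zeroTerm (sym (trans (+-cong (trans (*-congˡ zeroTerm) (zeroʳ _)) (trans (*-congˡ zeroTerm) (zeroʳ _))) (+-identityˡ _)))
        where
        zeroTerm : g μ ≈ 0#
        zeroTerm = trans (normal μ) (trans (*-congˡ (outside-facet (elems ρ) μ notFace)) (zeroʳ _))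
          where
          notFace : ¬ (support (elems ρ) ⊑ facet μ)
          notFace s with only μ (λ k k∈ρ → s k (∈-support (∈-elems k ρ k∈ρ)))
          ... | inj₁ e = ne₁ (≡.sym e)
          ... | inj₂ e = ne₂ (≡.sym e)

    -- Induction upwards to the ridges, which have d - 1 elements. For a vertex i of a facet
    -- containing F, with i not in F, the relation for x_i writes p_i ψ(x_F) through ψ(x_j x_F) with
    -- j outside F only, since the coefficients at vertices of F vanish; and p_i is nonzero.
    squarefree : ∀ k (F : Subset n) → ∣ F ∣ ℕ.+ k ≡ d′ → ψ₁ (elems F) ≈ 0#
    squarefree k F size with Finₚ.any? (λ τ → support (elems F) ⊑? facet τ)
    ... | no none = φ-face (elems F) (λ τ s → none (τ , s))
    ... | yes (σ , s) with ⊑-witness F (facet σ) (≡.subst (∣ F ∣ <_) (≡.sym (facet-size σ)) (s≤s (≡.subst (∣ F ∣ ≤_) size (ℕₚ.m≤m+n _ k))))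
    squarefree zero F size | yes (σ , s) | i , i∈σ , i∉F =
      trans (reflexive (≡.cong (ψ₁ ∘ elems) F≡)) (ridge-sum σ i i∈σ)
      where
      F≡ : F ≡ toggle i (facet σ)
      F≡ = ⊑-equal F (toggle i (facet σ)) (⊑-toggle {A = F} {facet σ} {i} i∉F (λ j j∈F → s j (∈-support (∈-elems j F j∈F))))
        (≡.trans (≡.sym (ℕₚ.+-identityʳ _)) (≡.trans size (ℕₚ.suc-injective (≡.trans (≡.sym (facet-size σ)) (∣toggle∣ i (facet σ) i∈σ)))))
    squarefree (suc k) F size | yes (σ , s) | i , i∈σ , i∉F = integral (At.p≉0 σ i i∈σ)
      (trans (sym (φ-rel σ i (elems F))) (sum-zero term))
      where
      term : ∀ j → coefficient σ i j * ψ₁ (j ∷ elems F) ≈ 0#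
      term j with lookup F j in eq
      ... | true = trans (*-congʳ (trans (At.WU σ i j (s j (∈-support (∈-elems j F eq))))
          (reflexive (δ-≢ {i = i} {j} λ { ≡.refl → true≢false (≡.trans (≡.sym eq) i∉F) })))) (zeroˡ _)
      ... | false = trans (*-congˡ (trans (ψ-cong (λ τ → *-congˡ (sym (trans (monomial-toggle (p τ) j F′ j∈F′)
              (*-congˡ (reflexive (≡.cong (mon τ ∘ elems) (toggle-involutive j F))))))))
              (squarefree k F′ size′))) (zeroʳ _)
        where
        F′ = toggle j F
        j∈F′ : lookup F′ j ≡ true
        j∈F′ = ≡.trans (lookup-toggle j F) (≡.cong not eq)
        size′ : ∣ F′ ∣ ℕ.+ k ≡ d′
        size′ = ≡.trans (≡.cong (ℕ._+ k) (≡.trans (∣toggle∣ j F′ j∈F′) (≡.cong (suc ∘ ∣_∣) (toggle-involutive j F))))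
          (≡.trans (≡.sym (ℕₚ.+-suc ∣ F ∣ k)) size)

    ψ₁-low-degree : ∀ L → length L ≤ d′ → ψ₁ L ≈ 0#
    ψ₁-low-degree = straightening ψ₁-functional d′ (λ τ le → squarefree (d′ ∸ ∣ S τ ∣) (S τ) (ℕₚ.m+[n∸m]≡n le))

    sum-square : ∀ {m} (f : Fin m → Carrier) → sum (λ i → f i * f i) ≈ sum f * sum f
    sum-square {zero} f = trans sum-[] (sym (trans (*-congˡ sum-[]) (zeroʳ _)))
    sum-square {suc m} f = trans sum-∷ (trans (+-congˡ (sum-square (f ∘ suc))) (trans
      (solve 2 (λ x y → x :* x :+ y :* y := (x :+ y) :* (x :+ y)) refl _ _) (sym (*-cong sum-∷ sum-∷))))

    support-++ˡ : ∀ {A B C : Subset n} → support (elems A ++ elems B) ⊑ C → A ⊑ C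
    support-++ˡ {A} s i m = s i (∈-support (Membershipₚ.∈-++⁺ˡ (∈-elems i A m)))

    support-++ʳ : ∀ {A B C : Subset n} → support (elems A ++ elems B) ⊑ C → B ⊑ C
    support-++ʳ {A} {B} s i m = s i (∈-support (Membershipₚ.∈-++⁺ʳ (elems A) (∈-elems i B m)))

    gram : Fin N → Fin N → Carrier
    gram σ τ = ψ₁ (elems (R σ) ++ elems (S τ))

    -- A facet ρ containing R σ and S τ has rank at most that of σ and at least that of τ, with
    -- equality of ranks only for equal facets. In all remaining cases the product is supported on
    -- no face.
    gram-triangular : ∀ σ τ → ¬ (σ ≡ τ) → ¬ (rank τ < rank σ) → gram σ τ ≈ 0#
    gram-triangular σ τ σ≢τ ≮ = φ-face (elems (R σ) ++ elems (S τ)) notFace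
      where
      notFace : ∀ ρ → ¬ (support (elems (R σ) ++ elems (S τ)) ⊑ facet ρ)
      notFace ρ s with R-order σ ρ (support-++ˡ {R σ} {S τ} {facet ρ} s) | S-order τ ρ (support-++ʳ {R σ} {S τ} {facet ρ} s)
      ... | inj₁ ≡.refl | inj₁ ≡.refl = σ≢τ ≡.refl
      ... | inj₁ ≡.refl | inj₂ lt = ≮ lt
      ... | inj₂ lt | inj₁ ≡.refl = ≮ lt
      ... | inj₂ lt | inj₂ lt′ = ≮ (ℕₚ.<-trans lt′ lt)

    -- The two orders leave τ as the only facet containing both R τ and S τ, and its term is a
    -- nonzero weight times coordinates that do not vanish.
    gram-diagonal : ∀ τ → ¬ (gram τ τ ≈ 0#)
    gram-diagonal τ e = *-nonzero (At.wt≉0 τ) (At.mon≉0 τ M inside) (trans (*-congˡ (sym (*-identityˡ _))) (trans (sym (sum-single τ others)) e))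
      where
      M = elems (R τ) ++ elems (S τ)
      inside : ∀ {i} → i ∈ₗ M → lookup (facet τ) i ≡ true
      inside {i} m with Membershipₚ.∈-++⁻ (elems (R τ)) m
      ... | inj₁ m′ = R⊑ τ i (elems-∈ (R τ) m′)
      ... | inj₂ m′ = S⊑ τ i (elems-∈ (S τ) m′)
      others : ∀ ρ → ρ ≢ τ → wt ρ * (1# * mon ρ M) ≈ 0#
      others ρ ρ≢τ = trans (*-congˡ (trans (*-congˡ (outside-facet M ρ notFace)) (zeroʳ _))) (zeroʳ _)
        where
        notFace : ¬ (support M ⊑ facet ρ)
        notFace s with R-order τ ρ (support-++ˡ {R τ} {S τ} {facet ρ} s) | S-order τ ρ (support-++ʳ {R τ} {S τ} {facet ρ} s)
        ... | inj₁ e | _ = ρ≢τ (≡.sym e)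
        ... | inj₂ _ | inj₁ e = ρ≢τ (≡.sym e)
        ... | inj₂ lt | inj₂ lt′ = ℕₚ.<-asym lt lt′

    ℓ : Fin N → Carrier
    ℓ τ = sum (λ j → b j * p τ j)

    module Kernel (m : ℕ) (2m≤d′ : m ℕ.+ m ≤ d′) (μ : Fin N → Carrier)
      (μ-outside : ∀ σ → ∣ R σ ∣ ≢ m → μ σ ≈ 0#) where

      F : Fin N → Carrier
      F τ = sum (λ σ → μ σ * mon τ (elems (R σ)))

      F-expand : ∀ (c w : Fin N → Carrier) →
        ψ (λ τ → (c τ * F τ) * w τ) ≈ sum (λ σ → μ σ * ψ (λ τ → (c τ * mon τ (elems (R σ))) * w τ))
      F-expand c w = trans (ψ-cong (λ τ → trans (solve 3 (λ c f w → (c :* f) :* w := f :* (c :* w)) refl _ _ _)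
        (trans (*-distribʳ-sum _ _) (sum-cong (λ σ → solve 4 (λ u m c w → (u :* m) :* (c :* w) := u :* ((c :* m) :* w)) refl _ _ _ _)))))
        (ψ-sum μ _)

      μ-terms : ∀ {t : Fin N → Carrier} → (∀ σ → ∣ R σ ∣ ≡ m → t σ ≈ 0#) → sum (λ σ → μ σ * t σ) ≈ 0#
      μ-terms {t} e = sum-zero term
        where
        term : ∀ σ → μ σ * t σ ≈ 0#
        term σ with ∣ R σ ∣ ℕ.≟ m
        ... | yes eq = trans (*-congˡ (e σ eq)) (zeroʳ _)
        ... | no ne = trans (*-congʳ (μ-outside σ ne)) (zeroˡ _)

      φ : List (Fin n) → Carrier
      φ L = ψ (λ τ → (ℓ τ * F τ) * mon τ L)

      module _ (kernel : ∀ τ → ∣ R τ ∣ ≡ suc m → φ (elems (S τ)) ≈ 0#) where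

        -- If ∣R τ∣ = m + 1 this is the kernel condition. Otherwise S τ has fewer than d - 1 - m
        -- elements, so ℓ x^{R σ} x^{S τ} with ∣R σ∣ = m has degree below d and ψ kills it.
        φ-base : ∀ τ → ∣ S τ ∣ ≤ d′ ∸ m → φ (elems (S τ)) ≈ 0#
        φ-base τ le with ∣ R τ ∣ ℕ.≟ suc m
        ... | yes eq = kernel τ eq
        ... | no ne = trans (F-expand ℓ (λ τ′ → mon τ′ (elems (S τ)))) (μ-terms (λ σ eq → begin
            ψ (λ ρ → (ℓ ρ * mon ρ (elems (R σ))) * mon ρ (elems (S τ)))
              ≈⟨ ψ-cong (λ ρ → trans (*-assoc _ _ _) (trans (*-distribʳ-sum _ _) (sum-cong (λ j → begin
                   (b j * p ρ j) * (mon ρ (elems (R σ)) * mon ρ (elems (S τ))) ≈⟨ *-congˡ (sym (monomial-++ (p ρ) (elems (R σ)) (elems (S τ)))) ⟩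
                   (b j * p ρ j) * mon ρ (M σ) ≈⟨ solve 3 (λ b p m → (b :* p) :* m := b :* (con true :* (p :* m))) refl _ _ _ ⟩
                   b j * (1# * (p ρ j * mon ρ (M σ))) ∎)))) ⟩
            ψ (λ ρ → sum (λ j → b j * (1# * (p ρ j * mon ρ (M σ))))) ≈⟨ ψ-sum b _ ⟩
            sum (λ j → b j * ψ₁ (j ∷ M σ)) ≈⟨ sum-zero (λ j → trans (*-congˡ (ψ₁-low-degree (j ∷ M σ) (short σ eq))) (zeroʳ _)) ⟩
            0# ∎))
          where
          M : Fin N → List (Fin n)
          M σ = elems (R σ) ++ elems (S τ)
          R>m : suc m < ∣ R τ ∣
          R>m = ℕₚ.≤∧≢⇒< (ℕₚ.+-cancelʳ-≤ (∣ S τ ∣) (suc m) (∣ R τ ∣)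
            (≡.subst (suc m ℕ.+ ∣ S τ ∣ ≤_) (≡.sym (R+S τ)) (s≤s (≡.subst (m ℕ.+ ∣ S τ ∣ ≤_)
              (ℕₚ.m+[n∸m]≡n (ℕₚ.≤-trans (ℕₚ.m≤m+n m m) 2m≤d′)) (ℕₚ.+-monoʳ-≤ m le))))) (ne ∘ ≡.sym)
          short : ∀ σ → ∣ R σ ∣ ≡ m → suc (length (M σ)) ≤ d′
          short σ eq = ≡.subst (λ k → suc k ≤ d′) (≡.sym (≡.trans (Listₚ.length-++ (elems (R σ)))
            (≡.cong₂ ℕ._+_ (≡.trans (length-elems (R σ)) eq) (length-elems (S τ)))))
            (ℕₚ.≤-pred (≡.subst (suc (suc m) ℕ.+ ∣ S τ ∣ ≤_) (R+S τ) (ℕₚ.+-monoˡ-≤ ∣ S τ ∣ R>m)))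

        φ≈0 : ∀ L → length L ≤ d′ ∸ m → φ L ≈ 0#
        φ≈0 = straightening (ψ-functional (λ τ → ℓ τ * F τ)) (d′ ∸ m) φ-base

        -- Expanding ℓ turns ψ(ℓF²x_I) into the stated sum. Expanding instead one factor F into the
        -- x^{R σ} leaves ψ(ℓF·x^{R σ}x_I) with m + (d-1-2m) = d-1-m further variables, where φ
        -- vanishes.
        quadratic : ∀ I → length I ≡ d′ ∸ (m ℕ.+ m) →
          sum (λ j → b j * ψ (λ τ → (F τ * F τ) * mon τ (j ∷ I))) ≈ 0#
        quadratic I len = begin
          sum (λ j → b j * ψ (λ τ → (F τ * F τ) * mon τ (j ∷ I))) ≈⟨ ψ-sum b _ ⟨
          ψ (λ τ → sum (λ j → b j * ((F τ * F τ) * (p τ j * mon τ I)))) ≈⟨ ψ-cong (λ τ → trans (sum-cong (λ j →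
              solve 4 (λ b f p m → b :* ((f :* f) :* (p :* m)) := (b :* p) :* ((f :* f) :* m)) refl _ _ _ _)) (trans (sym (*-distribʳ-sum _ _))
              (solve 3 (λ l f m → l :* ((f :* f) :* m) := ((l :* f) :* f) :* m) refl _ _ _))) ⟩
          ψ (λ τ → ((ℓ τ * F τ) * F τ) * mon τ I) ≈⟨ F-expand _ _ ⟩
          sum (λ σ → μ σ * ψ (λ τ → ((ℓ τ * F τ) * mon τ (elems (R σ))) * mon τ I)) ≈⟨ μ-terms (λ σ eq → trans
              (ψ-cong (λ τ → trans (*-assoc _ _ _) (*-congˡ (sym (monomial-++ (p τ) (elems (R σ)) I)))))
              (φ≈0 (elems (R σ) ++ I) (ℕₚ.≤-reflexive (≡.trans (Listₚ.length-++ (elems (R σ)))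
                (≡.trans (≡.cong₂ ℕ._+_ (≡.trans (length-elems (R σ)) eq) len) (arithmetic))))))  ⟩
          0# ∎
          where
          arithmetic : m ℕ.+ (d′ ∸ (m ℕ.+ m)) ≡ d′ ∸ m
          arithmetic = ≡.trans (≡.cong (m ℕ.+_) (≡.sym (ℕₚ.∸-+-assoc d′ m m)))
            (ℕₚ.m+[n∸m]≡n (ℕₚ.+-cancelˡ-≤ m _ _ (≡.subst (m ℕ.+ m ≤_) (≡.sym (ℕₚ.m+[n∸m]≡n (ℕₚ.≤-trans (ℕₚ.m≤m+n m m) 2m≤d′))) 2m≤d′)))

        -- F² and the weights are constants of ∂b i, so differentiating isolates the i-th term.
        square-vanishes : ∀ i I → length I ≡ d′ ∸ (m ℕ.+ m) → ψ (λ τ → (F τ * F τ) * mon τ (i ∷ I)) ≈ 0#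
        square-vanishes i I len = begin
          X i ≈⟨ sum-δ i X ⟨
          sum (λ j → δ i j * X j) ≈⟨ sum-cong (λ j → sym (begin
              ∂ D (b j * X j) ≈⟨ ∂-* D _ _ ⟩
              ∂ D (b j) * X j + b j * ∂ D (X j) ≈⟨ +-cong (*-congʳ (∂b-b i j)) (trans (*-congˡ (constant j)) (zeroʳ _)) ⟩
              δ i j * X j + 0# ≈⟨ +-identityʳ _ ⟩
              δ i j * X j ∎)) ⟩
          sum (λ j → ∂ D (b j * X j)) ≈⟨ ∂-sum D _ ⟨
          ∂ D (sum (λ j → b j * X j)) ≈⟨ ∂-cong D (quadratic I len) ⟩
          ∂ D 0# ≈⟨ ∂-zero D ⟩
          0# ∎
          where
          D = ∂b i
          X : Fin n → Carrier
          X j = ψ (λ τ → (F τ * F τ) * mon τ (j ∷ I))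
          constant : ∀ j → ∂ D (X j) ≈ 0#
          constant j = trans (∂-sum D _) (sum-zero (λ τ → trans (∂-const-* D (At.wt-constant τ D (∂b-a i)))
            (trans (*-congˡ (trans (∂-square-* D (F τ) _) (trans (*-congˡ (At.mon-constant τ D (∂b-a i) (j ∷ I))) (zeroʳ _)))) (zeroʳ _))))

        orthogonal : ∀ L → length L ≡ suc d′ ∸ m → ψ (λ τ → F τ * mon τ L) ≈ 0#
        orthogonal L len = root (begin
          ψ (λ τ → F τ * mon τ L) * ψ (λ τ → F τ * mon τ L) ≈⟨ sum-square _ ⟨
          sum (λ τ → (wt τ * (F τ * mon τ L)) * (wt τ * (F τ * mon τ L))) ≈⟨ sum-cong (λ τ → sym (begin
              Diff rows J (wt τ * ((F τ * F τ) * mon τ I)) ≈⟨ Diff-cong rows J (solve 3 (λ w f m → w :* (f :* m) := f :* (w :* m)) refl _ _ _) ⟩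
              Diff rows J ((F τ * F τ) * (wt τ * mon τ I)) ≈⟨ Diff-square-* rows J (F τ) _ ⟩
              (F τ * F τ) * Diff rows J (wt τ * mon τ I) ≈⟨ *-congˡ (At.Diff-wt-mon τ J I lenJ parity-J) ⟩
              (F τ * F τ) * ((wt τ * wt τ) * (mon τ J * mon τ I)) ≈⟨ *-congˡ (*-congˡ (*-congʳ (monomial-++ (p τ) P (P ++ I)))) ⟩
              (F τ * F τ) * ((wt τ * wt τ) * ((mon τ P * mon τ (P ++ I)) * mon τ I))
                ≈⟨ *-congˡ (*-congˡ (trans (solve 3 (λ x y z → (x :* y) :* z := (x :* z) :* y) refl _ _ _) (*-congʳ (sym (monomial-++ (p τ) P I))))) ⟩
              (F τ * F τ) * ((wt τ * wt τ) * (mon τ (P ++ I) * mon τ (P ++ I)))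
                ≈⟨ solve 3 (λ f w m → (f :* f) :* ((w :* w) :* (m :* m)) := (w :* (f :* m)) :* (w :* (f :* m))) refl _ _ _ ⟩
              (wt τ * (F τ * mon τ (P ++ I))) * (wt τ * (F τ * mon τ (P ++ I)))
                ≡⟨ ≡.cong (λ L → (wt τ * (F τ * mon τ L)) * (wt τ * (F τ * mon τ L))) (Listₚ.take++drop≡id m L) ⟩
              (wt τ * (F τ * mon τ L)) * (wt τ * (F τ * mon τ L)) ∎)) ⟩
          sum (λ τ → Diff rows J (wt τ * ((F τ * F τ) * mon τ I))) ≈⟨ Diff-sum rows J _ ⟨
          Diff rows J (ψ (λ τ → (F τ * F τ) * mon τ I)) ≈⟨ Diff-cong rows J (vanishes I lenI) ⟩
          Diff rows J 0# ≈⟨ Diff-zero rows J ⟩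
          0# ∎)
          where
          -- `J` takes the first m vertices of L twice and the others once: then x_J x_I = x_P² x_I²
          -- = x_L², and `J` has m + (d - m) = d entries, one for each row.
          P = List.take m L
          I = List.drop m L
          J = P ++ (P ++ I)
          m≤d′ : m ≤ d′
          m≤d′ = ℕₚ.≤-trans (ℕₚ.m≤m+n m m) 2m≤d′
          root : ∀ {x} → x * x ≈ 0# → x ≈ 0#
          root {x} e with x ≟ 0#
          ... | yes z = z
          ... | no nz = integral nz e
          lenI : length I ≡ suc (d′ ∸ (m ℕ.+ m))
          lenI = ≡.trans (Listₚ.length-drop m L) (≡.trans (≡.cong (_∸ m) len)
            (≡.trans (ℕₚ.∸-+-assoc (suc d′) m m) (ℕₚ.+-∸-assoc 1 2m≤d′)))
          lenP : length P ≡ m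
          lenP = ≡.trans (Listₚ.length-take m L) (ℕₚ.m≤n⇒m⊓n≡m (≡.subst (m ≤_) (≡.sym len)
            (ℕₚ.+-cancelˡ-≤ m _ _ (≡.subst (m ℕ.+ m ≤_) (≡.sym (ℕₚ.m+[n∸m]≡n (ℕₚ.m≤n⇒m≤1+n m≤d′))) (ℕₚ.m≤n⇒m≤1+n 2m≤d′)))))
          lenJ : length J ≡ suc d′
          lenJ = ≡.trans (Listₚ.length-++ P) (≡.trans (≡.cong₂ ℕ._+_ lenP (≡.trans (≡.cong length (Listₚ.take++drop≡id m L)) len))
            (ℕₚ.m+[n∸m]≡n (ℕₚ.m≤n⇒m≤1+n m≤d′)))
          parity-J : toggles (toggles ⊤ I) J ≡ ⊤
          parity-J = ≡.trans (Listₚ.foldr-++ toggle _ P (P ++ I)) (≡.trans (≡.cong (λ C → toggles C P)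
            (≡.trans (Listₚ.foldr-++ toggle _ P I) (≡.cong (λ C → toggles C P) (toggles-twice ⊤ I)))) (toggles-twice ⊤ P))
          vanishes : ∀ I → length I ≡ suc (d′ ∸ (m ℕ.+ m)) → ψ (λ τ → (F τ * F τ) * mon τ I) ≈ 0#
          vanishes (i ∷ I) e = square-vanishes i I (ℕₚ.suc-injective e)

        -- Back substitution from the largest rank down. In the pairing of F with x^{S τ}, facets of
        -- larger rank have coefficient zero by induction, all others except τ drop out by
        -- triangularity, and the diagonal entry is nonzero.
        μ≈0 : ∀ fuel τ → bound ∸ rank τ < fuel → μ τ ≈ 0#
        μ≈0 (suc fuel) τ (s≤s lt) with ∣ R τ ∣ ℕ.≟ m
        ... | no ne = μ-outside τ ne
        ... | yes eq = integral (gram-diagonal τ) (begin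
          gram τ τ * μ τ ≈⟨ *-comm _ _ ⟩
          μ τ * gram τ τ ≈⟨ sum-single τ others ⟨
          sum (λ σ → μ σ * gram σ τ) ≈⟨ sum-cong (λ σ → *-congˡ (ψ-cong (λ ρ → trans (*-congˡ (monomial-++ (p ρ) (elems (R σ)) (elems (S τ)))) (sym (*-assoc _ _ _))))) ⟩
          sum (λ σ → μ σ * ψ (λ ρ → (1# * mon ρ (elems (R σ))) * mon ρ (elems (S τ)))) ≈⟨ F-expand (λ _ → 1#) _ ⟨
          ψ (λ ρ → (1# * F ρ) * mon ρ (elems (S τ))) ≈⟨ ψ-cong (λ ρ → *-congʳ (*-identityˡ _)) ⟩
          ψ (λ ρ → F ρ * mon ρ (elems (S τ))) ≈⟨ orthogonal (elems (S τ)) (≡.trans (length-elems (S τ))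
              (≡.trans (≡.sym (ℕₚ.m+n∸m≡n m ∣ S τ ∣)) (≡.cong (_∸ m) (≡.trans (≡.cong (ℕ._+ ∣ S τ ∣) (≡.sym eq)) (R+S τ))))) ⟩
          0# ∎)
          where
          others : ∀ σ → σ ≢ τ → μ σ * gram σ τ ≈ 0#
          others σ σ≢τ with rank τ ℕₚ.<? rank σ
          ... | yes less = trans (*-congʳ (μ≈0 fuel σ (ℕₚ.<-≤-trans (ℕₚ.∸-monoʳ-< less (rank≤ σ)) lt))) (zeroˡ _)
          ... | no ≮ = trans (*-congˡ (gram-triangular σ τ σ≢τ ≮)) (zeroʳ _)

    h-increasing : ∀ m → m ℕ.+ m ≤ d′ → ∣ level m ∣ ≤ ∣ level (suc m) ∣
    h-increasing m 2m≤d′ with ∣ level m ∣ ℕ.≤? ∣ level (suc m) ∣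
    ... | yes le = le
    ... | no ≰ = ⊥-elim (nz (μ≈0 kernel (suc (bound ∸ rank (proj₁ (proj₂ (proj₂ solution))))) _ ℕₚ.≤-refl))
      where
      E = elems (level (suc m))
      -- One equation ψ(ℓ F x^{S τ}) = 0 for each facet τ at level m + 1, in the coefficients of F,
      -- which are indexed by level m.
      A : Fin (length E) → Fin N → Carrier
      A e σ = ψ (λ τ → (ℓ τ * mon τ (elems (R σ))) * mon τ (elems (S (List.lookup E e))))
      solution = nontrivial-solution (length E) (level m)
        (≡.subst (_< ∣ level m ∣) (≡.sym (length-elems (level (suc m)))) (ℕₚ.≰⇒> ≰)) A
      μ = proj₁ solution
      nz = proj₂ (proj₂ (proj₂ solution))
      open Kernel m 2m≤d′ μ (λ σ ne → proj₁ (proj₁ (proj₂ solution)) σ (λ m∈ → ne (level-∈ m σ (Vecₚ.[]=⇒lookup m∈))))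
      kernel : ∀ τ → ∣ R τ ∣ ≡ suc m → φ (elems (S τ)) ≈ 0#
      kernel τ eq = trans (F-expand ℓ _) (≡.subst (λ τ → sum (λ σ → μ σ * ψ (λ ρ → (ℓ ρ * mon ρ (elems (R σ))) * mon ρ (elems (S τ)))) ≈ 0#)
        (≡.sym (Anyₚ.lookup-index τ∈)) (proj₂ (proj₁ (proj₂ solution)) (Any.index τ∈)))
        where
        τ∈ : τ ∈ₗ E
        τ∈ = ∈-elems τ (level (suc m)) (∈-level (suc m) τ eq)

open Shellings

-- A field with enough variables for the matrix and the linear form

module GenericFields where
  open import Data.Fin.Subset using (∣_∣)
  open import Data.Nat as ℕ using (ℕ; zero; suc; _≤_)
  open import Relation.Binary.PropositionalEquality as ≡ using (_≡_)

  module WithVariables (K : CommutativeRing 0ℓ 0ℓ) (isField : IsField K)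
    (x+x≈0 : ∀ x → CommutativeRing._≈_ K (CommutativeRing._+_ K x x) (CommutativeRing.0# K))
    (d′ n : ℕ) (coordinates : Coordinates K (suc (suc d′) ℕ.* n)) where
    open CommutativeRing K hiding (zero)
    open Coordinates coordinates
    open Sums K

    δ-combine : ∀ {m} (s t : Fin m) (j k : Fin n) → δ (Fin.combine s j) (Fin.combine t k) ≈ δ s t * δ j k
    δ-combine s t j k with s Finₚ.≟ t | j Finₚ.≟ k
    ... | yes ≡.refl | yes ≡.refl = trans (reflexive (δ-refl (Fin.combine s j)))
      (sym (trans (*-cong (reflexive (δ-refl s)) (reflexive (δ-refl j))) (*-identityˡ _)))
    ... | yes ≡.refl | no j≢k = trans (reflexive (δ-≢ (j≢k ∘ proj₂ ∘ Finₚ.combine-injective s j s k)))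
      (sym (trans (*-congˡ (reflexive (δ-≢ j≢k))) (zeroʳ _)))
    ... | no s≢t | _ = trans (reflexive (δ-≢ (s≢t ∘ proj₁ ∘ Finₚ.combine-injective s j t k)))
      (sym (trans (*-congʳ (reflexive (δ-≢ s≢t))) (zeroˡ _)))

    -- The variables form d + 1 rows of length n: row zero supplies the coefficients of the linear
    -- form, the other d rows supply the matrix.
    increasing : (shelling : Shelling (suc d′) n) → ∀ m → m ℕ.+ m ≤ d′ →
      ∣ Shelling.level shelling m ∣ ≤ ∣ Shelling.level shelling (suc m) ∣
    increasing = Lefschetz.h-increasing K isField x+x≈0 d′ n
      (λ s j → x (Fin.combine {suc (suc d′)} (suc s) j)) (λ j → x (Fin.combine {suc (suc d′)} zero j))
      (λ s j → ∂/ (Fin.combine {suc (suc d′)} (suc s) j)) (λ j → ∂/ (Fin.combine {suc (suc d′)} zero j))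
      (λ s j t k → trans (∂x _ _) (δ-combine {suc (suc d′)} (suc s) (suc t) j k))
      (λ j t k → trans (∂x _ _) (trans (δ-combine {suc (suc d′)} zero (suc t) j k) (zeroˡ _)))
      (λ j k → trans (∂x _ _) (trans (δ-combine {suc (suc d′)} zero zero j k) (*-identityˡ _)))

  h-increasing : ∀ {d′ n} (shelling : Shelling (suc d′) n) → ∀ m → m ℕ.+ m ≤ d′ →
    ∣ Shelling.level shelling m ∣ ≤ ∣ Shelling.level shelling (suc m) ∣
  h-increasing {d′} {n} = WithVariables.increasing Frac Frac-isField Frac-char2 d′ n
    (extend (Polynomials-coordinates variables))
    where
    variables = suc (suc d′) ℕ.* n
    open Fractions (Polynomials variables) (Polynomials-isDomain variables)

open GenericFields

-- Facets of a rational polytope and their line shellings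

module RationalLinearAlgebra where
  open import Defs
  open import Data.Fin.Subset as Subset using (Subset; _∉_; ∣_∣; ⊤)
  open import Data.Nat as ℕ using (ℕ; zero; suc)
  open import Data.Rational using (ℚ; 0ℚ; 1ℚ; _+_; _*_; -_; _≤_; _<_; _-_; 1/_; ∣_∣)
  import Data.Rational as ℚ
  open import Data.Rational.Solver using (module +-*-Solver)
  open import Relation.Binary.PropositionalEquality using (_≡_; _≢_; refl; sym; trans; cong; cong₂; subst)

  ℚ-ring : CommutativeRing 0ℓ 0ℓ
  ℚ-ring = ℚₚ.+-*-commutativeRing

  ℚ-isField : IsField ℚ-ring
  ℚ-isField = record { _⁻¹ = inv ; inverse = λ {x} → inv-inverse x ; _≟_ = ℚₚ._≟_ ; 1≉0 = λ () }
    where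
    inv : ℚ → ℚ
    inv x with x ℚₚ.≟ 0ℚ
    ... | yes _ = 0ℚ
    ... | no nz = (1/ x) {{ℚ.≢-nonZero nz}}
    inv-inverse : ∀ x → x ≢ 0ℚ → x * inv x ≡ 1ℚ
    inv-inverse x nz with x ℚₚ.≟ 0ℚ
    ... | yes z = ⊥-elim (nz z)
    ... | no nz′ = ℚₚ.*-inverseʳ x {{ℚ.≢-nonZero nz′}}

  open Sums ℚ-ring
  open HomogeneousSystems ℚ-ring ℚ-isField
  open IsField ℚ-isField using (_⁻¹; inverse; integral)
  open +-*-Solver using (solve; _:=_; _:+_; _:*_; :-_; _:-_)

  module Signs where
    1≢0 : 1ℚ ≢ 0ℚ
    1≢0 ()

    +-≤ : ∀ {x y} → 0ℚ ≤ x → 0ℚ ≤ y → 0ℚ ≤ x + y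
    +-≤ = ℚₚ.+-mono-≤

    +-<-≤ : ∀ {x y} → 0ℚ < x → 0ℚ ≤ y → 0ℚ < x + y
    +-<-≤ = ℚₚ.+-mono-<-≤

    +-≤-< : ∀ {x y} → 0ℚ ≤ x → 0ℚ < y → 0ℚ < x + y
    +-≤-< = ℚₚ.+-mono-≤-<

    *-≤ : ∀ {x y} → 0ℚ ≤ x → 0ℚ ≤ y → 0ℚ ≤ x * y
    *-≤ {x} {y} p q = ℚₚ.nonNegative⁻¹ (x * y) {{ℚₚ.nonNeg*nonNeg⇒nonNeg x {{ℚ.nonNegative p}} y {{ℚ.nonNegative q}}}}

    *-< : ∀ {x y} → 0ℚ < x → 0ℚ < y → 0ℚ < x * y
    *-< {x} {y} p q = ℚₚ.positive⁻¹ (x * y) {{ℚₚ.pos*pos⇒pos x {{ℚ.positive p}} y {{ℚ.positive q}}}}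

    neg-< : ∀ {x} → x < 0ℚ → 0ℚ < - x
    neg-< = ℚₚ.neg-antimono-<

    <⇒≢ : ∀ {x} → 0ℚ < x → x ≢ 0ℚ
    <⇒≢ lt refl = ℚₚ.<-irrefl refl lt

    <⇒≱ : ∀ {x y} → x < y → ¬ (y ≤ x)
    <⇒≱ lt le = ℚₚ.<-irrefl refl (ℚₚ.<-≤-trans lt le)

    ⁻¹-< : ∀ {x} → 0ℚ < x → 0ℚ < x ⁻¹
    ⁻¹-< {x} lt with ℚₚ.<-cmp 0ℚ (x ⁻¹)
    ... | tri< a _ _ = a
    ... | tri≈ _ e _ = ⊥-elim (1≢0 (trans (sym (inverse (<⇒≢ lt))) (trans (cong (x *_) (sym e)) (ℚₚ.*-zeroʳ x))))
    ... | tri> _ _ c = ⊥-elim (ℚₚ.<-asym (*-< lt (neg-< c)) (subst (_< 0ℚ) eq (ℚₚ.negative⁻¹ (- 1ℚ))))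
      where
      eq : - 1ℚ ≡ x * - (x ⁻¹)
      eq = trans (cong -_ (sym (inverse (<⇒≢ lt)))) (ℚₚ.neg-distribʳ-* x (x ⁻¹))

    ≤-from-zero : ∀ {x y} → 0ℚ ≤ y - x → x ≤ y
    ≤-from-zero {x} {y} le = ℚₚ.≤-trans (ℚₚ.≤-reflexive (sym (ℚₚ.+-identityˡ x)))
      (ℚₚ.≤-trans (ℚₚ.+-monoˡ-≤ x le) (ℚₚ.≤-reflexive (solve 2 (λ x y → (y :- x) :+ x := y) refl x y)))

    zero-from-≤ : ∀ {x y} → x ≤ y → 0ℚ ≤ y - x
    zero-from-≤ {x} {y} le = ℚₚ.≤-trans (ℚₚ.≤-reflexive (sym (ℚₚ.+-inverseʳ x))) (ℚₚ.+-monoˡ-≤ (- x) le)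

    <-from-zero : ∀ {x y} → 0ℚ < y - x → x < y
    <-from-zero {x} {y} lt = ℚₚ.≤-<-trans (ℚₚ.≤-reflexive (sym (ℚₚ.+-identityˡ x)))
      (ℚₚ.<-≤-trans (ℚₚ.+-monoˡ-< x lt) (ℚₚ.≤-reflexive (solve 2 (λ x y → (y :- x) :+ x := y) refl x y)))

    ≢0∧≥0⇒>0 : ∀ {x} → 0ℚ ≤ x → x ≢ 0ℚ → 0ℚ < x
    ≢0∧≥0⇒>0 le ne with ℚₚ.<-cmp 0ℚ _
    ... | tri< a _ _ = a
    ... | tri≈ _ e _ = ⊥-elim (ne (sym e))
    ... | tri> _ _ c = ⊥-elim (<⇒≱ c le)

    sum-≤ : ∀ {n} {f : Fin n → ℚ} → (∀ i → 0ℚ ≤ f i) → 0ℚ ≤ sum f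
    sum-≤ {zero}  le = ℚₚ.≤-reflexive (sym sum-[])
    sum-≤ {suc n} le = ℚₚ.≤-trans (+-≤ (le zero) (sum-≤ (le ∘ suc))) (ℚₚ.≤-reflexive (sym sum-∷))

    sum-< : ∀ {n} {f : Fin n → ℚ} → (∀ i → 0ℚ ≤ f i) → ∀ k → 0ℚ < f k → 0ℚ < sum f
    sum-< {suc n} le zero    lt = ℚₚ.<-≤-trans (+-<-≤ lt (sum-≤ (le ∘ suc))) (ℚₚ.≤-reflexive (sym sum-∷))
    sum-< {suc n} le (suc k) lt = ℚₚ.<-≤-trans (+-≤-< (le zero) (sum-< (le ∘ suc) k lt)) (ℚₚ.≤-reflexive (sym sum-∷))

    sum-≤-zero : ∀ {n} {f : Fin n → ℚ} → (∀ i → 0ℚ ≤ f i) → sum f ≤ 0ℚ → ∀ k → f k ≡ 0ℚ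
    sum-≤-zero {f = f} le s k with f k ℚₚ.≟ 0ℚ
    ... | yes e = e
    ... | no ne = ⊥-elim (<⇒≱ (sum-< le k (≢0∧≥0⇒>0 (le k) ne)) s)

  open Signs

  sum≡sumℚ : ∀ {n} (f : Fin n → ℚ) → sumℚ f ≡ sum f
  sum≡sumℚ {zero}  f = sym sum-[]
  sum≡sumℚ {suc n} f = trans (cong (f zero +_) (sum≡sumℚ (f ∘ suc))) (sym sum-∷)

  argmin : ∀ {n} {P : Fin n → Set} → (∀ i → Dec (P i)) → (f : Fin n → ℚ) → ∃ P → ∃ λ j → P j × (∀ i → P i → f j ≤ f i)
  argmin {suc n} {P} P? f (i , Pi) with Finₚ.any? (P? ∘ suc)
  ... | no none = zero , only i Pi , least
    where
    only : ∀ i → P i → P zero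
    only zero    p = p
    only (suc i) p = ⊥-elim (none (i , p))
    least : ∀ i → P i → f zero ≤ f i
    least zero    _ = ℚₚ.≤-refl
    least (suc i) p = ⊥-elim (none (i , p))
  ... | yes some with argmin (P? ∘ suc) (f ∘ suc) some
  ... | j , Pj , min with P? zero
  ... | no ¬P0 = suc j , Pj , λ { zero p → ⊥-elim (¬P0 p) ; (suc i) p → min i p }
  ... | yes P0 with f zero ℚₚ.≤? f (suc j)
  ... | yes le = zero , P0 , λ { zero p → ℚₚ.≤-refl ; (suc i) p → ℚₚ.≤-trans le (min i p) }
  ... | no ≰ = suc j , Pj , λ { zero p → ℚₚ.<⇒≤ (ℚₚ.≰⇒> ≰) ; (suc i) p → min i p }

  ⟨_,_⟩ : ∀ {D} → (Fin D → ℚ) → (Fin D → ℚ) → ℚ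
  ⟨ y , x ⟩ = sum (λ s → y s * x s)

  ⟨⟩-combination : ∀ {D} (a : ℚ) (y : Fin D → ℚ) (b : ℚ) (z : Fin D → ℚ) x →
    ⟨ (λ s → a * y s + b * z s) , x ⟩ ≡ a * ⟨ y , x ⟩ + b * ⟨ z , x ⟩
  ⟨⟩-combination a y b z x = trans (sum-cong (λ s → solve 5 (λ a y b z x → (a :* y :+ b :* z) :* x := a :* (y :* x) :+ b :* (z :* x)) refl a (y s) b (z s) (x s)))
    (trans (∑-distrib-+ _ _) (cong₂ _+_ (sym (*-distribˡ-sum a _)) (sym (*-distribˡ-sum b _))))

  ⟨⟩-scale : ∀ {D} (a : ℚ) (y : Fin D → ℚ) x → ⟨ (λ s → a * y s) , x ⟩ ≡ a * ⟨ y , x ⟩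
  ⟨⟩-scale a y x = trans (sum-cong (λ s → ℚₚ.*-assoc a (y s) (x s))) (sym (*-distribˡ-sum a _))

  ⟨⟩-sumˡ : ∀ {D m} (c : Fin m → ℚ) (y : Fin m → Fin D → ℚ) x → ⟨ (λ s → sum (λ i → c i * y i s)) , x ⟩ ≡ sum (λ i → c i * ⟨ y i , x ⟩)
  ⟨⟩-sumˡ c y x = trans (sum-cong (λ s → *-distribʳ-sum (x s) _)) (trans (∑-comm _) (sum-cong (λ i →
    trans (sum-cong (λ s → ℚₚ.*-assoc (c i) (y i s) (x s))) (sym (*-distribˡ-sum (c i) _)))))

  ⟨⟩-sumʳ : ∀ {D m} (y : Fin D → ℚ) (c : Fin m → ℚ) (u : Fin m → Fin D → ℚ) → ⟨ y , (λ s → sum (λ i → c i * u i s)) ⟩ ≡ sum (λ i → c i * ⟨ y , u i ⟩)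
  ⟨⟩-sumʳ y c u = trans (sum-cong (λ s → *-distribˡ-sum (y s) _)) (trans (∑-comm _) (sum-cong (λ i →
    trans (sum-cong (λ s → solve 3 (λ y c u → y :* (c :* u) := c :* (y :* u)) refl (y s) (c i) (u i s))) (sym (*-distribˡ-sum (c i) _)))))

  ∉⇒false : ∀ {n} {i : Fin n} {S} → i ∉ S → lookup S i ≡ false
  ∉⇒false {i = i} {S} i∉S = Boolₚ.¬-not (λ e → i∉S (Vecₚ.lookup⇒[]= i S e))

  false⇒∉ : ∀ {n} {i : Fin n} {S} → lookup S i ≡ false → i ∉ S
  false⇒∉ e m = true≢false (trans (sym (Vecₚ.[]=⇒lookup m)) e)

  Indep : ∀ {D N} → (Fin N → Fin D → ℚ) → Subset N → Set
  Indep u T = OnlyTrivial T (λ s i → u i s)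

  indep? : ∀ {D N} (u : Fin N → Fin D → ℚ) T → Dec (Indep u T)
  indep? u T with elimination _ T (λ s i → u i s)
  ... | inj₁ (x , sol , i , nz) = no (λ ind → nz (ind x sol i))
  ... | inj₂ (ind , _) = yes ind

  indep-size : ∀ {D N} {u : Fin N → Fin D → ℚ} {T} → Indep u T → Subset.∣ T ∣ ℕ.≤ D
  indep-size {u = u} {T} ind with elimination _ T (λ s i → u i s)
  ... | inj₁ (x , sol , i , nz) = ⊥-elim (nz (ind x sol i))
  ... | inj₂ (_ , le) = le

  indep-⊑ : ∀ {D N} {u : Fin N → Fin D → ℚ} {T T′} → T′ ⊑ T → Indep u T → Indep u T′
  indep-⊑ {T = T} {T′} sub ind x (supp , eqs) =
    ind x ((λ i i∉T → supp i (λ m → i∉T (Vecₚ.lookup⇒[]= i T (sub i (Vecₚ.[]=⇒lookup m))))) , eqs)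

  -- Applying `y` to a linear relation leaves only the term at `k`, so the coefficient of `k`
  -- vanishes and the relation lives on `T`.
  indep-add : ∀ {D N} {u : Fin N → Fin D → ℚ} {T} (y : Fin D → ℚ) {k} → Indep u T →
    (∀ i → lookup T i ≡ true → ⟨ y , u i ⟩ ≡ 0ℚ) → ⟨ y , u k ⟩ ≢ 0ℚ → lookup T k ≡ false × Indep u (toggle k T)
  indep-add {u = u} {T} y {k} ind y⊥T y≢0 = k∉T , added
    where
    k∉T : lookup T k ≡ false
    k∉T = Boolₚ.¬-not (y≢0 ∘ y⊥T k)
    added : Indep u (toggle k T)
    added x (supp , eqs) = ind x (supp′ , eqs)
      where
      term : ∀ i → i ≢ k → x i * ⟨ y , u i ⟩ ≡ 0ℚ
      term i i≢k with lookup T i in eq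
      ... | true = trans (cong (x i *_) (y⊥T i eq)) (ℚₚ.*-zeroʳ (x i))
      ... | false = trans (cong (_* ⟨ y , u i ⟩) (supp i (false⇒∉ (trans (lookup-toggle-≢ T i≢k) eq)))) (ℚₚ.*-zeroˡ ⟨ y , u i ⟩)
      total : sum (λ i → x i * ⟨ y , u i ⟩) ≡ 0ℚ
      total = trans (sym (⟨⟩-sumʳ y x u)) (sum-zero (λ s → trans (cong (y s *_) (eqs s)) (ℚₚ.*-zeroʳ (y s))))
      xk : x k ≡ 0ℚ
      xk = integral y≢0 (trans (ℚₚ.*-comm ⟨ y , u k ⟩ (x k)) (trans (sym (sum-single k term)) total))
      supp′ : ∀ i → i ∉ T → x i ≡ 0ℚ
      supp′ i i∉T with i Finₚ.≟ k
      ... | yes refl = xk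
      ... | no i≢k = supp i (false⇒∉ (trans (lookup-toggle-≢ T i≢k) (∉⇒false i∉T)))

  ∣toggle∣-absent : ∀ {n} (i : Fin n) C → lookup C i ≡ false → Subset.∣ toggle i C ∣ ≡ suc Subset.∣ C ∣
  ∣toggle∣-absent i C e = trans (∣toggle∣ i (toggle i C) (trans (lookup-toggle i C) (cong not e)))
    (cong (suc ∘ Subset.∣_∣) (toggle-involutive i C))

  -- Otherwise `indep-add` would produce D + 1 independent vectors in dimension D.
  vanish : ∀ {D N} {u : Fin N → Fin D → ℚ} {T} (y : Fin D → ℚ) → Indep u T → Subset.∣ T ∣ ≡ D →
    (∀ i → lookup T i ≡ true → ⟨ y , u i ⟩ ≡ 0ℚ) → ∀ k → ⟨ y , u k ⟩ ≡ 0ℚ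
  vanish {u = u} {T} y ind size y⊥T k with ⟨ y , u k ⟩ ℚₚ.≟ 0ℚ
  ... | yes e = e
  ... | no ne with indep-add y ind y⊥T ne
  ... | k∉T , ind′ = ⊥-elim (ℕₚ.<-irrefl refl (subst (ℕ._≤ _) (trans (∣toggle∣-absent k T k∉T) (cong suc size)) (indep-size ind′)))

  infixr 5 _▹_
  _▹_ : ∀ {D N} → (Fin D → ℚ) → (Fin N → Fin D → ℚ) → Fin (suc N) → Fin D → ℚ
  (x ▹ u) zero    = x
  (x ▹ u) (suc i) = u i

  indep-▹ : ∀ {D N} {u : Fin N → Fin D → ℚ} {T} x → Indep u T → Indep (x ▹ u) (false ∷ T)
  indep-▹ {u = u} {T} x ind c (supp , eqs) = λ { zero → c₀ ; (suc i) → ind (c ∘ suc) (supp′ , eqs′) i }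
    where
    c₀ : c zero ≡ 0ℚ
    c₀ = supp zero (λ ())
    supp′ : ∀ i → i ∉ T → c (suc i) ≡ 0ℚ
    supp′ i i∉ = supp (suc i) (λ { (Vec.there m) → i∉ m })
    eqs′ : ∀ s → sum (λ i → c (suc i) * u i s) ≡ 0ℚ
    eqs′ s = trans (sym (trans (cong (_+ sum (λ i → c (suc i) * u i s)) (trans (cong (_* x s) c₀) (ℚₚ.*-zeroˡ (x s)))) (ℚₚ.+-identityˡ (sum (λ i → c (suc i) * u i s))))) (trans (sym sum-∷) (eqs s))

  -- An arbitrary vector comes within reach of `vanish` once it is adjoined to the family under a
  -- new index.
  vanish-everywhere : ∀ {D N} {u : Fin N → Fin D → ℚ} {T} (y : Fin D → ℚ) → Indep u T → Subset.∣ T ∣ ≡ D →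
    (∀ i → lookup T i ≡ true → ⟨ y , u i ⟩ ≡ 0ℚ) → ∀ x → ⟨ y , x ⟩ ≡ 0ℚ
  vanish-everywhere y ind size y⊥T x = vanish {u = x ▹ _} y (indep-▹ x ind) size (λ { (suc i) e → y⊥T i e }) zero

  functional-exists : ∀ {D} (L : List (Fin D → ℚ)) → length L ℕ.< D →
    Σ (Fin D → ℚ) λ y → (∃ λ s → y s ≢ 0ℚ) × (∀ {x} → x ∈ₗ L → ⟨ y , x ⟩ ≡ 0ℚ)
  functional-exists {D} L lt with nontrivial-solution (length L) (⊤ {D}) (subst (length L ℕ.<_) (sym (Subsetₚ.∣⊤∣≡n D)) lt) (λ m s → List.lookup L m s)
  ... | y , (_ , eqs) , nz = y , nz , λ {x} m → trans (cong (λ x → ⟨ y , x ⟩) (Anyₚ.lookup-index m)) (eqs (Any.index m))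

  coordinate : ∀ {D} (y : Fin D → ℚ) s → ⟨ y , δ s ⟩ ≡ y s
  coordinate y s = trans (sum-cong (λ t → ℚₚ.*-comm (y t) (δ s t))) (sum-δ s y)

open RationalLinearAlgebra

-- Facets of a simplicial polytope: existence, pivoting, the two facets at a ridge

module PolytopeFacets where
  open import Defs
  open import Data.Fin.Subset as Subset using (Subset; _∈_; ⊥; _⊆_)
  open import Data.Nat as ℕ using (ℕ; zero; suc; s≤s)
  open import Data.Rational using (ℚ; 0ℚ; 1ℚ; _+_; _*_; -_; _≤_; _<_; _-_)
  open import Data.Rational.Solver using (module +-*-Solver)
  open import Relation.Binary.PropositionalEquality as ≡ using (_≡_; _≢_; refl; sym; trans; cong; cong₂; subst)

  open Sums ℚ-ring
  open IsField ℚ-isField using (_⁻¹; inverse)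
  open Signs
  open +-*-Solver using (solve; _:=_; _:+_; _:*_; :-_; con; _:-_)

  ⊆⇒⊑ : ∀ {n} {A B : Subset n} → A ⊆ B → A ⊑ B
  ⊆⇒⊑ {A = A} s i e = Vecₚ.[]=⇒lookup (s (Vecₚ.lookup⇒[]= i A e))

  ⊑⇒⊆ : ∀ {n} {A B : Subset n} → A ⊑ B → A ⊆ B
  ⊑⇒⊆ {B = B} s {i} m = Vecₚ.lookup⇒[]= i B (s i (Vecₚ.[]=⇒lookup m))

  module Polytope (d′ n : ℕ) (v : Config (suc d′) n)
    (full : Σ (Subset n) λ T → Subset.∣ T ∣ ≡ suc (suc d′) × AffIndep v T)
    (simplicial : Simplicial v) (d<n : suc d′ ℕ.< n) where

    D : ℕ
    D = suc (suc d′)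

    -- Homogeneous coordinates: affine functions on ℚ^d are the linear functionals of ℚ^D.
    hv : Fin n → Fin D → ℚ
    hv i zero    = 1ℚ
    hv i (suc t) = v i t

    infix 9 _∙_
    _∙_ : (Fin D → ℚ) → Fin n → ℚ
    y ∙ i = ⟨ y , hv i ⟩

    affIndep⇒indep : ∀ {T} → AffIndep v T → Indep hv T
    affIndep⇒indep ind x (supp , eqs) = ind x supp
      (trans (sum≡sumℚ x) (trans (sum-cong (λ i → sym (ℚₚ.*-identityʳ (x i)))) (eqs zero)))
      (λ t → trans (sum≡sumℚ _) (eqs (suc t)))

    indep⇒affIndep : ∀ {T} → Indep hv T → AffIndep v T
    indep⇒affIndep ind x supp total coords = ind x (supp , λ
      { zero → trans (sum-cong (λ i → ℚₚ.*-identityʳ (x i))) (trans (sym (sum≡sumℚ x)) total)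
      ; (suc t) → trans (sym (sum≡sumℚ _)) (coords t) })

    ∙-split : ∀ y i → y ∙ i ≡ y zero + sum (λ t → y (suc t) * v i t)
    ∙-split y i = trans sum-∷ (cong (_+ sum (λ t → y (suc t) * v i t)) (ℚₚ.*-identityʳ (y zero)))

    sum-neg : ∀ {m} (f : Fin m → ℚ) → sum (λ t → - f t) ≡ - sum f
    sum-neg f = trans (sum-cong (λ t → solve 1 (λ x → :- x := con (- 1ℚ) :* x) refl (f t)))
      (trans (sym (*-distribˡ-sum (- 1ℚ) f)) (sym (solve 1 (λ x → :- x := con (- 1ℚ) :* x) refl (sum f))))

    -- A valid inequality c·x ≤ b in the homogeneous form b - c·x ≥ 0, with `S` as its set of
    -- equality.
    record Supports (y : Fin D → ℚ) (S : Subset n) : Set where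
      field
        nonneg  : ∀ i → 0ℚ ≤ y ∙ i
        zero-on : ∀ i → lookup S i ≡ true → y ∙ i ≡ 0ℚ
        pos-off : ∀ i → lookup S i ≡ false → 0ℚ < y ∙ i
    open Supports

    supports⇒face : ∀ {y S} → Supports y S → IsFace v S
    supports⇒face {y} {S} sup = c , y zero , bounded , λ i → mk⇔ (member i) (equality i)
      where
      c : Fin (suc d′) → ℚ
      c t = - y (suc t)
      value : ∀ i → c · v i ≡ y zero - y ∙ i
      value i = begin
        sumℚ (λ t → c t * v i t) ≡⟨ sum≡sumℚ _ ⟩
        sum (λ t → c t * v i t) ≡⟨ sum-cong (λ t → sym (ℚₚ.neg-distribˡ-* (y (suc t)) (v i t))) ⟩
        sum (λ t → - (y (suc t) * v i t)) ≡⟨ sum-neg _ ⟩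
        - s ≡⟨ solve 2 (λ y s → :- s := y :- (y :+ s)) refl (y zero) s ⟩
        y zero - (y zero + s) ≡⟨ cong (λ z → y zero - z) (sym (∙-split y i)) ⟩
        y zero - y ∙ i ∎
        where
        open ≡.≡-Reasoning
        s = sum (λ t → y (suc t) * v i t)
      bounded : ∀ i → c · v i ≤ y zero
      bounded i = ≤-from-zero (subst (0ℚ ≤_) (trans (solve 2 (λ y z → z := y :- (y :- z)) refl (y zero) (y ∙ i)) (cong (λ z → y zero - z) (sym (value i)))) (nonneg sup i))
      member : ∀ i → c · v i ≡ y zero → i ∈ S
      member i e with lookup S i in eq
      ... | true = Vecₚ.lookup⇒[]= i S eq
      ... | false = ⊥-elim (<⇒≢ (pos-off sup i eq) (trans (solve 2 (λ y z → z := y :- (y :- z)) refl (y zero) (y ∙ i))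
          (trans (cong (λ z → y zero - z) (trans (sym (value i)) e)) (ℚₚ.+-inverseʳ (y zero)))))
      equality : ∀ i → i ∈ S → c · v i ≡ y zero
      equality i m = trans (value i) (trans (cong (λ z → y zero - z) (zero-on sup i (Vecₚ.[]=⇒lookup m))) (ℚₚ.+-identityʳ (y zero)))

    face⇒supports : ∀ {S} → IsFace v S → ∃ λ y → Supports y S
    face⇒supports {S} (c , b , bounded , equality) = y , record
      { nonneg = λ i → subst (0ℚ ≤_) (sym (value i)) (zero-from-≤ (bounded i))
      ; zero-on = λ i e → trans (value i) (trans (cong (λ z → b - z) (Equivalence.from (equality i) (Vecₚ.lookup⇒[]= i S e))) (ℚₚ.+-inverseʳ b))
      ; pos-off = λ i e → subst (0ℚ <_) (sym (value i)) (≢0∧≥0⇒>0 (zero-from-≤ (bounded i))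
          (λ z → false⇒∉ e (Equivalence.to (equality i) (trans (solve 2 (λ b w → w := b :- (b :- w)) refl b (c · v i))
             (trans (cong (λ z → b - z) z) (ℚₚ.+-identityʳ b)))))) }
      where
      y : Fin D → ℚ
      y zero    = b
      y (suc t) = - c t
      value : ∀ i → y ∙ i ≡ b - (c · v i)
      value i = trans (∙-split y i) (cong (b +_) (trans (sum-cong (λ t → sym (ℚₚ.neg-distribˡ-* (c t) (v i t))))
        (trans (sum-neg _) (cong -_ (sym (sum≡sumℚ _))))))

    -- The sum of the homogenised vertices, n times the barycentre. A nonnegative functional that is
    -- nonzero at some vertex is positive here, so facet functionals can be normalised to value 1.
    o : Fin D → ℚ
    o s = sum (λ i → 1ℚ * hv i s)

    at-o : ∀ y → ⟨ y , o ⟩ ≡ sum (λ i → y ∙ i)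
    at-o y = trans (⟨⟩-sumʳ y (λ _ → 1ℚ) hv) (sum-cong (λ i → ℚₚ.*-identityˡ (y ∙ i)))

    o-positive : ∀ y → (∀ i → 0ℚ ≤ y ∙ i) → ∀ {k} → y ∙ k ≢ 0ℚ → 0ℚ < ⟨ y , o ⟩
    o-positive y nn {k} nz = subst (0ℚ <_) (sym (at-o y)) (sum-< nn k (≢0∧≥0⇒>0 (nn k) nz))

    spanning : ∀ (g : Fin D → ℚ) {s} → g s ≢ 0ℚ → ∃ λ i → g ∙ i ≢ 0ℚ
    spanning g {s} nz with Finₚ.any? (λ i → ¬? (g ∙ i ℚₚ.≟ 0ℚ))
    ... | yes found = found
    ... | no none = ⊥-elim (nz (trans (sym (coordinate g s)) (vanish-everywhere g (affIndep⇒indep (proj₂ (proj₂ full)))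
        (proj₁ (proj₂ full)) (λ i _ → allZero i) (δ s))))
      where
      allZero : ∀ i → g ∙ i ≡ 0ℚ
      allZero i with g ∙ i ℚₚ.≟ 0ℚ
      ... | yes e = e
      ... | no ne = ⊥-elim (none (i , ne))

    negative-value : ∀ g → ⟨ g , o ⟩ ≡ 0ℚ → ∀ {k} → g ∙ k ≢ 0ℚ → ∃ λ j → g ∙ j < 0ℚ
    negative-value g e {k} nz with Finₚ.any? (λ j → g ∙ j ℚₚ.<? 0ℚ)
    ... | yes found = found
    ... | no none = ⊥-elim (nz (sum-≤-zero (λ i → ℚₚ.≮⇒≥ (λ lt → none (i , lt))) (ℚₚ.≤-reflexive (trans (sym (at-o g)) e)) k))

    -- The member of the pencil of `y` and `g` that vanishes at vertex `j`, scaled to have a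
    -- positive multiple of `y` when `g ∙ j` is negative.
    tilt : (y g : Fin D → ℚ) → Fin n → Fin D → ℚ
    tilt y g j s = (- (g ∙ j)) * y s + (y ∙ j) * g s

    tilt-∙ : ∀ y g j x → ⟨ tilt y g j , x ⟩ ≡ (- (g ∙ j)) * ⟨ y , x ⟩ + (y ∙ j) * ⟨ g , x ⟩
    tilt-∙ y g j x = ⟨⟩-combination (- (g ∙ j)) y (y ∙ j) g x

    tilt-zero : ∀ y g j → tilt y g j ∙ j ≡ 0ℚ
    tilt-zero y g j = trans (tilt-∙ y g j (hv j)) (solve 2 (λ g y → :- g :* y :+ y :* g := con 0ℚ) refl (g ∙ j) (y ∙ j))

    tilt-at-zero : ∀ y g j x → ⟨ g , x ⟩ ≡ 0ℚ → ⟨ tilt y g j , x ⟩ ≡ (- (g ∙ j)) * ⟨ y , x ⟩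
    tilt-at-zero y g j x e = trans (tilt-∙ y g j x) (trans (cong (λ z → (- (g ∙ j)) * ⟨ y , x ⟩ + y ∙ j * z) e)
      (solve 2 (λ a b → a :+ b :* con 0ℚ := a) refl ((- (g ∙ j)) * ⟨ y , x ⟩) (y ∙ j)))

    -- The ratio test of the simplex method: among the vertices where `g` is negative, the one with
    -- least y/(-g) is the first at which y + λg reaches zero as λ grows.
    rotate : ∀ y → (∀ i → 0ℚ ≤ y ∙ i) → ∀ g → (∃ λ j → g ∙ j < 0ℚ) → ∃ λ j → g ∙ j < 0ℚ × (∀ i → 0ℚ ≤ tilt y g j ∙ i)
    rotate y nn g neg with argmin (λ i → g ∙ i ℚₚ.<? 0ℚ) (λ i → y ∙ i * (- (g ∙ i)) ⁻¹) neg
    ... | j , gj<0 , least = j , gj<0 , λ i → subst (0ℚ ≤_) (sym (tilt-∙ y g j (hv i))) (value i)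
      where
      value : ∀ i → 0ℚ ≤ (- (g ∙ j)) * (y ∙ i) + (y ∙ j) * (g ∙ i)
      value i with g ∙ i ℚₚ.<? 0ℚ
      ... | no ≮ = +-≤ (*-≤ (ℚₚ.<⇒≤ (neg-< gj<0)) (nn i)) (*-≤ (nn j) (ℚₚ.≮⇒≥ ≮))
      ... | yes lt = subst (0ℚ ≤_) eq (*-≤ (zero-from-≤ (least i lt)) (ℚₚ.<⇒≤ (*-< (neg-< gj<0) (neg-< lt))))
        where
        A = - (g ∙ j)
        B = - (g ∙ i)
        eq : (y ∙ i * B ⁻¹ - y ∙ j * A ⁻¹) * (A * B) ≡ A * (y ∙ i) + (y ∙ j) * (g ∙ i)
        eq = begin
          (y ∙ i * B ⁻¹ - y ∙ j * A ⁻¹) * (A * B)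
            ≡⟨ solve 6 (λ yi yj a b a′ b′ → (yi :* b′ :- yj :* a′) :* (a :* b) := yi :* a :* (b :* b′) :- yj :* b :* (a :* a′)) refl (y ∙ i) (y ∙ j) A B (A ⁻¹) (B ⁻¹) ⟩
          y ∙ i * A * (B * B ⁻¹) - y ∙ j * B * (A * A ⁻¹)
            ≡⟨ cong₂ (λ p q → y ∙ i * A * p - y ∙ j * B * q) (inverse (<⇒≢ (neg-< lt))) (inverse (<⇒≢ (neg-< gj<0))) ⟩
          y ∙ i * A * 1ℚ - y ∙ j * B * 1ℚ
            ≡⟨ solve 4 (λ yi yj gi gj → yi :* (:- gj) :* con 1ℚ :- yj :* (:- gi) :* con 1ℚ := (:- gj) :* yi :+ yj :* gi) refl (y ∙ i) (y ∙ j) (g ∙ i) (g ∙ j) ⟩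
          A * (y ∙ i) + (y ∙ j) * (g ∙ i) ∎
          where open ≡.≡-Reasoning

    record Facet (σ : Subset n) : Set where
      field
        y        : Fin D → ℚ
        supports : Supports y σ
        height   : ⟨ y , o ⟩ ≡ 1ℚ
        size     : Subset.∣ σ ∣ ≡ suc d′
        indep    : Indep hv σ
    open Facet

    indep-small : ∀ {T} y {k} → Indep hv T → (∀ i → lookup T i ≡ true → y ∙ i ≡ 0ℚ) → y ∙ k ≢ 0ℚ → Subset.∣ T ∣ ℕ.≤ suc d′
    indep-small {T} y {k} ind zeros nz with indep-add y ind zeros nz
    ... | k∉T , ind′ = ℕₚ.≤-pred (subst (ℕ._≤ D) (∣toggle∣-absent k T k∉T) (indep-size ind′))

    -- Simpliciality enters here. The zero set of `y` contains `T` and is a face of dimension d - 1,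
    -- hence affinely independent; an independent set on which a nonzero functional vanishes has at
    -- most d elements, so the zero set is `T` itself.
    make-facet : ∀ {T} y → (∀ i → 0ℚ ≤ y ∙ i) → ∀ {k} → y ∙ k ≢ 0ℚ → Indep hv T → Subset.∣ T ∣ ≡ suc d′ →
      (∀ i → lookup T i ≡ true → y ∙ i ≡ 0ℚ) → Facet T
    make-facet {T} y nn {k} nz ind size zeros = subst Facet (sym T≡Z) (record
      { y = y′
      ; supports = record
        { nonneg = λ i → subst (0ℚ ≤_) (sym (⟨⟩-scale r y (hv i))) (*-≤ (ℚₚ.<⇒≤ r>0) (nn i))
        ; zero-on = λ i e → trans (⟨⟩-scale r y (hv i)) (trans (cong (r *_) (zero-on Z-supports i e)) (ℚₚ.*-zeroʳ r))
        ; pos-off = λ i e → subst (0ℚ <_) (sym (⟨⟩-scale r y (hv i))) (*-< r>0 (pos-off Z-supports i e)) }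
      ; height = trans (⟨⟩-scale r y o) (trans (ℚₚ.*-comm r ⟨ y , o ⟩) (inverse (<⇒≢ o>0)))
      ; size = trans (cong Subset.∣_∣ (sym T≡Z)) size
      ; indep = Z-indep })
      where
      o>0 = o-positive y nn nz
      r = ⟨ y , o ⟩ ⁻¹
      r>0 = ⁻¹-< o>0
      y′ : Fin D → ℚ
      y′ s = r * y s
      Z : Subset n
      Z = Vec.tabulate (λ i → does (y ∙ i ℚₚ.≟ 0ℚ))
      Z-zero : ∀ i → lookup Z i ≡ true → y ∙ i ≡ 0ℚ
      Z-zero i e = does⁻ (y ∙ i ℚₚ.≟ 0ℚ) (trans (sym (Vecₚ.lookup∘tabulate _ i)) e)
      zero-Z : ∀ i → y ∙ i ≡ 0ℚ → lookup Z i ≡ true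
      zero-Z i e = trans (Vecₚ.lookup∘tabulate _ i) (dec-true (y ∙ i ℚₚ.≟ 0ℚ) e)
      Z-supports : Supports y Z
      Z-supports = record { nonneg = nn ; zero-on = Z-zero
        ; pos-off = λ i e → ≢0∧≥0⇒>0 (nn i) (λ z → true≢false (trans (sym (zero-Z i z)) e)) }
      T⊑Z : T ⊑ Z
      T⊑Z i i∈T = zero-Z i (zeros i i∈T)
      Z-indep : Indep hv Z
      Z-indep = affIndep⇒indep (simplicial Z (supports⇒face Z-supports
        , (T , ⊑⇒⊆ T⊑Z , size , indep⇒affIndep ind)
        , λ T′ T′⊆Z ind′ → indep-small y (affIndep⇒indep ind′) (λ i i∈ → Z-zero i (⊆⇒⊑ T′⊆Z i i∈)) nz))
      T≡Z : T ≡ Z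
      T≡Z = ⊑-equal T Z T⊑Z (ℕₚ.≤-antisym (⊑⇒∣∣≤ T Z T⊑Z)
        (subst (Subset.∣ Z ∣ ℕ.≤_) (sym size) (indep-small y Z-indep Z-zero nz)))

    nonzero-somewhere : ∀ y → ⟨ y , o ⟩ ≢ 0ℚ → ∃ λ k → y ∙ k ≢ 0ℚ
    nonzero-somewhere y nz with Finₚ.any? (λ i → ¬? (y ∙ i ℚₚ.≟ 0ℚ))
    ... | yes found = found
    ... | no none = ⊥-elim (nz (trans (at-o y) (sum-zero allZero)))
      where
      allZero : ∀ i → y ∙ i ≡ 0ℚ
      allZero i with y ∙ i ℚₚ.≟ 0ℚ
      ... | yes e = e
      ... | no ne = ⊥-elim (none (i , ne))

    annihilator : ∀ T → Subset.∣ T ∣ ℕ.≤ d′ → ∃ λ g → (∃ λ s → g s ≢ 0ℚ) × ⟨ g , o ⟩ ≡ 0ℚ × (∀ i → lookup T i ≡ true → g ∙ i ≡ 0ℚ)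
    annihilator T le with functional-exists (o ∷ map hv (elems T))
        (s≤s (s≤s (subst (ℕ._≤ d′) (sym (trans (Listₚ.length-map hv (elems T)) (length-elems T))) le)))
    ... | g , nz , zeros = g , nz , zeros {o} (here refl) , λ i i∈T → zeros {hv i} (there (Membershipₚ.∈-map⁺ hv (∈-elems i T i∈T)))

    record Flag (r : ℕ) : Set where
      field
        f     : Fin D → ℚ
        nn    : ∀ i → 0ℚ ≤ f ∙ i
        k     : Fin n
        nz    : f ∙ k ≢ 0ℚ
        T     : Subset n
        T-ind : Indep hv T
        T-size : Subset.∣ T ∣ ≡ r
        zeros : ∀ i → lookup T i ≡ true → f ∙ i ≡ 0ℚ

    -- Choose `g` vanishing on `T` and at `o`; it takes a negative value at some vertex, so the
    -- supporting hyperplane can be rotated about `T` until it meets a new vertex. As `g` vanishes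
    -- at `o`, the rotated functional stays positive there and does not degenerate.
    extend-flag : ∀ {r} → r ℕ.≤ d′ → Flag r → Flag (suc r)
    extend-flag {r} le F = extended (annihilator T (subst (ℕ._≤ d′) (sym T-size) le))
      where
      open Flag F
      extended : (∃ λ g → (∃ λ s → g s ≢ 0ℚ) × ⟨ g , o ⟩ ≡ 0ℚ × (∀ i → lookup T i ≡ true → g ∙ i ≡ 0ℚ)) → Flag (suc r)
      extended (g , (s , gs) , go , gT) = turn (rotate f nn g (negative-value g go (proj₂ (spanning g gs))))
        where
        turn : (∃ λ j → g ∙ j < 0ℚ × (∀ i → 0ℚ ≤ tilt f g j ∙ i)) → Flag (suc r)
        turn (j , gj<0 , nn′) = record
          { f = tilt f g j ; nn = nn′ ; k = proj₁ somewhere ; nz = proj₂ somewhere ; T = toggle j T ; T-ind = proj₂ added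
          ; T-size = trans (∣toggle∣-absent j T (proj₁ added)) (cong suc T-size) ; zeros = zeros′ }
          where
          added : lookup T j ≡ false × Indep hv (toggle j T)
          added = indep-add g {j} T-ind gT (λ e → ℚₚ.<-irrefl e gj<0)
          o>0 : 0ℚ < ⟨ tilt f g j , o ⟩
          o>0 = subst (0ℚ <_) (sym (tilt-at-zero f g j o go)) (*-< (neg-< gj<0) (o-positive f nn nz))
          somewhere : ∃ λ k → tilt f g j ∙ k ≢ 0ℚ
          somewhere = nonzero-somewhere (tilt f g j) (<⇒≢ o>0)
          zeros′ : ∀ i → lookup (toggle j T) i ≡ true → tilt f g j ∙ i ≡ 0ℚ
          zeros′ i i∈ with i Finₚ.≟ j
          ... | yes refl = tilt-zero f g j
          ... | no i≢j = trans (tilt-at-zero f g j (hv i) (gT i i∈T)) (trans (cong (λ z → (- (g ∙ j)) * z) (zeros i i∈T)) (ℚₚ.*-zeroʳ (- (g ∙ j))))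
            where
            i∈T : lookup T i ≡ true
            i∈T = trans (sym (lookup-toggle-≢ T i≢j)) i∈

    flag : ∀ r → r ℕ.≤ suc d′ → Flag r
    flag zero _ = record
      { f = δ zero ; nn = λ i → subst (0ℚ ≤_) (sym (one i)) (ℚₚ.<⇒≤ (ℚₚ.positive⁻¹ 1ℚ)) ; k = k ; nz = λ e → 1≢0 (trans (sym (one k)) e)
      ; T = ⊥ ; T-ind = λ x sol i → proj₁ sol i Subsetₚ.∉⊥ ; T-size = Subsetₚ.∣⊥∣≡0 n
      ; zeros = λ i e → ⊥-elim (true≢false (trans (sym e) (Vecₚ.lookup-replicate i false))) }
      where
      k = Fin.fromℕ< d<n
      one : ∀ i → δ zero ∙ i ≡ 1ℚ
      one i = sum-δ zero (hv i)
    flag (suc r) (s≤s le) = extend-flag le (flag r (ℕₚ.m≤n⇒m≤1+n le))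

    facet-exists : ∃ Facet
    facet-exists = T , make-facet f nn nz T-ind T-size zeros
      where open Flag (flag (suc d′) ℕₚ.≤-refl)

    facet-basis : ∀ {σ} → Facet σ → Indep (o ▹ hv) (true ∷ σ)
    facet-basis {σ} F = proj₂ (indep-add {u = o ▹ hv} {T = false ∷ σ} (y F) {zero} (indep-▹ o (indep F))
      (λ { (suc i) i∈σ → zero-on (supports F) i i∈σ }) (λ e → 1≢0 (trans (sym (height F)) e)))

    vanish-on-facet : ∀ {σ} → Facet σ → ∀ f → ⟨ f , o ⟩ ≡ 0ℚ → (∀ i → lookup σ i ≡ true → f ∙ i ≡ 0ℚ) → ∀ x → ⟨ f , x ⟩ ≡ 0ℚ
    vanish-on-facet F f fo fσ = vanish-everywhere {u = o ▹ hv} f (facet-basis F) (cong suc (size F))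
      (λ { zero _ → fo ; (suc i) i∈σ → fσ i i∈σ })

    toggle-inside : ∀ {σ : Subset n} {i k} → lookup (toggle i σ) k ≡ true → k ≢ i → lookup σ k ≡ true
    toggle-inside {σ} e ne = trans (sym (lookup-toggle-≢ σ ne)) e

    -- The member at `i` of the basis dual to `o` and the vertices of σ.
    record Dual (σ : Subset n) (i : Fin n) : Set where
      field
        γ     : Fin D → ℚ
        γ-i   : γ ∙ i ≡ 1ℚ
        γ-o   : ⟨ γ , o ⟩ ≡ 0ℚ
        γ-off : ∀ k → lookup (toggle i σ) k ≡ true → γ ∙ k ≡ 0ℚ

    dual : ∀ {σ} → Facet σ → ∀ i → lookup σ i ≡ true → Dual σ i
    dual {σ} F i i∈σ = scaled (annihilator (toggle i σ) (ℕₚ.≤-reflexive (ℕₚ.suc-injective (trans (sym (∣toggle∣ i σ i∈σ)) (size F)))))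
      where
      scaled : (∃ λ g → (∃ λ s → g s ≢ 0ℚ) × ⟨ g , o ⟩ ≡ 0ℚ × (∀ k → lookup (toggle i σ) k ≡ true → g ∙ k ≡ 0ℚ)) → Dual σ i
      scaled (g , (s , gs) , go , gT) = record
        { γ = λ t → r * g t
        ; γ-i = trans (⟨⟩-scale r g (hv i)) (trans (ℚₚ.*-comm r (g ∙ i)) (inverse nz))
        ; γ-o = trans (⟨⟩-scale r g o) (trans (cong (r *_) go) (ℚₚ.*-zeroʳ r))
        ; γ-off = λ k e → trans (⟨⟩-scale r g (hv k)) (trans (cong (r *_) (gT k e)) (ℚₚ.*-zeroʳ r)) }
        where
        r = (g ∙ i) ⁻¹
        nz : g ∙ i ≢ 0ℚ
        nz e = gs (trans (sym (coordinate g s)) (vanish-on-facet F g go everywhere (δ s)))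
          where
          everywhere : ∀ k → lookup σ k ≡ true → g ∙ k ≡ 0ℚ
          everywhere k k∈σ with k Finₚ.≟ i
          ... | yes refl = e
          ... | no k≢i = gT k (trans (lookup-toggle-≢ σ k≢i) k∈σ)

    record Pivot (σ : Subset n) (i : Fin n) : Set where
      field
        j     : Fin n
        j∉σ   : lookup σ j ≡ false
        facet : Facet (toggle j (toggle i σ))

    -- The hyperplane of the facet is rotated about the ridge opposite `i`, in the direction of the
    -- dual functional at `i`, until it meets another vertex `j`; it has then left `i`.
    pivot : ∀ {σ} → Facet σ → ∀ i → lookup σ i ≡ true → Pivot σ i
    pivot {σ} F i i∈σ = turn (rotate (y F) (nonneg (supports F)) γ (negative-value γ γ-o γi≢0))
      where
      open Dual (dual F i i∈σ)
      T = toggle i σ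
      γi≢0 : γ ∙ i ≢ 0ℚ
      γi≢0 e = 1≢0 (trans (sym γ-i) e)
      turn : (∃ λ j → γ ∙ j < 0ℚ × (∀ k → 0ℚ ≤ tilt (y F) γ j ∙ k)) → Pivot σ i
      turn (j , γj<0 , nn′) = record { j = j ; j∉σ = j∉σ ; facet = make-facet y′ nn′ {i} (<⇒≢ y′i>0) (proj₂ added) size′ zeros }
        where
        y′ = tilt (y F) γ j
        added : lookup T j ≡ false × Indep hv (toggle j T)
        added = indep-add γ {j} (indep-⊑ (toggle-⊑ {C = σ} i∈σ) (indep F)) γ-off (λ e → ℚₚ.<-irrefl e γj<0)
        j≢i : j ≢ i
        j≢i refl = ℚₚ.<-asym γj<0 (subst (0ℚ <_) (sym γ-i) (ℚₚ.positive⁻¹ 1ℚ))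
        j∉σ : lookup σ j ≡ false
        j∉σ = trans (sym (lookup-toggle-≢ σ j≢i)) (proj₁ added)
        size′ : Subset.∣ toggle j T ∣ ≡ suc d′
        size′ = trans (∣toggle∣-absent j T (proj₁ added)) (trans (sym (∣toggle∣ i σ i∈σ)) (size F))
        y′i>0 : 0ℚ < y′ ∙ i
        y′i>0 = subst (0ℚ <_) (sym (trans (tilt-∙ (y F) γ j (hv i)) (trans (cong₂ (λ p q → (- (γ ∙ j)) * p + y F ∙ j * q) (zero-on (supports F) i i∈σ) γ-i)
          (solve 2 (λ a b → a :* con 0ℚ :+ b :* con 1ℚ := b) refl (- (γ ∙ j)) (y F ∙ j))))) (pos-off (supports F) j j∉σ)
        zeros : ∀ k → lookup (toggle j T) k ≡ true → y′ ∙ k ≡ 0ℚ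
        zeros k k∈ with k Finₚ.≟ j
        ... | yes refl = tilt-zero (y F) γ j
        ... | no k≢j = trans (tilt-at-zero (y F) γ j (hv k) (γ-off k k∈T))
            (trans (cong (λ z → (- (γ ∙ j)) * z) (zero-on (supports F) k (toggle-⊑ {C = σ} i∈σ k k∈T))) (ℚₚ.*-zeroʳ (- (γ ∙ j))))
          where
          k∈T : lookup T k ≡ true
          k∈T = toggle-inside {T} k∈ k≢j

    -- Suppose the ridge and a third vertex k formed a facet. The three facet functionals vanish on
    -- the ridge and so are dependent: b·yσ + c·yτ = a·yρ with b > 0 and c ≥ 0. At k the right side
    -- is zero and the left side positive.
    two-facets : ∀ {σ i j ρ} → Facet σ → lookup σ i ≡ true → lookup σ j ≡ false →
      Facet (toggle j (toggle i σ)) → Facet ρ → toggle i σ ⊑ ρ → ρ ≡ σ ⊎ ρ ≡ toggle j (toggle i σ)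
    two-facets {σ} {i} {j} {ρ} F i∈σ j∉σ H G T⊑ρ = found (⊑-witness T ρ (ℕₚ.≤-reflexive sizes))
      where
      T τ : Subset n
      T = toggle i σ
      τ = toggle j T
      sizes : suc Subset.∣ T ∣ ≡ Subset.∣ ρ ∣
      sizes = trans (sym (∣toggle∣ i σ i∈σ)) (trans (size F) (sym (size G)))
      i≢j : i ≢ j
      i≢j refl = true≢false (trans (sym i∈σ) j∉σ)
      i∉T : lookup T i ≡ false
      i∉T = trans (lookup-toggle i σ) (cong not i∈σ)
      j∉T : lookup T j ≡ false
      j∉T = trans (lookup-toggle-≢ σ (i≢j ∘ sym)) j∉σ
      found : (∃ λ k → lookup ρ k ≡ true × lookup T k ≡ false) → ρ ≡ σ ⊎ ρ ≡ τ
      found (k , k∈ρ , k∉T) = decide (k Finₚ.≟ i) (k Finₚ.≟ j)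
        where
        ρ≡ : ρ ≡ toggle k T
        ρ≡ = trans (sym (toggle-involutive k ρ)) (cong (toggle k) (sym (⊑-equal T (toggle k ρ) (⊑-toggle {A = T} {ρ} {k} k∉T T⊑ρ)
          (ℕₚ.suc-injective (trans sizes (∣toggle∣ k ρ k∈ρ))))))
        decide : Dec (k ≡ i) → Dec (k ≡ j) → ρ ≡ σ ⊎ ρ ≡ τ
        decide (yes refl) _ = inj₁ (trans ρ≡ (toggle-involutive k σ))
        decide (no _) (yes refl) = inj₂ ρ≡
        decide (no k≢i) (no k≢j) = ⊥-elim (<⇒≢ positive fk≡0)
          where
          yσ = y F
          yτ = y H
          yρ = y G
          j∉ρ : lookup ρ j ≡ false
          j∉ρ = trans (cong (λ S → lookup S j) ρ≡) (trans (lookup-toggle-≢ T (k≢j ∘ sym)) j∉T)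
          i∉τ : lookup τ i ≡ false
          i∉τ = trans (lookup-toggle-≢ T i≢j) i∉T
          k∉σ : lookup σ k ≡ false
          k∉σ = trans (sym (lookup-toggle-≢ σ k≢i)) k∉T
          a = yσ ∙ j * yτ ∙ i
          b = yρ ∙ j * yτ ∙ i
          c = yρ ∙ i * yσ ∙ j
          -- The combination of the three functionals vanishing at i, j and on the ridge.
          f : Fin D → ℚ
          f s = 1ℚ * (b * yσ s + c * yτ s) + (- a) * yρ s
          f-∙ : ∀ x → f ∙ x ≡ (b * yσ ∙ x + c * yτ ∙ x) - a * yρ ∙ x
          f-∙ x = trans (⟨⟩-combination 1ℚ (λ s → b * yσ s + c * yτ s) (- a) yρ (hv x))
            (trans (cong (λ z → 1ℚ * z + (- a) * yρ ∙ x) (⟨⟩-combination b yσ c yτ (hv x)))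
              (solve 3 (λ z a r → con 1ℚ :* z :+ (:- a) :* r := z :- a :* r) refl (b * yσ ∙ x + c * yτ ∙ x) a (yρ ∙ x)))
          on-ridge : ∀ x → lookup T x ≡ true → f ∙ x ≡ 0ℚ
          on-ridge x x∈T = trans (f-∙ x) (trans (cong₂ _-_ (cong₂ (λ p q → b * p + c * q) (zero-on (supports F) x (toggle-⊑ {C = σ} i∈σ x x∈T))
              (zero-on (supports H) x (trans (lookup-toggle-≢ T (λ { refl → true≢false (trans (sym x∈T) j∉T) })) x∈T)))
              (cong (a *_) (zero-on (supports G) x (T⊑ρ x x∈T))))
            (solve 3 (λ a b c → (b :* con 0ℚ :+ c :* con 0ℚ) :- a :* con 0ℚ := con 0ℚ) refl a b c))
          at-i : f ∙ i ≡ 0ℚ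
          at-i = trans (f-∙ i) (trans (cong (λ p → (b * p + c * yτ ∙ i) - a * yρ ∙ i) (zero-on (supports F) i i∈σ))
            (solve 4 (λ b r s t → (b :* con 0ℚ :+ (r :* s) :* t) :- (s :* t) :* r := con 0ℚ) refl b (yρ ∙ i) (yσ ∙ j) (yτ ∙ i)))
          at-j : f ∙ j ≡ 0ℚ
          at-j = trans (f-∙ j) (trans (cong (λ p → (b * yσ ∙ j + c * p) - a * yρ ∙ j) (zero-on (supports H) j (trans (lookup-toggle j T) (cong not j∉T))))
            (solve 4 (λ c r s t → ((r :* t) :* s :+ c :* con 0ℚ) :- (s :* t) :* r := con 0ℚ) refl c (yρ ∙ j) (yσ ∙ j) (yτ ∙ i)))
          basis : Indep hv (toggle j σ)
          basis = proj₂ (indep-add yσ {j} (indep F) (zero-on (supports F)) (<⇒≢ (pos-off (supports F) j j∉σ)))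
          zeros : ∀ x → lookup (toggle j σ) x ≡ true → f ∙ x ≡ 0ℚ
          zeros x x∈ with x Finₚ.≟ j | x Finₚ.≟ i
          ... | yes refl | _ = at-j
          ... | no _ | yes refl = at-i
          ... | no x≢j | no x≢i = on-ridge x (trans (lookup-toggle-≢ σ x≢i) (toggle-inside {σ} x∈ x≢j))
          fk≡0 : (b * yσ ∙ k + c * yτ ∙ k) - a * yρ ∙ k ≡ 0ℚ
          fk≡0 = trans (sym (f-∙ k)) (vanish f basis (trans (∣toggle∣-absent j σ j∉σ) (cong suc (size F))) zeros k)
          positive : 0ℚ < (b * yσ ∙ k + c * yτ ∙ k) - a * yρ ∙ k
          positive = subst (0ℚ <_) (trans (solve 2 (λ z a → z := z :- a :* con 0ℚ) refl (b * yσ ∙ k + c * yτ ∙ k) a)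
              (cong (λ p → (b * yσ ∙ k + c * yτ ∙ k) - a * p) (sym (zero-on (supports G) k k∈ρ))))
            (+-<-≤ (*-< (*-< (pos-off (supports G) j j∉ρ) (pos-off (supports H) i i∉τ)) (pos-off (supports F) k k∉σ))
                   (*-≤ (*-≤ (nonneg (supports G) i) (nonneg (supports F) j)) (nonneg (supports H) k)))

open PolytopeFacets

-- Line shellings in a generic direction

module FacetShellings where
  open import Defs
  open import Data.Fin.Subset as Subset using (Subset; ⊤; ⊥)
  open import Data.Nat as ℕ using (ℕ; zero; suc; s≤s)
  open import Data.Rational using (ℚ; 0ℚ; 1ℚ; _+_; _*_; -_; _≤_; _<_; _-_; ∣_∣)
  open import Data.Rational.Solver using (module +-*-Solver)
  open import Relation.Binary.PropositionalEquality as ≡ using (_≡_; _≢_; refl; sym; trans; cong; cong₂; subst)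

  open Sums ℚ-ring
  open IsField ℚ-isField using (_⁻¹; inverse; *-nonzero)
  open Signs
  open +-*-Solver using (solve; _:=_; _:+_; _:*_; :-_; con; _:-_)

  double-negation : ∀ x → x ≡ - (- x)
  double-negation x = solve 1 (λ x → x := :- (:- x)) refl x

  negate-< : ∀ {x y} → - x < - y → y < x
  negate-< {x} {y} lt = subst (_< x) (sym (double-negation y)) (subst (- (- y) <_) (sym (double-negation x)) (ℚₚ.neg-antimono-< lt))

  ⟨⟩-comm : ∀ {D} (x y : Fin D → ℚ) → ⟨ x , y ⟩ ≡ ⟨ y , x ⟩
  ⟨⟩-comm x y = sum-cong (λ s → ℚₚ.*-comm (x s) (y s))

  ∣∣-partition : ∀ {n} (A B C : Subset n) → A ⊑ C → B ⊑ C → (∀ i → lookup C i ≡ true → lookup A i ≡ true ⊎ lookup B i ≡ true) →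
    (∀ i → lookup A i ≡ true → lookup B i ≡ false) → Subset.∣ A ∣ ℕ.+ Subset.∣ B ∣ ≡ Subset.∣ C ∣
  ∣∣-partition [] [] [] _ _ _ _ = refl
  ∣∣-partition (a ∷ A) (b ∷ B) (c ∷ C) p q r s = head a b c (p zero) (q zero) (r zero) (s zero)
    where
    rec = ∣∣-partition A B C (p ∘ suc) (q ∘ suc) (r ∘ suc) (s ∘ suc)
    head : ∀ a b c → (a ≡ true → c ≡ true) → (b ≡ true → c ≡ true) → (c ≡ true → a ≡ true ⊎ b ≡ true) → (a ≡ true → b ≡ false) →
      Subset.∣ a ∷ A ∣ ℕ.+ Subset.∣ b ∷ B ∣ ≡ Subset.∣ c ∷ C ∣
    head false false false _ _ _ _ = rec
    head true false true _ _ _ _ = cong suc rec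
    head false true true _ _ _ _ = trans (ℕₚ.+-suc _ _) (cong suc rec)
    head true true _ _ _ _ s with s refl
    ... | ()
    head false false true _ _ r _ with r refl
    ... | inj₁ ()
    ... | inj₂ ()
    head true false false p _ _ _ with p refl
    ... | ()
    head false true false _ q _ _ with q refl
    ... | ()

  ∣∣-strict : ∀ {n} {A B : Subset n} {k} → A ⊑ B → lookup B k ≡ true → lookup A k ≡ false → Subset.∣ A ∣ ℕ.< Subset.∣ B ∣
  ∣∣-strict {A = A} {B} {k} s k∈B k∉A = subst (Subset.∣ A ∣ ℕ.<_) (sym (∣toggle∣ k B k∈B))
    (s≤s (⊑⇒∣∣≤ A (toggle k B) (⊑-toggle {A = A} {B} {k} k∉A s)))

  subsets : ∀ n → List (Subset n)
  subsets zero    = [] ∷ []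
  subsets (suc n) = map (true ∷_) (subsets n) ++ map (false ∷_) (subsets n)

  ∈-subsets : ∀ {n} (A : Subset n) → A ∈ₗ subsets n
  ∈-subsets []          = here refl
  ∈-subsets (true ∷ A)  = Membershipₚ.∈-++⁺ˡ (Membershipₚ.∈-map⁺ (true ∷_) (∈-subsets A))
  ∈-subsets (false ∷ A) = Membershipₚ.∈-++⁺ʳ (map (true ∷_) (subsets _)) (Membershipₚ.∈-map⁺ (false ∷_) (∈-subsets A))

  subsets-unique : ∀ n → Unique (subsets n)
  subsets-unique zero    = [] ∷ []
  subsets-unique (suc n) = Uniqueₚ.++⁺ (Uniqueₚ.map⁺ Vecₚ.∷-injectiveʳ (subsets-unique n))
    (Uniqueₚ.map⁺ Vecₚ.∷-injectiveʳ (subsets-unique n)) λ { (m , m′) → disjoint (Membershipₚ.∈-map⁻ (true ∷_) m) (Membershipₚ.∈-map⁻ (false ∷_) m′) }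
    where
    disjoint : ∀ {A : Subset (suc n)} → (∃ λ B → B ∈ₗ subsets n × A ≡ true ∷ B) → (∃ λ B → B ∈ₗ subsets n × A ≡ false ∷ B) → Empty.⊥
    disjoint (_ , _ , refl) (_ , _ , ())

  lookup-injective : ∀ {A : Set} {xs : List A} → Unique xs → ∀ i j → List.lookup xs i ≡ List.lookup xs j → i ≡ j
  lookup-injective (_ ∷ _)  zero    zero    _ = refl
  lookup-injective (x∉ ∷ _) zero    (suc j) e = ⊥-elim (All.lookup x∉ (Membershipₚ.∈-lookup j) e)
  lookup-injective (x∉ ∷ _) (suc i) zero    e = ⊥-elim (All.lookup x∉ (Membershipₚ.∈-lookup i) (sym e))
  lookup-injective (_ ∷ u)  (suc i) (suc j) e = cong suc (lookup-injective u i j e)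

  self≤abs : ∀ x → x ≤ ∣ x ∣
  self≤abs x with ℚₚ.≤-total 0ℚ x
  ... | inj₁ le = ℚₚ.≤-reflexive (sym (ℚₚ.0≤p⇒∣p∣≡p le))
  ... | inj₂ le = ℚₚ.≤-trans le (ℚₚ.0≤∣p∣ x)

  -- The forbidden values are the -a/b; one plus the sum of their absolute values exceeds them all.
  avoid : (L : List (ℚ × ℚ)) → (∀ {ab} → ab ∈ₗ L → proj₁ ab ≢ 0ℚ) →
    ∃ λ ε → ε ≢ 0ℚ × (∀ {ab} → ab ∈ₗ L → proj₁ ab + ε * proj₂ ab ≢ 0ℚ)
  avoid L nz = 1ℚ + total L , <⇒≢ (+-<-≤ (ℚₚ.positive⁻¹ 1ℚ) (total-≤ L)) , λ {ab} m → fine (proj₁ ab) (proj₂ ab) (nz m) (bad<ε m)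
    where
    bad : ℚ × ℚ → ℚ
    bad (a , b) = ∣ - a * b ⁻¹ ∣
    total : List (ℚ × ℚ) → ℚ
    total []       = 0ℚ
    total (ab ∷ L) = bad ab + total L
    total-≤ : ∀ L → 0ℚ ≤ total L
    total-≤ []       = ℚₚ.≤-refl
    total-≤ (ab ∷ L) = +-≤ (ℚₚ.0≤∣p∣ (- proj₁ ab * proj₂ ab ⁻¹)) (total-≤ L)
    bad≤total : ∀ {ab L} → ab ∈ₗ L → bad ab ≤ total L
    bad≤total {ab} {_ ∷ L} (here refl) = ℚₚ.≤-trans (ℚₚ.≤-reflexive (sym (ℚₚ.+-identityʳ (bad ab)))) (ℚₚ.+-monoʳ-≤ (bad ab) (total-≤ L))
    bad≤total {ab} {ab′ ∷ L} (there m) = ℚₚ.≤-trans (bad≤total m) (ℚₚ.≤-trans (ℚₚ.≤-reflexive (sym (ℚₚ.+-identityˡ (total L))))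
      (ℚₚ.+-monoˡ-≤ (total L) (ℚₚ.0≤∣p∣ (- proj₁ ab′ * proj₂ ab′ ⁻¹))))
    bad<ε : ∀ {ab} → ab ∈ₗ L → bad ab < 1ℚ + total L
    bad<ε {ab} m = ℚₚ.≤-<-trans (bad≤total m) (ℚₚ.≤-<-trans (ℚₚ.≤-reflexive (sym (ℚₚ.+-identityˡ (total L)))) (ℚₚ.+-monoˡ-< (total L) (ℚₚ.positive⁻¹ 1ℚ)))
    fine : ∀ a b → a ≢ 0ℚ → bad (a , b) < 1ℚ + total L → a + (1ℚ + total L) * b ≢ 0ℚ
    fine a b a≢0 lt e = go (b ℚₚ.≟ 0ℚ)
      where
      t = 1ℚ + total L
      go : Dec (b ≡ 0ℚ) → Empty.⊥
      go (yes b≡0) = a≢0 (trans (trans (solve 2 (λ a t → a := a :+ t :* con 0ℚ) refl a (1ℚ + total L)) (cong (λ z → a + (1ℚ + total L) * z) (sym b≡0))) e)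
      go (no b≢0) = <⇒≱ lt (ℚₚ.≤-trans (ℚₚ.≤-reflexive (sym bad≡)) (self≤abs (- a * b ⁻¹)))
       where
       bad≡ : - a * b ⁻¹ ≡ t
       bad≡ = begin
         - a * b ⁻¹ ≡⟨ solve 4 (λ a b c t → :- a :* c := t :* (b :* c) :- (a :+ t :* b) :* c) refl a b (b ⁻¹) t ⟩
         t * (b * b ⁻¹) - (a + t * b) * b ⁻¹ ≡⟨ cong₂ (λ p q → t * p - q * b ⁻¹) (inverse b≢0) e ⟩
         t * 1ℚ - 0ℚ * b ⁻¹ ≡⟨ solve 2 (λ t c → t :* con 1ℚ :- con 0ℚ :* c := t) refl t (b ⁻¹) ⟩
         t ∎
         where open ≡.≡-Reasoning

  -- One functional at a time: where the next one vanishes, the point moves along a vector on which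
  -- it does not, by a multiple that keeps the earlier ones nonzero.
  generic-point : ∀ {D} (fs : List (Fin D → ℚ)) → (∀ {f} → f ∈ₗ fs → ∃ λ x → ⟨ f , x ⟩ ≢ 0ℚ) →
    ∃ λ w → ∀ {f} → f ∈ₗ fs → ⟨ f , w ⟩ ≢ 0ℚ
  generic-point []       _  = (λ _ → 0ℚ) , λ ()
  generic-point {D} (f ∷ fs) nz = move (generic-point fs (nz ∘ there)) (nz (here refl))
    where
    move : (∃ λ w → ∀ {g} → g ∈ₗ fs → ⟨ g , w ⟩ ≢ 0ℚ) → (∃ λ x → ⟨ f , x ⟩ ≢ 0ℚ) → ∃ λ w → ∀ {g} → g ∈ₗ f ∷ fs → ⟨ g , w ⟩ ≢ 0ℚ
    move (w , ok) (x , fx) = choose (⟨ f , w ⟩ ℚₚ.≟ 0ℚ)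
      where
      pair : (Fin D → ℚ) → ℚ × ℚ
      pair g = ⟨ g , w ⟩ , ⟨ g , x ⟩
      choose : Dec (⟨ f , w ⟩ ≡ 0ℚ) → ∃ λ w → ∀ {g} → g ∈ₗ f ∷ fs → ⟨ g , w ⟩ ≢ 0ℚ
      choose (no ne) = w , λ { (here refl) → ne ; (there m) → ok m }
      choose (yes fw) = shifted (avoid (map pair fs) nonzero)
        where
        nonzero : ∀ {ab} → ab ∈ₗ map pair fs → proj₁ ab ≢ 0ℚ
        nonzero m with Membershipₚ.∈-map⁻ pair m
        ... | g , g∈ , refl = ok g∈
        shifted : (∃ λ ε → ε ≢ 0ℚ × (∀ {ab} → ab ∈ₗ map pair fs → proj₁ ab + ε * proj₂ ab ≢ 0ℚ)) → ∃ λ w → ∀ {g} → g ∈ₗ f ∷ fs → ⟨ g , w ⟩ ≢ 0ℚ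
        shifted (ε , ε≢0 , fine) = w′ , λ { {g} (here refl) e → *-nonzero ε≢0 fx (trans (sym (at-f g fw)) (trans (sym (value g)) e))
                                          ; {g} (there m) e → fine (Membershipₚ.∈-map⁺ pair m) (trans (sym (value g)) e) }
          where
          w′ : Fin D → ℚ
          w′ s = 1ℚ * w s + ε * x s
          value : ∀ g → ⟨ g , w′ ⟩ ≡ ⟨ g , w ⟩ + ε * ⟨ g , x ⟩
          value g = trans (⟨⟩-comm g w′) (trans (⟨⟩-combination 1ℚ w ε x g)
            (cong₂ (λ p q → p + ε * q) (trans (ℚₚ.*-identityˡ ⟨ w , g ⟩) (⟨⟩-comm w g)) (⟨⟩-comm x g)))
          at-f : ∀ g → ⟨ g , w ⟩ ≡ 0ℚ → ⟨ g , w ⟩ + ε * ⟨ g , x ⟩ ≡ ε * ⟨ g , x ⟩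
          at-f g e = trans (cong (_+ ε * ⟨ g , x ⟩) e) (ℚₚ.+-identityˡ (ε * ⟨ g , x ⟩))

  module FacetList (d′ n : ℕ) (v : Config (suc d′) n)
    (full : Σ (Subset n) λ T → Subset.∣ T ∣ ≡ suc (suc d′) × AffIndep v T)
    (simplicial : Simplicial v) (d<n : suc d′ ℕ.< n) where
    open Polytope d′ n v full simplicial d<n
    open Supports
    open Facet

    -- For i ∈ σ, the coefficient of hv i over the basis o, hv k (k ∈ σ), as a functional.
    dualMap′ : ∀ {σ} → Facet σ → ∀ i b → lookup σ i ≡ b → Fin D → ℚ
    dualMap′ F i true  e = Dual.γ (dual F i e)
    dualMap′ F i false e = λ _ → 0ℚ

    dualMap : ∀ {σ} → Facet σ → Fin n → Fin D → ℚ
    dualMap {σ} F i = dualMap′ F i (lookup σ i) refl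

    zero-functional : ∀ (x : Fin D → ℚ) → ⟨ (λ _ → 0ℚ) , x ⟩ ≡ 0ℚ
    zero-functional x = sum-zero (λ s → ℚₚ.*-zeroˡ (x s))

    dualMap-o : ∀ {σ} (F : Facet σ) i → ⟨ dualMap F i , o ⟩ ≡ 0ℚ
    dualMap-o {σ} F i = go (lookup σ i) refl
      where
      go : ∀ b e → ⟨ dualMap′ F i b e , o ⟩ ≡ 0ℚ
      go true  e = Dual.γ-o (dual F i e)
      go false e = zero-functional o

    dualMap-outside : ∀ {σ} (F : Facet σ) i x → lookup σ i ≡ false → ⟨ dualMap F i , x ⟩ ≡ 0ℚ
    dualMap-outside {σ} F i x i∉σ = go (lookup σ i) refl i∉σ
      where
      go : ∀ b e → b ≡ false → ⟨ dualMap′ F i b e , x ⟩ ≡ 0ℚ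
      go false e _ = zero-functional x

    dualMap-δ : ∀ {σ} (F : Facet σ) i k → lookup σ k ≡ true → dualMap F i ∙ k ≡ δ k i
    dualMap-δ {σ} F i k k∈σ = go (lookup σ i) refl (k Finₚ.≟ i)
      where
      go : ∀ b e → Dec (k ≡ i) → dualMap′ F i b e ∙ k ≡ δ k i
      go true  e (yes refl) = trans (Dual.γ-i (dual F k e)) (sym (δ-refl k))
      go true  e (no k≢i)   = trans (Dual.γ-off (dual F i e) k (trans (lookup-toggle-≢ σ k≢i) k∈σ)) (sym (δ-≢ k≢i))
      go false e (yes refl) = ⊥-elim (true≢false (trans (sym k∈σ) e))
      go false e (no k≢i)   = trans (zero-functional (hv k)) (sym (δ-≢ k≢i))

    coeff : ∀ {σ} → Facet σ → (Fin D → ℚ) → Fin n → ℚ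
    coeff F w i = ⟨ dualMap F i , w ⟩

    expansion : ∀ {σ} (F : Facet σ) f w → ⟨ f , w ⟩ ≡ ⟨ f , o ⟩ * ⟨ y F , w ⟩ + sum (λ i → f ∙ i * coeff F w i)
    expansion {σ} F f w = begin
      ⟨ f , w ⟩ ≡⟨ solve 2 (λ a b → a := (a :- b) :+ b) refl ⟨ f , w ⟩ (G w) ⟩
      (⟨ f , w ⟩ - G w) + G w ≡⟨ cong (_+ G w) (trans (sym (h-∙ w)) (vanish-on-facet F h at-o′ on-σ w)) ⟩
      0ℚ + G w ≡⟨ ℚₚ.+-identityˡ (G w) ⟩
      G w ∎
      where
      open ≡.≡-Reasoning
      fo = ⟨ f , o ⟩
      g : Fin D → ℚ
      g s = sum (λ i → f ∙ i * dualMap F i s)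
      G : (Fin D → ℚ) → ℚ
      G x = fo * ⟨ y F , x ⟩ + sum (λ i → f ∙ i * coeff F x i)
      h : Fin D → ℚ
      h s = 1ℚ * f s + (- 1ℚ) * (fo * y F s + 1ℚ * g s)
      h-∙ : ∀ x → ⟨ h , x ⟩ ≡ ⟨ f , x ⟩ - G x
      h-∙ x = trans (⟨⟩-combination 1ℚ f (- 1ℚ) (λ s → fo * y F s + 1ℚ * g s) x)
        (trans (cong (λ z → 1ℚ * ⟨ f , x ⟩ + (- 1ℚ) * z) (trans (⟨⟩-combination fo (y F) 1ℚ g x) (cong (λ z → fo * ⟨ y F , x ⟩ + 1ℚ * z) (⟨⟩-sumˡ (λ i → f ∙ i) (dualMap F) x))))
          (solve 3 (λ a b c → con 1ℚ :* a :+ con (- 1ℚ) :* (b :+ con 1ℚ :* c) := a :- (b :+ c)) refl ⟨ f , x ⟩ (fo * ⟨ y F , x ⟩) (sum (λ i → f ∙ i * coeff F x i))))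
      at-o′ : ⟨ h , o ⟩ ≡ 0ℚ
      at-o′ = trans (h-∙ o) (trans (cong₂ (λ p q → fo - (fo * p + q)) (height F) (sum-zero (λ i → trans (cong (f ∙ i *_) (dualMap-o F i)) (ℚₚ.*-zeroʳ (f ∙ i)))))
        (solve 1 (λ a → a :- (a :* con 1ℚ :+ con 0ℚ) := con 0ℚ) refl fo))
      on-σ : ∀ k → lookup σ k ≡ true → h ∙ k ≡ 0ℚ
      on-σ k k∈σ = trans (h-∙ (hv k)) (trans (cong₂ (λ p q → f ∙ k - (fo * p + q)) (zero-on (supports F) k k∈σ)
          (trans (sum-cong (λ i → trans (cong (f ∙ i *_) (dualMap-δ F i k k∈σ)) (ℚₚ.*-comm (f ∙ i) (δ k i)))) (sum-δ k (λ i → f ∙ i))))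
        (solve 2 (λ a b → b :- (a :* con 0ℚ :+ b) := con 0ℚ) refl fo (f ∙ k)))

    -- Expand `w` in the basis of `o` and the vertices of σ and apply the functional of τ, which is
    -- 1 at `o`. Both the order and the covering property of the shelling are read off from this
    -- formula.
    height-change : ∀ {σ τ} (F : Facet σ) (G : Facet τ) w → ⟨ y G , w ⟩ ≡ ⟨ y F , w ⟩ + sum (λ i → y G ∙ i * coeff F w i)
    height-change F G w = trans (expansion F (y G) w) (cong (_+ sum (λ i → y G ∙ i * coeff F w i))
      (trans (cong (_* ⟨ y F , w ⟩) (height G)) (ℚₚ.*-identityˡ ⟨ y F , w ⟩)))

    -- Up to scale only one functional vanishes on d independent vectors. If `S` is a facet,
    -- normalisation at `o` gives the facet functional, so the signs at the finitely many other
    -- vertices decide.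
    facet? : ∀ S → Dec (Facet S)
    facet? S = go (Subset.∣ S ∣ ℕ.≟ suc d′) (indep? hv S)
      where
      go : Dec (Subset.∣ S ∣ ≡ suc d′) → Dec (Indep hv S) → Dec (Facet S)
      go (no ne) _ = no (λ F → ne (size F))
      go (yes _) (no ¬ind) = no (λ F → ¬ind (indep F))
      go (yes size) (yes ind) = test (functional-exists (map hv (elems S))
          (s≤s (ℕₚ.≤-reflexive (trans (Listₚ.length-map hv (elems S)) (trans (length-elems S) size)))))
        where
        test : (Σ (Fin D → ℚ) λ g → (∃ λ s → g s ≢ 0ℚ) × (∀ {x} → x ∈ₗ map hv (elems S) → ⟨ g , x ⟩ ≡ 0ℚ)) → Dec (Facet S)
        test (g , (s , gs) , zeros) = decide (Finₚ.all? positive?)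
          where
          r = ⟨ g , o ⟩ ⁻¹
          f : Fin D → ℚ
          f t = r * g t
          positive? : ∀ i → Dec (lookup S i ≡ false → 0ℚ < f ∙ i)
          positive? i = implies (lookup S i) (0ℚ ℚₚ.<? f ∙ i)
            where
            implies : ∀ b → Dec (0ℚ < f ∙ i) → Dec (b ≡ false → 0ℚ < f ∙ i)
            implies true  _        = yes (λ ())
            implies false (yes lt) = yes (λ _ → lt)
            implies false (no ≮)   = no (λ h → ≮ (h refl))
          g-zero : ∀ i → lookup S i ≡ true → g ∙ i ≡ 0ℚ
          g-zero i i∈S = zeros {hv i} (Membershipₚ.∈-map⁺ hv (∈-elems i S i∈S))
          f-zero : ∀ i → lookup S i ≡ true → f ∙ i ≡ 0ℚ
          f-zero i i∈S = trans (⟨⟩-scale r g (hv i)) (trans (cong (r *_) (g-zero i i∈S)) (ℚₚ.*-zeroʳ r))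
          decide : Dec (∀ i → lookup S i ≡ false → 0ℚ < f ∙ i) → Dec (Facet S)
          decide (yes pos) = yes (make-facet f nn (<⇒≢ (pos (proj₁ outside) (proj₂ outside))) ind size f-zero)
            where
            outside : ∃ λ i → lookup S i ≡ false
            outside with ⊑-witness S ⊤ (subst (ℕ._< Subset.∣ ⊤ {n} ∣) (sym size) (subst (suc d′ ℕ.<_) (sym (Subsetₚ.∣⊤∣≡n n)) d<n))
            ... | i , _ , i∉S = i , i∉S
            nn : ∀ i → 0ℚ ≤ f ∙ i
            nn i = go′ (lookup S i) refl
              where
              go′ : ∀ b → lookup S i ≡ b → 0ℚ ≤ f ∙ i
              go′ true  e = ℚₚ.≤-reflexive (sym (f-zero i e))
              go′ false e = ℚₚ.<⇒≤ (pos i e)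
          decide (no ¬pos) = no (λ F → ¬pos (λ i i∉S → subst (0ℚ <_) (sym (same F i)) (pos-off (supports F) i i∉S)))
            where
            same : ∀ F i → f ∙ i ≡ y F ∙ i
            same F i = begin
              f ∙ i ≡⟨ ⟨⟩-scale r g (hv i) ⟩
              r * g ∙ i ≡⟨ cong (r *_) (proportional (hv i)) ⟩
              r * (⟨ g , o ⟩ * y F ∙ i) ≡⟨ solve 3 (λ r g y → r :* (g :* y) := (g :* r) :* y) refl r ⟨ g , o ⟩ (y F ∙ i) ⟩
              (⟨ g , o ⟩ * r) * y F ∙ i ≡⟨ cong (_* y F ∙ i) (inverse go≢0) ⟩
              1ℚ * y F ∙ i ≡⟨ ℚₚ.*-identityˡ (y F ∙ i) ⟩
              y F ∙ i ∎
              where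
              open ≡.≡-Reasoning
              term : ∀ x k → g ∙ k * coeff F x k ≡ 0ℚ
              term x k = go′ (lookup S k) refl
                where
                go′ : ∀ b → lookup S k ≡ b → g ∙ k * coeff F x k ≡ 0ℚ
                go′ true  e = trans (cong (_* coeff F x k) (g-zero k e)) (ℚₚ.*-zeroˡ (coeff F x k))
                go′ false e = trans (cong (g ∙ k *_) (dualMap-outside F k x e)) (ℚₚ.*-zeroʳ (g ∙ k))
              proportional : ∀ x → ⟨ g , x ⟩ ≡ ⟨ g , o ⟩ * ⟨ y F , x ⟩
              proportional x = trans (expansion F g x) (trans (cong (⟨ g , o ⟩ * ⟨ y F , x ⟩ +_) (sum-zero (term x))) (ℚₚ.+-identityʳ (⟨ g , o ⟩ * ⟨ y F , x ⟩)))
              go≢0 : ⟨ g , o ⟩ ≢ 0ℚ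
              go≢0 e = gs (trans (sym (coordinate g s)) (trans (proportional (δ s)) (trans (cong (_* ⟨ y F , δ s ⟩) e) (ℚₚ.*-zeroˡ ⟨ y F , δ s ⟩))))

    Φ : List (Subset n)
    Φ = filter facet? (subsets n)

    N : ℕ
    N = length Φ

    facet : Fin N → Subset n
    facet = List.lookup Φ

    Φ-unique : Unique Φ
    Φ-unique = Uniqueₚ.filter⁺ facet? (subsets-unique n)

    data-at : ∀ σ → Facet (facet σ)
    data-at σ = proj₂ (Membershipₚ.∈-filter⁻ facet? {xs = subsets n} (Membershipₚ.∈-lookup {xs = Φ} σ))

    index : ∀ {S} → Facet S → ∃ λ σ → facet σ ≡ S
    index {S} F = Any.index m , sym (Anyₚ.lookup-index m)
      where
      m : S ∈ₗ Φ
      m = Membershipₚ.∈-filter⁺ facet? (∈-subsets S) F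

    facet-injective : ∀ {σ τ} → facet σ ≡ facet τ → σ ≡ τ
    facet-injective {σ} {τ} = lookup-injective Φ-unique σ τ

    Y : Fin N → Fin D → ℚ
    Y σ = y (data-at σ)

    sup : ∀ σ → Supports (Y σ) (facet σ)
    sup σ = supports (data-at σ)

    -- On the line o + t·w the functional of σ equals 1 + t·key. Increasing keys give the order in
    -- which a point leaving `o`, passing through infinity and returning crosses the facet
    -- hyperplanes.
    key : (Fin D → ℚ) → Fin N → ℚ
    key w σ = ⟨ Y σ , w ⟩

    c : (Fin D → ℚ) → Fin N → Fin n → ℚ
    c w σ = coeff (data-at σ) w

    c-outside : ∀ w σ i → lookup (facet σ) i ≡ false → c w σ i ≡ 0ℚ
    c-outside w σ i = dualMap-outside (data-at σ) i w

    key-change : ∀ w σ τ → key w τ ≡ key w σ + sum (λ i → Y τ ∙ i * c w σ i)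
    key-change w σ τ = height-change (data-at σ) (data-at τ) w

    record Neighbour (σ : Fin N) (i : Fin n) : Set where
      field
        τ      : Fin N
        j      : Fin n
        j∉σ    : lookup (facet σ) j ≡ false
        facet≡ : facet τ ≡ toggle j (toggle i (facet σ))

    neighbour : ∀ σ i → lookup (facet σ) i ≡ true → Neighbour σ i
    neighbour σ i i∈σ = record { τ = proj₁ τ ; j = j ; j∉σ = j∉σ ; facet≡ = proj₂ τ }
      where
      open Pivot (pivot (data-at σ) i i∈σ) renaming (facet to F)
      τ = index F

    module _ {σ i} (i∈σ : lookup (facet σ) i ≡ true) (ν : Neighbour σ i) where
      open Neighbour ν
      private
        T = toggle i (facet σ)

      i≢j : i ≢ j
      i≢j refl = true≢false (trans (sym i∈σ) j∉σ)

      j∉T : lookup T j ≡ false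
      j∉T = trans (lookup-toggle-≢ (facet σ) (i≢j ∘ sym)) j∉σ

      ridge⊑τ : T ⊑ facet τ
      ridge⊑τ k k∈T = trans (cong (λ S → lookup S k) facet≡)
        (trans (lookup-toggle-≢ T (λ { refl → true≢false (trans (sym k∈T) j∉T) })) k∈T)

      i∉τ : lookup (facet τ) i ≡ false
      i∉τ = trans (cong (λ S → lookup S i) facet≡) (trans (lookup-toggle-≢ T i≢j) (trans (lookup-toggle i (facet σ)) (cong not i∈σ)))

      neighbour-key : ∀ w → key w τ ≡ key w σ + Y τ ∙ i * c w σ i
      neighbour-key w = trans (key-change w σ τ) (cong (key w σ +_) (sum-single i others))
        where
        others : ∀ k → k ≢ i → Y τ ∙ k * c w σ k ≡ 0ℚ
        others k k≢i = go (lookup (facet σ) k) refl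
          where
          go : ∀ b → lookup (facet σ) k ≡ b → Y τ ∙ k * c w σ k ≡ 0ℚ
          go true  e = trans (cong (_* c w σ k) (zero-on (sup τ) k (ridge⊑τ k (trans (lookup-toggle-≢ (facet σ) k≢i) e)))) (ℚₚ.*-zeroˡ (c w σ k))
          go false e = trans (cong (Y τ ∙ k *_) (c-outside w σ k e)) (ℚₚ.*-zeroʳ (Y τ ∙ k))

    -- Crossing the ridge opposite `i` changes the key by a positive multiple of `c w σ i`, so a
    -- negative coefficient would lead to a smaller key.
    minimal-nonneg : ∀ w σ i → lookup (facet σ) i ≡ true → (∀ ν → key w σ ≤ key w (Neighbour.τ {σ} {i} ν)) → 0ℚ ≤ c w σ i
    minimal-nonneg w σ i i∈σ min = ℚₚ.≮⇒≥ (λ lt → <⇒≱ (decrease lt) (min ν))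
      where
      ν = neighbour σ i i∈σ
      open Neighbour ν
      decrease : c w σ i < 0ℚ → key w τ < key w σ
      decrease lt = <-from-zero (subst (0ℚ <_) eq (*-< (pos-off (sup τ) i (i∉τ i∈σ ν)) (neg-< lt)))
        where
        eq : Y τ ∙ i * - (c w σ i) ≡ key w σ - key w τ
        eq = trans (solve 3 (λ k a c → a :* (:- c) := k :- (k :+ a :* c)) refl (key w σ) (Y τ ∙ i) (c w σ i))
          (cong (λ z → key w σ - z) (sym (neighbour-key i∈σ ν w)))

    -- Take the facet of least key among those containing `F`. A vertex outside `F` can be pivoted
    -- away without losing `F`, hence has a nonnegative coefficient.
    covers : ∀ w (F : Subset n) τ → F ⊑ facet τ → ∃ λ σ → F ⊑ facet σ × (∀ i → c w σ i < 0ℚ → lookup F i ≡ true)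
    covers w F τ F⊑τ = found (argmin (λ σ → F ⊑? facet σ) (key w) (τ , F⊑τ))
      where
      found : (∃ λ σ → F ⊑ facet σ × (∀ ρ → F ⊑ facet ρ → key w σ ≤ key w ρ)) → ∃ λ σ → F ⊑ facet σ × (∀ i → c w σ i < 0ℚ → lookup F i ≡ true)
      found (σ , F⊑σ , min) = σ , F⊑σ , λ i lt → go i lt (lookup (facet σ) i) refl (lookup F i) refl
        where
        go : ∀ i → c w σ i < 0ℚ → ∀ b → lookup (facet σ) i ≡ b → ∀ b′ → lookup F i ≡ b′ → lookup F i ≡ true
        go i lt _     _  true  e′ = e′
        go i lt false e  false _  = ⊥-elim (ℚₚ.<-irrefl (c-outside w σ i e) lt)
        go i lt true  e  false e′ = ⊥-elim (<⇒≱ lt (minimal-nonneg w σ i e (λ ν → min (Neighbour.τ ν)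
          (λ k k∈F → ridge⊑τ e ν k (⊑-toggle {A = F} {facet σ} {i} e′ F⊑σ k k∈F)))))

    -- In the formula for the change of key all terms are nonnegative: the functional of τ vanishes
    -- wherever a coefficient is negative. A vertex of σ outside τ makes the change positive, by
    -- genericity.
    ordered : ∀ w σ τ → (∀ i → lookup (facet σ) i ≡ true → c w σ i ≢ 0ℚ) → (∀ i → c w σ i < 0ℚ → lookup (facet τ) i ≡ true) →
      σ ≡ τ ⊎ key w σ < key w τ
    ordered w σ τ generic R⊑τ = decide (facet σ ⊑? facet τ)
      where
      sizes : Subset.∣ facet σ ∣ ≡ Subset.∣ facet τ ∣
      sizes = trans (size (data-at σ)) (sym (size (data-at τ)))
      nonneg-outside : ∀ i → lookup (facet τ) i ≡ false → 0ℚ ≤ c w σ i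
      nonneg-outside i e = ℚₚ.≮⇒≥ (λ lt → true≢false (trans (sym (R⊑τ i lt)) e))
      terms : ∀ i → 0ℚ ≤ Y τ ∙ i * c w σ i
      terms i = go (lookup (facet τ) i) refl
        where
        go : ∀ b → lookup (facet τ) i ≡ b → 0ℚ ≤ Y τ ∙ i * c w σ i
        go true  e = ℚₚ.≤-reflexive (sym (trans (cong (_* c w σ i) (zero-on (sup τ) i e)) (ℚₚ.*-zeroˡ (c w σ i))))
        go false e = *-≤ (nonneg (sup τ) i) (nonneg-outside i e)
      increase : ∀ i → lookup (facet σ) i ≡ true → lookup (facet τ) i ≡ false → key w σ < key w τ
      increase i i∈σ i∉τ = <-from-zero (subst (0ℚ <_) (trans (solve 2 (λ k s → s := (k :+ s) :- k) refl (key w σ) (sum (λ i → Y τ ∙ i * c w σ i)))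
          (cong (_- key w σ) (sym (key-change w σ τ))))
        (sum-< terms i (*-< (pos-off (sup τ) i i∉τ) (≢0∧≥0⇒>0 (nonneg-outside i i∉τ) (generic i i∈σ)))))
      decide : Dec (facet σ ⊑ facet τ) → σ ≡ τ ⊎ key w σ < key w τ
      decide (yes s) = inj₁ (facet-injective (⊑-equal (facet σ) (facet τ) s sizes))
      decide (no ¬s) = inj₂ (increase (proj₁ out) (proj₁ (proj₂ out)) (proj₂ (proj₂ out)))
        where
        out : ∃ λ i → lookup (facet σ) i ≡ true × lookup (facet τ) i ≡ false
        out with Finₚ.any? (λ i → both (lookup (facet σ) i) (lookup (facet τ) i))
          where
          both : ∀ a b → Dec (a ≡ true × b ≡ false)
          both true  false = yes (refl , refl)
          both true  true  = no λ ()
          both false b     = no λ ()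
        ... | yes found = found
        ... | no none = ⊥-elim (¬s (λ i i∈σ → Boolₚ.¬-not (λ e → none (i , i∈σ , e))))

    negate : (Fin D → ℚ) → Fin D → ℚ
    negate w s = (- 1ℚ) * w s

    ⟨⟩-negate : ∀ f w → ⟨ f , negate w ⟩ ≡ - ⟨ f , w ⟩
    ⟨⟩-negate f w = trans (⟨⟩-comm f (negate w)) (trans (⟨⟩-scale (- 1ℚ) w f) (trans (cong ((- 1ℚ) *_) (⟨⟩-comm w f))
      (solve 1 (λ x → con (- 1ℚ) :* x := :- x) refl ⟨ f , w ⟩)))

    direction : ∃ λ w → ∀ σ i → lookup (facet σ) i ≡ true → c w σ i ≢ 0ℚ
    direction = conclude (generic-point duals nonzero)
      where
      dualsAt : Fin N → List (Fin D → ℚ)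
      dualsAt σ = map (dualMap (data-at σ)) (elems (facet σ))
      duals : List (Fin D → ℚ)
      duals = concat (map dualsAt (allFin N))
      Nonzero : (Fin D → ℚ) → Set
      Nonzero f = ∃ λ x → ⟨ f , x ⟩ ≢ 0ℚ
      one : ∀ σ i → lookup (facet σ) i ≡ true → Nonzero (dualMap (data-at σ) i)
      one σ i i∈σ = hv i , λ e → 1≢0 (trans (sym (trans (dualMap-δ (data-at σ) i i i∈σ) (δ-refl i))) e)
      in-facet : ∀ {f} σ → (∃ λ i → i ∈ₗ elems (facet σ) × f ≡ dualMap (data-at σ) i) → Nonzero f
      in-facet σ (i , i∈ , e) = subst Nonzero (sym e) (one σ i (elems-∈ (facet σ) i∈))
      in-list : ∀ {f L} → f ∈ₗ L → (∃ λ σ → σ ∈ₗ allFin N × L ≡ dualsAt σ) → Nonzero f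
      in-list {f} m (σ , _ , e) = in-facet σ (Membershipₚ.∈-map⁻ (dualMap (data-at σ)) (subst (f ∈ₗ_) e m))
      in-concat : ∀ {f} → (∃ λ L → f ∈ₗ L × L ∈ₗ map dualsAt (allFin N)) → Nonzero f
      in-concat (L , m , m′) = in-list m (Membershipₚ.∈-map⁻ dualsAt m′)
      nonzero : ∀ {f} → f ∈ₗ duals → Nonzero f
      nonzero m = in-concat (Membershipₚ.∈-concat⁻′ (map dualsAt (allFin N)) m)
      conclude : (∃ λ w → ∀ {f} → f ∈ₗ duals → ⟨ f , w ⟩ ≢ 0ℚ) → ∃ λ w → ∀ σ i → lookup (facet σ) i ≡ true → c w σ i ≢ 0ℚ
      conclude (w , ok) = w , λ σ i i∈σ → ok {dualMap (data-at σ) i} (Membershipₚ.∈-concat⁺′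
        (Membershipₚ.∈-map⁺ (dualMap (data-at σ)) (∈-elems i (facet σ) i∈σ)) (Membershipₚ.∈-map⁺ dualsAt (Membershipₚ.∈-allFin σ)))

    module Directed (w : Fin D → ℚ) (generic : ∀ σ i → lookup (facet σ) i ≡ true → c w σ i ≢ 0ℚ) where
      R S : Fin N → Subset n
      R σ = Vec.tabulate (λ i → does (c w σ i ℚₚ.<? 0ℚ))
      S σ = Vec.tabulate (λ i → does (0ℚ ℚₚ.<? c w σ i))
      R⇒ : ∀ σ i → lookup (R σ) i ≡ true → c w σ i < 0ℚ
      R⇒ σ i e = does⁻ (c w σ i ℚₚ.<? 0ℚ) (trans (sym (Vecₚ.lookup∘tabulate _ i)) e)
      S⇒ : ∀ σ i → lookup (S σ) i ≡ true → 0ℚ < c w σ i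
      S⇒ σ i e = does⁻ (0ℚ ℚₚ.<? c w σ i) (trans (sym (Vecₚ.lookup∘tabulate _ i)) e)
      ⇒R : ∀ σ i → c w σ i < 0ℚ → lookup (R σ) i ≡ true
      ⇒R σ i lt = trans (Vecₚ.lookup∘tabulate _ i) (dec-true (c w σ i ℚₚ.<? 0ℚ) lt)
      ⇒S : ∀ σ i → 0ℚ < c w σ i → lookup (S σ) i ≡ true
      ⇒S σ i lt = trans (Vecₚ.lookup∘tabulate _ i) (dec-true (0ℚ ℚₚ.<? c w σ i) lt)
      inside : ∀ σ i → c w σ i ≢ 0ℚ → lookup (facet σ) i ≡ true
      inside σ i ne = Boolₚ.¬-not (λ e → ne (c-outside w σ i e))
      R⊎S : ∀ σ i → lookup (facet σ) i ≡ true → lookup (R σ) i ≡ true ⊎ lookup (S σ) i ≡ true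
      R⊎S σ i i∈σ = go (c w σ i ℚₚ.<? 0ℚ)
        where
        go : Dec (c w σ i < 0ℚ) → lookup (R σ) i ≡ true ⊎ lookup (S σ) i ≡ true
        go (yes lt) = inj₁ (⇒R σ i lt)
        go (no ≮)   = inj₂ (⇒S σ i (≢0∧≥0⇒>0 (ℚₚ.≮⇒≥ ≮) (generic σ i i∈σ)))
      R-inside : ∀ σ → R σ ⊑ facet σ
      R-inside σ i e = inside σ i (λ z → ℚₚ.<-irrefl z (R⇒ σ i e))
      S-inside : ∀ σ → S σ ⊑ facet σ
      S-inside σ i e = inside σ i (λ z → ℚₚ.<-irrefl (sym z) (S⇒ σ i e))
      R+S : ∀ σ → Subset.∣ R σ ∣ ℕ.+ Subset.∣ S σ ∣ ≡ suc d′
      R+S σ = trans (∣∣-partition (R σ) (S σ) (facet σ) (R-inside σ) (S-inside σ) (R⊎S σ)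
        (λ i e → Boolₚ.¬-not (λ e′ → ℚₚ.<-asym (R⇒ σ i e) (S⇒ σ i e′)))) (size (data-at σ))
      above : Fin N → Subset N
      above σ = Vec.tabulate (λ ρ → does (key w σ ℚₚ.<? key w ρ))
      above⇒ : ∀ σ ρ → lookup (above σ) ρ ≡ true → key w σ < key w ρ
      above⇒ σ ρ e = does⁻ (key w σ ℚₚ.<? key w ρ) (trans (sym (Vecₚ.lookup∘tabulate _ ρ)) e)
      ⇒above : ∀ σ ρ → key w σ < key w ρ → lookup (above σ) ρ ≡ true
      ⇒above σ ρ lt = trans (Vecₚ.lookup∘tabulate _ ρ) (dec-true (key w σ ℚₚ.<? key w ρ) lt)
      -- Counting the facets above turns rational keys into bounded naturals and reverses the order.
      -- Distinct facets may share a key, so only strict comparisons are transferred.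
      rank : Fin N → ℕ
      rank σ = Subset.∣ above σ ∣
      rank-mono : ∀ σ τ → key w σ < key w τ → rank τ ℕ.< rank σ
      rank-mono σ τ lt = ∣∣-strict {A = above τ} {above σ} {τ} (λ ρ e → ⇒above σ ρ (ℚₚ.<-trans lt (above⇒ τ ρ e)))
        (⇒above σ τ lt) (Boolₚ.¬-not (λ e → ℚₚ.<-irrefl refl (above⇒ τ τ e)))
      reverse : ∀ σ τ → key (negate w) σ < key (negate w) τ → key w τ < key w σ
      reverse σ τ lt = negate-< (subst (_< - key w τ) (⟨⟩-negate (Y σ) w) (subst (key (negate w) σ <_) (⟨⟩-negate (Y τ) w) lt))
      positive : ∀ σ i → c (negate w) σ i < 0ℚ → 0ℚ < c w σ i
      positive σ i lt = negate-< (subst (_< 0ℚ) (⟨⟩-negate (dualMap (data-at σ) i) w) lt)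
      negative : ∀ σ i → 0ℚ < c w σ i → c (negate w) σ i < 0ℚ
      negative σ i lt = subst (_< 0ℚ) (sym (⟨⟩-negate (dualMap (data-at σ) i) w)) (ℚₚ.neg-antimono-< lt)
      R-order : ∀ σ τ → R σ ⊑ facet τ → σ ≡ τ ⊎ rank τ ℕ.< rank σ
      R-order σ τ s = Sum.map id (rank-mono σ τ) (ordered w σ τ (generic σ) (λ i lt → s i (⇒R σ i lt)))
      c-negate : ∀ σ i → c (negate w) σ i ≡ - c w σ i
      c-negate σ i = ⟨⟩-negate (dualMap (data-at σ) i) w
      generic′ : ∀ σ i → lookup (facet σ) i ≡ true → c (negate w) σ i ≢ 0ℚ
      generic′ σ i i∈σ e = generic σ i i∈σ (trans (double-negation (c w σ i)) (cong -_ (trans (sym (c-negate σ i)) e)))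
      S-order : ∀ σ τ → S σ ⊑ facet τ → σ ≡ τ ⊎ rank σ ℕ.< rank τ
      S-order σ τ s = Sum.map id (λ lt → rank-mono τ σ (reverse σ τ lt))
        (ordered (negate w) σ τ (generic′ σ) (λ i lt → s i (⇒S σ i (positive σ i lt))))
      rephraseR : ∀ F → (∃ λ σ → F ⊑ facet σ × (∀ i → c w σ i < 0ℚ → lookup F i ≡ true)) → ∃ λ σ → R σ ⊑ F × F ⊑ facet σ
      rephraseR F (σ , s , r) = σ , (λ i e → r i (R⇒ σ i e)) , s
      rephraseS : ∀ F → (∃ λ σ → F ⊑ facet σ × (∀ i → c (negate w) σ i < 0ℚ → lookup F i ≡ true)) → ∃ λ σ → S σ ⊑ F × F ⊑ facet σ
      rephraseS F (σ , s , r) = σ , (λ i e → r i (negative σ i (S⇒ σ i e))) , s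
      ridge-of : ∀ σ i → lookup (facet σ) i ≡ true → Neighbour σ i → ∃₂ λ τ j → τ ≢ σ × lookup (facet τ) j ≡ true ×
        toggle j (facet τ) ≡ toggle i (facet σ) × (∀ ρ → toggle i (facet σ) ⊑ facet ρ → ρ ≡ σ ⊎ ρ ≡ τ)
      ridge-of σ i i∈σ ν = τ , j , different , j∈τ , back , only
        where
        open Neighbour ν
        T : Subset n
        T = toggle i (facet σ)
        j∈τ : lookup (facet τ) j ≡ true
        j∈τ = trans (cong (λ S → lookup S j) facet≡) (trans (lookup-toggle j T) (cong not (j∉T i∈σ ν)))
        different : τ ≢ σ
        different e = true≢false (trans (sym j∈τ) (trans (cong (λ ρ → lookup (facet ρ) j) e) j∉σ))
        back : toggle j (facet τ) ≡ T
        back = trans (cong (toggle j) facet≡) (toggle-involutive j T)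
        opposite : Facet (toggle j T)
        opposite = subst Facet facet≡ (data-at τ)
        only : ∀ ρ → T ⊑ facet ρ → ρ ≡ σ ⊎ ρ ≡ τ
        only ρ s = identify (two-facets {facet σ} {i} {j} {facet ρ} (data-at σ) i∈σ j∉σ opposite (data-at ρ) s)
          where
          identify : facet ρ ≡ facet σ ⊎ facet ρ ≡ toggle j T → ρ ≡ σ ⊎ ρ ≡ τ
          identify (inj₁ e) = inj₁ (facet-injective e)
          identify (inj₂ e) = inj₂ (facet-injective (trans e (sym facet≡)))

      directed-shelling : Shelling (suc d′) n
      directed-shelling = record
        { N = N ; facet = facet ; R = R ; S = S ; facet-size = λ σ → size (data-at σ)
        ; R⊑ = R-inside
        ; S⊑ = S-inside
        ; R⊎S = R⊎S
        ; R+S = R+S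
        ; bound = N ; rank = rank ; rank≤ = λ σ → Subsetₚ.∣p∣≤n (above σ)
        ; R-order = R-order ; S-order = S-order
        ; R-covers = λ F τ s → rephraseR F (covers w F τ s)
        ; S-covers = λ F τ s → rephraseS F (covers (negate w) F τ s)
        ; ridge = λ σ i i∈σ → ridge-of σ i i∈σ (neighbour σ i i∈σ) }

    shelling : Shelling (suc d′) n
    shelling = Directed.directed-shelling (proj₁ direction) (proj₂ direction)

open FacetShellings

-- Proper faces and subsets of facets

module PolytopeFaces where
  open import Defs
  open import Data.Fin.Subset as Subset using (Subset; ⊤)
  open import Data.Nat as ℕ using (ℕ; zero; suc)
  open import Data.Rational using (ℚ; 0ℚ; 1ℚ; _+_; _*_; -_; _≤_; _<_; _-_; ∣_∣)
  open import Data.Rational.Solver using (module +-*-Solver)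
  open import Relation.Binary.PropositionalEquality using (_≡_; refl; sym; trans; cong; cong₂; subst)

  open Sums ℚ-ring
  open IsField ℚ-isField using (_⁻¹; inverse)
  open Signs
  open +-*-Solver using (solve; _:=_; _:+_; _:*_; :-_; con; _:-_)


  1+abs+self-positive : ∀ x → 0ℚ < (1ℚ + ∣ x ∣) + x
  1+abs+self-positive x = ℚₚ.<-≤-trans (+-<-≤ (ℚₚ.positive⁻¹ 1ℚ) (zero-from-≤ (subst (- x ≤_) (ℚₚ.∣-p∣≡∣p∣ x) (self≤abs (- x)))))
    (ℚₚ.≤-reflexive (solve 2 (λ a x → con 1ℚ :+ (a :- :- x) := (con 1ℚ :+ a) :+ x) refl ∣ x ∣ x))

  dominate : ∀ {n} {P : Fin n → Set} (P? : ∀ k → Dec (P k)) (α β : Fin n → ℚ) → (∀ k → P k → 0ℚ < α k) →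
    ∃ λ M → 0ℚ ≤ M × (∀ k → P k → 0ℚ < M * α k + β k)
  dominate {n} {P} P? α β pos = sum t , sum-≤ t-≤ , λ k Pk → large k Pk
    where
    term : ∀ k → Dec (P k) → ℚ
    term k (yes _) = (1ℚ + ∣ β k ∣) * α k ⁻¹
    term k (no _)  = 0ℚ
    term-≤ : ∀ k (d : Dec (P k)) → 0ℚ ≤ term k d
    term-≤ k (yes Pk) = *-≤ (+-≤ (ℚₚ.<⇒≤ (ℚₚ.positive⁻¹ 1ℚ)) (ℚₚ.0≤∣p∣ (β k))) (ℚₚ.<⇒≤ (⁻¹-< (pos k Pk)))
    term-≤ k (no _) = ℚₚ.≤-refl
    term-k : ∀ k (d : Dec (P k)) → P k → term k d * α k ≡ 1ℚ + ∣ β k ∣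
    term-k k (yes Pk) _ = trans (solve 3 (λ b r a → (b :* r) :* a := b :* (a :* r)) refl (1ℚ + ∣ β k ∣) (α k ⁻¹) (α k))
      (trans (cong ((1ℚ + ∣ β k ∣) *_) (inverse (<⇒≢ (pos k Pk)))) (ℚₚ.*-identityʳ (1ℚ + ∣ β k ∣)))
    term-k k (no ¬Pk) Pk = ⊥-elim (¬Pk Pk)
    t : Fin n → ℚ
    t k = term k (P? k)
    t-≤ : ∀ k → 0ℚ ≤ t k
    t-≤ k = term-≤ k (P? k)
    summand≤sum : ∀ {m} (f : Fin m → ℚ) → (∀ i → 0ℚ ≤ f i) → ∀ k → f k ≤ sum f
    summand≤sum {suc m} f nn zero = ℚₚ.≤-trans (ℚₚ.≤-reflexive (sym (ℚₚ.+-identityʳ (f zero))))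
      (ℚₚ.≤-trans (ℚₚ.+-monoʳ-≤ (f zero) (sum-≤ (nn ∘ suc))) (ℚₚ.≤-reflexive (sym sum-∷)))
    summand≤sum {suc m} f nn (suc k) = ℚₚ.≤-trans (summand≤sum (f ∘ suc) (nn ∘ suc) k) (ℚₚ.≤-trans (ℚₚ.≤-reflexive (sym (ℚₚ.+-identityˡ (sum (f ∘ suc)))))
      (ℚₚ.≤-trans (ℚₚ.+-monoˡ-≤ (sum (f ∘ suc)) (nn zero)) (ℚₚ.≤-reflexive (sym sum-∷))))
    large : ∀ k → P k → 0ℚ < sum t * α k + β k
    large k Pk = ℚₚ.<-≤-trans (subst (λ z → 0ℚ < z + β k) (sym (term-k k (P? k) Pk)) (1+abs+self-positive (β k)))
      (ℚₚ.+-monoˡ-≤ (β k) (≤-from-zero {t k * α k} {sum t * α k} (subst (0ℚ ≤_) (solve 3 (λ s t a → (s :- t) :* a := s :* a :- t :* a) refl (sum t) (t k) (α k))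
        (*-≤ (zero-from-≤ (summand≤sum t t-≤ k)) (ℚₚ.<⇒≤ (pos k Pk))))))

  module Faces (d′ n : ℕ) (v : Config (suc d′) n)
    (full : Σ (Subset n) λ T → Subset.∣ T ∣ ≡ suc (suc d′) × AffIndep v T)
    (simplicial : Simplicial v) (d<n : suc d′ ℕ.< n) where
    open Polytope d′ n v full simplicial d<n
    open Supports
    open Facet

    open FacetList d′ n v full simplicial d<n

    bit : Bool → ℚ
    bit true  = 1ℚ
    bit false = 0ℚ

    bit-≤ : ∀ b → 0ℚ ≤ bit b
    bit-≤ true  = ℚₚ.<⇒≤ (ℚₚ.positive⁻¹ 1ℚ)
    bit-≤ false = ℚₚ.≤-refl

    -- Let w be the sum of the vertices in S and σ a facet of least key at w. Expanding w over σ and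
    -- applying a functional f that supports S gives 0 = f(o)·key plus nonnegative terms, with f(o)
    -- > 0. So the key, a sum of nonnegative values at the vertices of S, is zero, and all of them
    -- lie on σ.
    face-in-facet : ∀ {S} → IsFace v S → (∃ λ i → lookup S i ≡ false) → ∃ λ σ → S ⊑ facet σ
    face-in-facet {S} isFace (out , out∉S) = from-support (face⇒supports isFace)
      where
      w : Fin D → ℚ
      w s = sum (λ i → bit (lookup S i) * hv i s)
      at-w : ∀ f → ⟨ f , w ⟩ ≡ sum (λ i → bit (lookup S i) * f ∙ i)
      at-w f = ⟨⟩-sumʳ f (λ i → bit (lookup S i)) hv
      from-support : (∃ λ f → Supports f S) → ∃ λ σ → S ⊑ facet σ
      from-support (f , sup-f) = found (argmin {P = λ _ → Unit.⊤} (λ _ → yes Unit.tt) (key w) (proj₁ (index (proj₂ facet-exists)) , Unit.tt))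
        where
        f-w : ⟨ f , w ⟩ ≡ 0ℚ
        f-w = trans (at-w f) (sum-zero (λ i → go i (lookup S i) refl))
          where
          go : ∀ i b → lookup S i ≡ b → bit b * f ∙ i ≡ 0ℚ
          go i true  e = trans (cong (1ℚ *_) (zero-on sup-f i e)) (ℚₚ.*-zeroʳ 1ℚ)
          go i false e = ℚₚ.*-zeroˡ (f ∙ i)
        f-o : 0ℚ < ⟨ f , o ⟩
        f-o = o-positive f (nonneg sup-f) {out} (<⇒≢ (pos-off sup-f out out∉S))
        found : (∃ λ σ → Unit.⊤ × (∀ τ → Unit.⊤ → key w σ ≤ key w τ)) → ∃ λ σ → S ⊑ facet σ
        found (σ , _ , min) = σ , inside
          where
          terms : ∀ i → 0ℚ ≤ bit (lookup S i) * Y σ ∙ i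
          terms i = *-≤ (bit-≤ (lookup S i)) (nonneg (sup σ) i)
          c-≤ : ∀ i → 0ℚ ≤ f ∙ i * c w σ i
          c-≤ i = go (lookup (facet σ) i) refl
            where
            go : ∀ b → lookup (facet σ) i ≡ b → 0ℚ ≤ f ∙ i * c w σ i
            go true  e = *-≤ (nonneg sup-f i) (minimal-nonneg w σ i e (λ ν → min (Neighbour.τ ν) Unit.tt))
            go false e = ℚₚ.≤-reflexive (sym (trans (cong (f ∙ i *_) (c-outside w σ i e)) (ℚₚ.*-zeroʳ (f ∙ i))))
          key≯0 : ¬ (0ℚ < key w σ)
          key≯0 lt = <⇒≢ (+-<-≤ (*-< f-o lt) (sum-≤ c-≤)) (trans (sym (expansion (data-at σ) f w)) f-w)
          weights≡0 : ∀ i → bit (lookup S i) * Y σ ∙ i ≡ 0ℚ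
          weights≡0 = sum-≤-zero terms (ℚₚ.≤-trans (ℚₚ.≤-reflexive (sym (at-w (Y σ)))) (ℚₚ.≮⇒≥ key≯0))
          inside : S ⊑ facet σ
          inside i i∈S = Boolₚ.¬-not (λ e → <⇒≢ (pos-off (sup σ) i e)
            (trans (sym (ℚₚ.*-identityˡ (Y σ ∙ i))) (trans (cong (λ b → bit b * Y σ ∙ i) (sym i∈S)) (weights≡0 i))))

    -- The dual basis gives a functional that is 0 on F and 1 on the other vertices of σ; a large
    -- multiple of the facet functional leaves these values alone and makes it positive outside σ.
    subface : ∀ σ F → F ⊑ facet σ → IsFace v F
    subface σ F F⊑σ = supports⇒face (from-bound (dominate {P = λ k → lookup (facet σ) k ≡ false} (λ k → lookup (facet σ) k Boolₚ.≟ false)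
        (λ k → Y σ ∙ k) G (pos-off (sup σ))))
      where
      e : Fin n → ℚ
      e i = bit (not (lookup F i))
      g : Fin D → ℚ
      g s = sum (λ i → e i * dualMap (data-at σ) i s)
      G : Fin n → ℚ
      G k = g ∙ k
      G-on : ∀ k → lookup (facet σ) k ≡ true → G k ≡ e k
      G-on k k∈σ = trans (⟨⟩-sumˡ e (dualMap (data-at σ)) (hv k))
        (trans (sum-cong (λ i → trans (cong (e i *_) (dualMap-δ (data-at σ) i k k∈σ)) (ℚₚ.*-comm (e i) (δ k i)))) (sum-δ k e))
      f : ℚ → Fin D → ℚ
      f M s = M * Y σ s + 1ℚ * g s
      f-∙ : ∀ M k → f M ∙ k ≡ M * Y σ ∙ k + G k
      f-∙ M k = trans (⟨⟩-combination M (Y σ) 1ℚ g (hv k)) (cong (M * Y σ ∙ k +_) (ℚₚ.*-identityˡ (G k)))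
      f-on : ∀ M k → lookup (facet σ) k ≡ true → f M ∙ k ≡ e k
      f-on M k k∈σ = trans (f-∙ M k) (trans (cong₂ (λ p q → M * p + q) (zero-on (sup σ) k k∈σ) (G-on k k∈σ))
        (solve 2 (λ m e → m :* con 0ℚ :+ e := e) refl M (e k)))
      from-bound : (b : ∃ λ M → 0ℚ ≤ M × (∀ k → lookup (facet σ) k ≡ false → 0ℚ < M * Y σ ∙ k + G k)) → Supports (f (proj₁ b)) F
      from-bound (M , _ , large) = record
        { nonneg = λ k → sign k (lookup (facet σ) k) refl
        ; zero-on = λ k k∈F → trans (f-on M k (F⊑σ k k∈F)) (cong (bit ∘ not) k∈F)
        ; pos-off = λ k k∉F → off k k∉F (lookup (facet σ) k) refl }
        where
        off : ∀ k → lookup F k ≡ false → ∀ b → lookup (facet σ) k ≡ b → 0ℚ < f M ∙ k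
        off k k∉F true  k∈σ = subst (0ℚ <_) (sym (trans (f-on M k k∈σ) (cong (bit ∘ not) k∉F))) (ℚₚ.positive⁻¹ 1ℚ)
        off k k∉F false k∉σ = subst (0ℚ <_) (sym (f-∙ M k)) (large k k∉σ)
        sign : ∀ k b → lookup (facet σ) k ≡ b → 0ℚ ≤ f M ∙ k
        sign k true  k∈σ = subst (0ℚ ≤_) (sym (f-on M k k∈σ)) (bit-≤ (not (lookup F k)))
        sign k false k∉σ = ℚₚ.<⇒≤ (subst (0ℚ <_) (sym (f-∙ M k)) (large k k∉σ))

    subface-j : ∀ σ F j → F ⊑ facet σ → Subset.∣ F ∣ ≡ suc j → IsJFace v j F
    subface-j σ F j F⊑σ size′ = subface σ F F⊑σ
      , (F , id , size′ , indep⇒affIndep (indep-⊑ F⊑σ (indep (data-at σ))))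
      , λ T T⊆F _ → subst (Subset.∣ T ∣ ℕ.≤_) size′ (⊑⇒∣∣≤ T F (⊆⇒⊑ T⊆F))

open PolytopeFaces

-- From h-vectors to face numbers

module FaceCounts where
  open import Data.Fin.Subset using (Subset; ∣_∣; ⊤; ⊥)
  open import Data.Nat as ℕ using (ℕ; zero; suc; s≤s; z≤n; _∸_; _+_; _*_; _≤_; _<_; _≡ᵇ_)
  open import Data.Nat.Combinatorics using (_C_; nCk+nC[k+1]≡[n+1]C[k+1]; nCk≡nC[n∸k]; k>n⇒nCk≡0; nCn≡1)
  open import Data.Nat.Solver using (module +-*-Solver)
  open import Relation.Binary.PropositionalEquality as ≡ using (_≡_; _≢_; refl; sym; trans; cong; cong₂; subst)

  open +-*-Solver using (solve; _:=_; _:+_)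

  -- Abstract, as the definition of _C_ unfolds to divisions of factorials.
  abstract
    binom : ℕ → ℕ → ℕ
    binom n k = n C k

    binom≡C : ∀ n k → binom n k ≡ n C k
    binom≡C n k = refl

    pascal : ∀ n k → binom (suc n) (suc k) ≡ binom n k + binom n (suc k)
    pascal n k = sym (nCk+nC[k+1]≡[n+1]C[k+1] n k)

    binom-0 : ∀ n → binom n 0 ≡ 1
    binom-0 n = trans (nCk≡nC[n∸k] {0} {n} z≤n) (nCn≡1 n)

    binom-self : ∀ n → binom n n ≡ 1
    binom-self = nCn≡1

    binom-> : ∀ {n k} → n < k → binom n k ≡ 0
    binom-> = k>n⇒nCk≡0

    binom-sym : ∀ {n k} → k ≤ n → binom n k ≡ binom n (n ∸ k)
    binom-sym = nCk≡nC[n∸k]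

  sumTo : ℕ → (ℕ → ℕ) → ℕ
  sumTo zero    f = f 0
  sumTo (suc s) f = f 0 + sumTo s (f ∘ suc)

  sumTo-cong : ∀ s {f g} → (∀ l → l ≤ s → f l ≡ g l) → sumTo s f ≡ sumTo s g
  sumTo-cong zero    e = e 0 z≤n
  sumTo-cong (suc s) e = cong₂ _+_ (e 0 z≤n) (sumTo-cong s (λ l le → e (suc l) (s≤s le)))

  sumTo-mono : ∀ s {f g} → (∀ l → l ≤ s → f l ≤ g l) → sumTo s f ≤ sumTo s g
  sumTo-mono zero    e = e 0 z≤n
  sumTo-mono (suc s) e = ℕₚ.+-mono-≤ (e 0 z≤n) (sumTo-mono s (λ l le → e (suc l) (s≤s le)))

  sumTo-last : ∀ s f → sumTo (suc s) f ≡ sumTo s f + f (suc s)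
  sumTo-last zero    f = refl
  sumTo-last (suc s) f = trans (cong (f 0 +_) (sumTo-last s (f ∘ suc))) (sym (ℕₚ.+-assoc (f 0) _ _))

  sumTo-+ : ∀ s f g → sumTo s (λ l → f l + g l) ≡ sumTo s f + sumTo s g
  sumTo-+ zero    f g = refl
  sumTo-+ (suc s) f g = trans (cong (f 0 + g 0 +_) (sumTo-+ s (f ∘ suc) (g ∘ suc)))
    (solve 4 (λ a b c d → (a :+ b) :+ (c :+ d) := (a :+ c) :+ (b :+ d)) refl (f 0) (g 0) _ _)

  sumTo-* : ∀ s c f → sumTo s (λ l → c * f l) ≡ c * sumTo s f
  sumTo-* zero    c f = refl
  sumTo-* (suc s) c f = trans (cong (c * f 0 +_) (sumTo-* s c (f ∘ suc))) (sym (ℕₚ.*-distribˡ-+ c (f 0) _))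

  sumTo-zero : ∀ s {f} → (∀ l → l ≤ s → f l ≡ 0) → sumTo s f ≡ 0
  sumTo-zero zero    e = e 0 z≤n
  sumTo-zero (suc s) e = cong₂ _+_ (e 0 z≤n) (sumTo-zero s (λ l le → e (suc l) (s≤s le)))

  sumTo-comm : ∀ s t (f : ℕ → ℕ → ℕ) → sumTo s (λ l → sumTo t (f l)) ≡ sumTo t (λ m → sumTo s (λ l → f l m))
  sumTo-comm zero    t f = refl
  sumTo-comm (suc s) t f = trans (cong (sumTo t (f 0) +_) (sumTo-comm s t (f ∘ suc)))
    (sym (sumTo-+ t (f 0) (λ m → sumTo s (λ l → f (suc l) m))))

  -- The coefficient of x^l in (1 − x)^{−(m+1)}.
  multichoose : ℕ → ℕ → ℕ
  multichoose m l = binom (m + l) l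

  multichoose-0 : ∀ m → multichoose m 0 ≡ 1
  multichoose-0 m = binom-0 (m + 0)

  multichoose-suc : ∀ m l → multichoose (suc m) (suc l) ≡ multichoose m (suc l) + multichoose (suc m) l
  multichoose-suc m l = trans (pascal (m + suc l) l) (trans (ℕₚ.+-comm (binom (m + suc l) l) (binom (m + suc l) (suc l)))
    (cong (multichoose m (suc l) +_) (cong (λ x → binom x l) (ℕₚ.+-suc m l))))

  multichoose-sum : ∀ m s → sumTo s (multichoose m) ≡ multichoose (suc m) s
  multichoose-sum m zero    = trans (multichoose-0 m) (sym (multichoose-0 (suc m)))
  multichoose-sum m (suc s) = trans (sumTo-last s (multichoose m)) (trans (cong (_+ multichoose m (suc s)) (multichoose-sum m s))
    (trans (ℕₚ.+-comm (multichoose (suc m) s) (multichoose m (suc s))) (sym (multichoose-suc m s))))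

  -- Coefficients in 1/(1-x)^(m+1) · 1/(1-x)^(a+1) = 1/(1-x)^(m+a+2).
  convolution : ∀ m a s → sumTo s (λ l → multichoose m l * multichoose a (s ∸ l)) ≡ multichoose (suc (m + a)) s
  convolution zero a s = begin
    sumTo s (λ l → multichoose 0 l * multichoose a (s ∸ l)) ≡⟨ sumTo-cong s (λ l _ → trans (cong (_* multichoose a (s ∸ l)) (binom-self l)) (ℕₚ.*-identityˡ _)) ⟩
    sumTo s (λ l → multichoose a (s ∸ l)) ≡⟨ reversed s ⟩
    sumTo s (multichoose a) ≡⟨ multichoose-sum a s ⟩
    multichoose (suc a) s ∎
    where
    open ≡.≡-Reasoning
    reversed : ∀ s → sumTo s (λ l → multichoose a (s ∸ l)) ≡ sumTo s (multichoose a)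
    reversed zero    = refl
    reversed (suc s) = trans (cong (multichoose a (suc s) +_) (reversed s)) (trans (ℕₚ.+-comm (multichoose a (suc s)) _) (sym (sumTo-last s (multichoose a))))
  convolution (suc m) a zero = trans (cong₂ _*_ (multichoose-0 (suc m)) (multichoose-0 a)) (sym (multichoose-0 (suc (suc m + a))))
  convolution (suc m) a (suc s) = begin
    multichoose (suc m) 0 * multichoose a (suc s) + sumTo s (λ l → multichoose (suc m) (suc l) * multichoose a (s ∸ l))
      ≡⟨ cong₂ _+_ (cong (_* multichoose a (suc s)) (trans (multichoose-0 (suc m)) (sym (multichoose-0 m))))
           (trans (sumTo-cong s (λ l _ → trans (cong (_* multichoose a (s ∸ l)) (multichoose-suc m l)) (ℕₚ.*-distribʳ-+ (multichoose a (s ∸ l)) (multichoose m (suc l)) (multichoose (suc m) l))))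
             (sumTo-+ s _ _)) ⟩
    multichoose m 0 * multichoose a (suc s) + (sumTo s (λ l → multichoose m (suc l) * multichoose a (s ∸ l)) + sumTo s (λ l → multichoose (suc m) l * multichoose a (s ∸ l)))
      ≡⟨ sym (ℕₚ.+-assoc (multichoose m 0 * multichoose a (suc s)) _ _) ⟩
    sumTo (suc s) (λ l → multichoose m l * multichoose a (suc s ∸ l)) + sumTo s (λ l → multichoose (suc m) l * multichoose a (s ∸ l))
      ≡⟨ cong₂ _+_ (convolution m a (suc s)) (convolution (suc m) a s) ⟩
    multichoose (suc (m + a)) (suc s) + multichoose (suc (suc m + a)) s ≡⟨ sym (multichoose-suc (suc (m + a)) s) ⟩
    multichoose (suc (suc m + a)) (suc s) ∎
    where open ≡.≡-Reasoning

  𝟙 : Bool → ℕ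
  𝟙 true  = 1
  𝟙 false = 0

  𝟙-∧ : ∀ a b → 𝟙 (a ∧ b) ≡ 𝟙 a * 𝟙 b
  𝟙-∧ true  b = sym (ℕₚ.*-identityˡ (𝟙 b))
  𝟙-∧ false b = refl

  sumL : ∀ {A : Set} → List A → (A → ℕ) → ℕ
  sumL []       f = 0
  sumL (x ∷ xs) f = f x + sumL xs f

  sumL-cong : ∀ {A : Set} (xs : List A) {f g : A → ℕ} → (∀ x → f x ≡ g x) → sumL xs f ≡ sumL xs g
  sumL-cong []       e = refl
  sumL-cong (x ∷ xs) e = cong₂ _+_ (e x) (sumL-cong xs e)

  sumL-zero : ∀ {A : Set} (xs : List A) {f : A → ℕ} → (∀ x → f x ≡ 0) → sumL xs f ≡ 0
  sumL-zero []       e = refl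
  sumL-zero (x ∷ xs) e = cong₂ _+_ (e x) (sumL-zero xs e)

  sumL-++ : ∀ {A : Set} (xs ys : List A) (f : A → ℕ) → sumL (xs ++ ys) f ≡ sumL xs f + sumL ys f
  sumL-++ []       ys f = refl
  sumL-++ (x ∷ xs) ys f = trans (cong (f x +_) (sumL-++ xs ys f)) (sym (ℕₚ.+-assoc (f x) _ _))

  sumL-map : ∀ {A B : Set} (g : A → B) xs (f : B → ℕ) → sumL (map g xs) f ≡ sumL xs (f ∘ g)
  sumL-map g []       f = refl
  sumL-map g (x ∷ xs) f = cong (f (g x) +_) (sumL-map g xs f)

  sumL-+ : ∀ {A : Set} (xs : List A) (f g : A → ℕ) → sumL xs (λ x → f x + g x) ≡ sumL xs f + sumL xs g
  sumL-+ []       f g = refl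
  sumL-+ (x ∷ xs) f g = trans (cong (f x + g x +_) (sumL-+ xs f g))
    (solve 4 (λ a b c d → (a :+ b) :+ (c :+ d) := (a :+ c) :+ (b :+ d)) refl (f x) (g x) _ _)

  length-filter : ∀ {A : Set} {P : A → Set} (P? : ∀ x → Dec (P x)) xs → length (filter P? xs) ≡ sumL xs (λ x → 𝟙 (does (P? x)))
  length-filter P? [] = refl
  length-filter P? (x ∷ xs) with does (P? x)
  ... | true  = cong suc (length-filter P? xs)
  ... | false = length-filter P? xs

  sumF : ∀ {N} → (Fin N → ℕ) → ℕ
  sumF {zero}  f = 0
  sumF {suc N} f = f zero + sumF (f ∘ suc)

  sumF-cong : ∀ {N} {f g : Fin N → ℕ} → (∀ i → f i ≡ g i) → sumF f ≡ sumF g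
  sumF-cong {zero}  e = refl
  sumF-cong {suc N} e = cong₂ _+_ (e zero) (sumF-cong (e ∘ suc))

  sumF-* : ∀ {N} (f : Fin N → ℕ) c → sumF (λ i → f i * c) ≡ sumF f * c
  sumF-* {zero}  f c = refl
  sumF-* {suc N} f c = trans (cong (f zero * c +_) (sumF-* (f ∘ suc) c)) (sym (ℕₚ.*-distribʳ-+ c (f zero) _))

  sumL-sumF : ∀ {A : Set} {N} (xs : List A) (f : A → Fin N → ℕ) → sumL xs (λ x → sumF (f x)) ≡ sumF (λ i → sumL xs (λ x → f x i))
  sumL-sumF {N = zero}  xs f = sumL-zero xs (λ _ → refl)
  sumL-sumF {N = suc N} xs f = trans (sumL-+ xs (λ x → f x zero) _) (cong (sumL xs (λ x → f x zero) +_) (sumL-sumF xs (λ x → f x ∘ suc)))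

  sumTo-sumF : ∀ {N} s (f : ℕ → Fin N → ℕ) → sumTo s (λ l → sumF (f l)) ≡ sumF (λ i → sumTo s (λ l → f l i))
  sumTo-sumF {zero}  s f = sumTo-zero s (λ _ _ → refl)
  sumTo-sumF {suc N} s f = trans (sumTo-+ s (λ l → f l zero) _) (cong (sumTo s (λ l → f l zero) +_) (sumTo-sumF s (λ l → f l ∘ suc)))

  sumF-zero : ∀ {N} {f : Fin N → ℕ} → (∀ i → f i ≡ 0) → sumF f ≡ 0
  sumF-zero {zero}  e = refl
  sumF-zero {suc N} e = cong₂ _+_ (e zero) (sumF-zero (e ∘ suc))

  sumF-single : ∀ {N} (f : Fin N → ℕ) i → (∀ j → j ≢ i → f j ≡ 0) → sumF f ≡ f i
  sumF-single f zero    e = trans (cong (f zero +_) (sumF-zero (λ j → e (suc j) λ ()))) (ℕₚ.+-identityʳ (f zero))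
  sumF-single f (suc i) e = cong₂ _+_ (e zero λ ()) (sumF-single (f ∘ suc) i (λ j ne → e (suc j) (ne ∘ Finₚ.suc-injective)))

  ∣∣-sumF : ∀ {N} (b : Fin N → Bool) → ∣ Vec.tabulate b ∣ ≡ sumF (λ i → 𝟙 (b i))
  ∣∣-sumF {zero}  b = refl
  ∣∣-sumF {suc N} b with b zero
  ... | true  = cong suc (∣∣-sumF (b ∘ suc))
  ... | false = ∣∣-sumF (b ∘ suc)

  sumTo-single : ∀ s f k → k ≤ s → (∀ l → l ≤ s → l ≢ k → f l ≡ 0) → sumTo s f ≡ f k
  sumTo-single zero    f zero    z≤n e = refl
  sumTo-single (suc s) f zero    le  e = trans (cong (f 0 +_) (sumTo-zero s (λ l l≤ → e (suc l) (s≤s l≤) λ ()))) (ℕₚ.+-identityʳ (f 0))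
  sumTo-single (suc s) f (suc k) (s≤s le) e = cong₂ _+_ (e 0 z≤n λ ()) (sumTo-single s (f ∘ suc) k le (λ l l≤ ne → e (suc l) (s≤s l≤) (ne ∘ ℕₚ.suc-injective)))

  infix 4 _⊑ᵇ_
  _⊑ᵇ_ : ∀ {n} → Subset n → Subset n → Bool
  []      ⊑ᵇ []      = true
  (a ∷ A) ⊑ᵇ (b ∷ B) = (not a ∨ b) ∧ (A ⊑ᵇ B)

  ⊑ᵇ-sound : ∀ {n} (A B : Subset n) → (A ⊑ᵇ B) ≡ true → A ⊑ B
  ⊑ᵇ-sound (true ∷ A)  (true ∷ B) e zero    _ = refl
  ⊑ᵇ-sound (true ∷ A)  (true ∷ B) e (suc i) m = ⊑ᵇ-sound A B e i m
  ⊑ᵇ-sound (false ∷ A) (b ∷ B)    e (suc i) m = ⊑ᵇ-sound A B e i m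

  ⊑ᵇ-complete : ∀ {n} (A B : Subset n) → A ⊑ B → (A ⊑ᵇ B) ≡ true
  ⊑ᵇ-complete [] [] s = refl
  ⊑ᵇ-complete (true ∷ A)  (true ∷ B)  s = ⊑ᵇ-complete A B (s ∘ suc)
  ⊑ᵇ-complete (true ∷ A)  (false ∷ B) s with s zero refl
  ... | ()
  ⊑ᵇ-complete (false ∷ A) (b ∷ B)     s = ⊑ᵇ-complete A B (s ∘ suc)

  ≡ᵇ-sound : ∀ a b → (a ≡ᵇ b) ≡ true → a ≡ b
  ≡ᵇ-sound zero    zero    _ = refl
  ≡ᵇ-sound (suc a) (suc b) e = cong suc (≡ᵇ-sound a b e)

  ≡ᵇ-refl : ∀ a → (a ≡ᵇ a) ≡ true
  ≡ᵇ-refl zero    = refl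
  ≡ᵇ-refl (suc a) = ≡ᵇ-refl a

  between : ∀ {n} → Subset n → Subset n → Subset n → Bool
  between A B F = (A ⊑ᵇ F) ∧ (F ⊑ᵇ B)

  -- The condition ∣F∣ + t = ∣B∣ says that F omits t elements of B.
  omitting : ∀ {n} → Subset n → Subset n → ℕ → ℕ
  omitting {n} A B t = sumL (subsets n) (λ F → 𝟙 (between A B F) * 𝟙 (∣ F ∣ + t ≡ᵇ ∣ B ∣))

  sum-subsets : ∀ n (f : Subset (suc n) → ℕ) → sumL (subsets (suc n)) f ≡ sumL (subsets n) (f ∘ (true ∷_)) + sumL (subsets n) (f ∘ (false ∷_))
  sum-subsets n f = trans (sumL-++ (map (true ∷_) (subsets n)) _ f) (cong₂ _+_ (sumL-map (true ∷_) (subsets n) f) (sumL-map (false ∷_) (subsets n) f))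

  omitting≡binom : ∀ {n} (A B : Subset n) m t → A ⊑ B → ∣ A ∣ + m ≡ ∣ B ∣ → omitting A B t ≡ binom m t
  omitting≡binom [] [] zero zero s e = sym (binom-0 0)
  omitting≡binom [] [] zero (suc t) s e = sym (binom-> (s≤s z≤n))
  omitting≡binom (true ∷ A) (false ∷ B) m t s e with s zero refl
  ... | ()
  omitting≡binom {suc n} (true ∷ A) (true ∷ B) m t s e = trans (sum-subsets n _)
    (trans (cong₂ _+_ (omitting≡binom A B m t (s ∘ suc) (ℕₚ.suc-injective e)) (sumL-zero (subsets n) (λ _ → refl))) (ℕₚ.+-identityʳ _))
  omitting≡binom {suc n} (false ∷ A) (false ∷ B) m t s e = trans (sum-subsets n _)
    (cong₂ _+_ (sumL-zero (subsets n) (λ F → cong (λ b → 𝟙 b * 𝟙 (suc ∣ F ∣ + t ≡ᵇ ∣ B ∣)) (Boolₚ.∧-zeroʳ (A ⊑ᵇ F)))) (omitting≡binom A B m t (s ∘ suc) e))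
  omitting≡binom {suc n} (false ∷ A) (true ∷ B) zero t s e = ⊥-elim (ℕₚ.<-irrefl (trans (sym (ℕₚ.+-identityʳ ∣ A ∣)) e) (s≤s (⊑⇒∣∣≤ A B (s ∘ suc))))
  omitting≡binom {suc n} (false ∷ A) (true ∷ B) (suc m) zero s e = trans (sum-subsets n _)
    (trans (cong₂ _+_ (omitting≡binom A B m 0 (s ∘ suc) e′) (sumL-zero (subsets n) none)) (trans (ℕₚ.+-identityʳ (binom m 0)) (trans (binom-0 m) (sym (binom-0 (suc m))))))
    where
    e′ : ∣ A ∣ + m ≡ ∣ B ∣
    e′ = ℕₚ.suc-injective (trans (sym (ℕₚ.+-suc ∣ A ∣ m)) e)
    none : ∀ F → 𝟙 (between A B F) * 𝟙 (∣ F ∣ + 0 ≡ᵇ suc ∣ B ∣) ≡ 0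
    none F with between A B F in eq | (∣ F ∣ + 0 ≡ᵇ suc ∣ B ∣) in eq′
    ... | false | _     = refl
    ... | true  | false = refl
    ... | true  | true  = ⊥-elim (ℕₚ.<-irrefl (trans (sym (ℕₚ.+-identityʳ ∣ F ∣)) (≡ᵇ-sound (∣ F ∣ + 0) (suc ∣ B ∣) eq′))
        (s≤s (⊑⇒∣∣≤ F B (⊑ᵇ-sound F B (second (A ⊑ᵇ F) (F ⊑ᵇ B) eq)))))
      where
      second : ∀ a b → (a ∧ b) ≡ true → b ≡ true
      second true true _ = refl
  omitting≡binom {suc n} (false ∷ A) (true ∷ B) (suc m) (suc t) s e = trans (sum-subsets n _)
    (trans (cong₂ _+_ (omitting≡binom A B m (suc t) (s ∘ suc) e′)
        (trans (sumL-cong (subsets n) (λ F → cong (λ x → 𝟙 (between A B F) * 𝟙 (x ≡ᵇ suc ∣ B ∣)) (ℕₚ.+-suc ∣ F ∣ t))) (omitting≡binom A B m t (s ∘ suc) e′)))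
      (trans (ℕₚ.+-comm (binom m (suc t)) (binom m t)) (sym (pascal m t))))
    where
    e′ : ∣ A ∣ + m ≡ ∣ B ∣
    e′ = ℕₚ.suc-injective (trans (sym (ℕₚ.+-suc ∣ A ∣ m)) e)

  module FaceNumbers {d n} (shelling : Shelling d n) where
    open Shelling shelling

    face? : ∀ F → Dec (∃ λ σ → F ⊑ facet σ)
    face? F = Finₚ.any? (λ σ → F ⊑? facet σ)

    faceCount : ℕ → ℕ
    faceCount t = sumL (subsets n) (λ F → 𝟙 (does (face? F)) * 𝟙 (∣ F ∣ + t ≡ᵇ d))

    private
      ∧-true : ∀ a b → (a ∧ b) ≡ true → a ≡ true × b ≡ true
      ∧-true true true _ = refl , refl

    intervals-disjoint : ∀ F σ τ → R σ ⊑ F → F ⊑ facet σ → R τ ⊑ F → F ⊑ facet τ → σ ≡ τ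
    intervals-disjoint F σ τ rσ fσ rτ fτ with R-order σ τ (λ i m → fτ i (rσ i m)) | R-order τ σ (λ i m → fσ i (rτ i m))
    ... | inj₁ e | _ = e
    ... | inj₂ _ | inj₁ e = sym e
    ... | inj₂ lt | inj₂ lt′ = ⊥-elim (ℕₚ.<-asym lt lt′)

    intervals-partition : ∀ F → sumF (λ σ → 𝟙 (between (R σ) (facet σ) F)) ≡ 𝟙 (does (face? F))
    intervals-partition F = go (face? F)
      where
      in-interval : ∀ σ → between (R σ) (facet σ) F ≡ true → R σ ⊑ F × F ⊑ facet σ
      in-interval σ e with ∧-true (R σ ⊑ᵇ F) (F ⊑ᵇ facet σ) e
      ... | a , b = ⊑ᵇ-sound (R σ) F a , ⊑ᵇ-sound F (facet σ) b
      go : (d : Dec (∃ λ σ → F ⊑ facet σ)) → sumF (λ σ → 𝟙 (between (R σ) (facet σ) F)) ≡ 𝟙 (does d)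
      go (no none) = sumF-zero (λ σ → cong 𝟙 (Boolₚ.¬-not (λ e → none (σ , proj₂ (in-interval σ e)))))
      go (yes (τ , s)) with R-covers F τ s
      ... | σ , lower , upper = trans (sumF-single (λ σ → 𝟙 (between (R σ) (facet σ) F)) σ (λ ρ ne → cong 𝟙 (Boolₚ.¬-not (λ e →
          ne (intervals-disjoint F ρ σ (proj₁ (in-interval ρ e)) (proj₂ (in-interval ρ e)) lower upper)))))
        (cong 𝟙 (cong₂ _∧_ (⊑ᵇ-complete (R σ) F lower) (⊑ᵇ-complete F (facet σ) upper)))

    -- Every face lies in exactly one interval from R σ to σ, and a face of size d - t in that
    -- interval arises by omitting t elements of S σ.
    faceCount≡ : ∀ t → faceCount t ≡ sumF (λ σ → binom ∣ S σ ∣ t)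
    faceCount≡ t = begin
      sumL (subsets n) (λ F → 𝟙 (does (face? F)) * 𝟙 (∣ F ∣ + t ≡ᵇ d))
        ≡⟨ sumL-cong (subsets n) (λ F → trans (cong (_* 𝟙 (∣ F ∣ + t ≡ᵇ d)) (sym (intervals-partition F))) (sym (sumF-* (λ σ → 𝟙 (between (R σ) (facet σ) F)) (𝟙 (∣ F ∣ + t ≡ᵇ d))))) ⟩
      sumL (subsets n) (λ F → sumF (λ σ → 𝟙 (between (R σ) (facet σ) F) * 𝟙 (∣ F ∣ + t ≡ᵇ d))) ≡⟨ sumL-sumF (subsets n) (λ F σ → 𝟙 (between (R σ) (facet σ) F) * 𝟙 (∣ F ∣ + t ≡ᵇ d)) ⟩
      sumF (λ σ → sumL (subsets n) (λ F → 𝟙 (between (R σ) (facet σ) F) * 𝟙 (∣ F ∣ + t ≡ᵇ d)))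
        ≡⟨ sumF-cong (λ σ → trans (sumL-cong (subsets n) (λ F → cong (λ x → 𝟙 (between (R σ) (facet σ) F) * 𝟙 (∣ F ∣ + t ≡ᵇ x)) (sym (facet-size σ))))
             (omitting≡binom (R σ) (facet σ) ∣ S σ ∣ t (R⊑ σ) (trans (R+S σ) (sym (facet-size σ))))) ⟩
      sumF (λ σ → binom ∣ S σ ∣ t) ∎
      where open ≡.≡-Reasoning

    R≤d : ∀ σ → ∣ R σ ∣ ≤ d
    R≤d σ = subst (∣ R σ ∣ ≤_) (R+S σ) (ℕₚ.m≤m+n ∣ R σ ∣ ∣ S σ ∣)

    by-level : ∀ (f : ℕ → ℕ) → sumF (λ σ → f ∣ R σ ∣) ≡ sumTo d (λ l → ∣ level l ∣ * f l)
    by-level f = sym (begin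
      sumTo d (λ l → ∣ level l ∣ * f l) ≡⟨ sumTo-cong d (λ l _ → trans (cong (_* f l) (∣∣-sumF (λ σ → does (∣ R σ ∣ ℕ.≟ l)))) (sym (sumF-* (λ σ → 𝟙 (does (∣ R σ ∣ ℕ.≟ l))) (f l)))) ⟩
      sumTo d (λ l → sumF (λ σ → 𝟙 (does (∣ R σ ∣ ℕ.≟ l)) * f l)) ≡⟨ sumTo-sumF d (λ l σ → 𝟙 (does (∣ R σ ∣ ℕ.≟ l)) * f l) ⟩
      sumF (λ σ → sumTo d (λ l → 𝟙 (does (∣ R σ ∣ ℕ.≟ l)) * f l)) ≡⟨ sumF-cong (λ σ → trans
          (sumTo-single d (λ l → 𝟙 (does (∣ R σ ∣ ℕ.≟ l)) * f l) ∣ R σ ∣ (R≤d σ) (λ l _ ne → cong (λ b → 𝟙 b * f l) (dec-false (∣ R σ ∣ ℕ.≟ l) (ne ∘ sym))))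
          (trans (cong (λ b → 𝟙 b * f ∣ R σ ∣) (dec-true (∣ R σ ∣ ℕ.≟ ∣ R σ ∣) refl)) (ℕₚ.*-identityˡ _))) ⟩
      sumF (λ σ → f ∣ R σ ∣) ∎)
      where open ≡.≡-Reasoning

    module _ (M k : ℕ) (n≡ : n ≡ suc d + M) (k≤d : k ≤ d)
      (neighborly : ∀ F → ∣ F ∣ ≤ k → ∃ λ σ → F ⊑ facet σ) where

      -- All s-subsets of the n vertices are faces, so counting faces of size s gives Σ_l h_l C(d-l,
      -- d-s) = C(n, s). Terms with l > s vanish, and the binomials are rewritten to match
      -- `convolution`.
      h-equation : ∀ s → s ≤ k → sumTo s (λ l → ∣ level l ∣ * multichoose (d ∸ s) (s ∸ l)) ≡ multichoose (suc (M + (d ∸ s))) s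
      h-equation s s≤k = begin
        sumTo s (λ l → ∣ level l ∣ * multichoose (d ∸ s) (s ∸ l)) ≡⟨ sumTo-cong s (λ l l≤s → cong (∣ level l ∣ *_) (sym (flip l l≤s))) ⟩
        sumTo s (λ l → ∣ level l ∣ * binom (d ∸ l) (d ∸ s)) ≡⟨ sym (truncate d s s≤d) ⟩
        sumTo d (λ l → ∣ level l ∣ * binom (d ∸ l) (d ∸ s)) ≡⟨ sym (by-level (λ l → binom (d ∸ l) (d ∸ s))) ⟩
        sumF (λ σ → binom (d ∸ ∣ R σ ∣) (d ∸ s)) ≡⟨ sumF-cong (λ σ → cong (λ x → binom x (d ∸ s)) (trans (cong (_∸ ∣ R σ ∣) (sym (R+S σ))) (ℕₚ.m+n∸m≡n ∣ R σ ∣ ∣ S σ ∣))) ⟩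
        sumF (λ σ → binom ∣ S σ ∣ (d ∸ s)) ≡⟨ sym (faceCount≡ (d ∸ s)) ⟩
        faceCount (d ∸ s) ≡⟨ sumL-cong (subsets n) all-faces ⟩
        sumL (subsets n) (λ F → 𝟙 (between ⊥ ⊤ F) * 𝟙 (∣ F ∣ + (n ∸ s) ≡ᵇ ∣ ⊤ {n} ∣))
          ≡⟨ omitting≡binom {n} ⊥ ⊤ n (n ∸ s) (λ i _ → Vecₚ.lookup-replicate i true) (trans (cong (_+ n) (Subsetₚ.∣⊥∣≡0 n)) (sym (Subsetₚ.∣⊤∣≡n n))) ⟩
        binom n (n ∸ s) ≡⟨ sym (binom-sym s≤n) ⟩
        binom n s ≡⟨ cong (λ x → binom x s) total ⟩
        multichoose (suc (M + (d ∸ s))) s ∎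
        where
        open ≡.≡-Reasoning
        s≤d : s ≤ d
        s≤d = ℕₚ.≤-trans s≤k k≤d
        s≤n : s ≤ n
        s≤n = subst (s ≤_) (sym n≡) (ℕₚ.≤-trans s≤d (ℕₚ.≤-trans (ℕₚ.n≤1+n d) (ℕₚ.m≤m+n (suc d) M)))
        total : n ≡ suc (M + (d ∸ s)) + s
        total = trans n≡ (cong suc (trans (ℕₚ.+-comm d M) (trans (cong (M +_) (sym (ℕₚ.m∸n+n≡m s≤d))) (sym (ℕₚ.+-assoc M (d ∸ s) s)))))
        flip : ∀ l → l ≤ s → binom (d ∸ l) (d ∸ s) ≡ multichoose (d ∸ s) (s ∸ l)
        flip l l≤s = trans (binom-sym (ℕₚ.∸-monoʳ-≤ d l≤s)) (cong₂ binom (sym split)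
            (trans (cong (_∸ (d ∸ s)) (sym split)) (ℕₚ.m+n∸m≡n (d ∸ s) (s ∸ l))))
          where
          split : (d ∸ s) + (s ∸ l) ≡ d ∸ l
          split = trans (sym (ℕₚ.+-∸-assoc (d ∸ s) l≤s)) (cong (_∸ l) (ℕₚ.m∸n+n≡m s≤d))
        truncate : ∀ e s → s ≤ e → sumTo e (λ l → ∣ level l ∣ * binom (e ∸ l) (e ∸ s)) ≡ sumTo s (λ l → ∣ level l ∣ * binom (e ∸ l) (e ∸ s))
        truncate e s s≤e = drop e s (λ l → ∣ level l ∣ * binom (e ∸ l) (e ∸ s)) s≤e (λ l s<l l≤e → trans (cong (∣ level l ∣ *_) (binom-> (ℕₚ.∸-monoʳ-< s<l l≤e))) (ℕₚ.*-zeroʳ ∣ level l ∣))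
          where
          drop : ∀ e s f → s ≤ e → (∀ l → s < l → l ≤ e → f l ≡ 0) → sumTo e f ≡ sumTo s f
          drop zero    zero    f _ _ = refl
          drop (suc e) zero    f _ z = trans (cong (f 0 +_) (sumTo-zero e (λ l l≤ → z (suc l) (s≤s z≤n) (s≤s l≤)))) (ℕₚ.+-identityʳ (f 0))
          drop (suc e) (suc s) f (s≤s le) z = cong (f 0 +_) (drop e s (f ∘ suc) le (λ l lt l≤ → z (suc l) (s≤s lt) (s≤s l≤)))
        all-faces : ∀ F → 𝟙 (does (face? F)) * 𝟙 (∣ F ∣ + (d ∸ s) ≡ᵇ d) ≡ 𝟙 (between ⊥ ⊤ F) * 𝟙 (∣ F ∣ + (n ∸ s) ≡ᵇ ∣ ⊤ {n} ∣)
        all-faces F = trans (compare (∣ F ∣ ℕ.≟ s)) (sym (trans (cong (λ b → 𝟙 b * 𝟙 (∣ F ∣ + (n ∸ s) ≡ᵇ ∣ ⊤ {n} ∣)) full)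
            (trans (ℕₚ.*-identityˡ _) (cong (λ x → 𝟙 (∣ F ∣ + (n ∸ s) ≡ᵇ x)) (Subsetₚ.∣⊤∣≡n n)))))
          where
          full : between ⊥ ⊤ F ≡ true
          full = cong₂ _∧_ (⊑ᵇ-complete ⊥ F (λ i e → ⊥-elim (true≢false (trans (sym e) (Vecₚ.lookup-replicate i false)))))
            (⊑ᵇ-complete F ⊤ (λ i _ → Vecₚ.lookup-replicate i true))
          sizes : ∀ x e → s ≤ e → x ≡ s → (x + (e ∸ s) ≡ᵇ e) ≡ true
          sizes x e s≤e refl = trans (cong (_≡ᵇ e) (ℕₚ.m+[n∸m]≡n s≤e)) (≡ᵇ-refl e)
          sizes-≢ : ∀ x e → s ≤ e → x ≢ s → (x + (e ∸ s) ≡ᵇ e) ≡ false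
          sizes-≢ x e s≤e ne = Boolₚ.¬-not (λ eq → ne (ℕₚ.+-cancelʳ-≡ (e ∸ s) x s (trans (≡ᵇ-sound (x + (e ∸ s)) e eq) (sym (ℕₚ.m+[n∸m]≡n s≤e)))))
          compare : Dec (∣ F ∣ ≡ s) → 𝟙 (does (face? F)) * 𝟙 (∣ F ∣ + (d ∸ s) ≡ᵇ d) ≡ 𝟙 (∣ F ∣ + (n ∸ s) ≡ᵇ n)
          compare (yes e) = trans (cong₂ (λ a b → 𝟙 a * 𝟙 b) (dec-true (face? F) (neighborly F (subst (_≤ k) (sym e) s≤k))) (sizes ∣ F ∣ d s≤d e))
            (cong 𝟙 (sym (sizes ∣ F ∣ n s≤n e)))
          compare (no ne) = trans (cong (λ b → 𝟙 (does (face? F)) * 𝟙 b) (sizes-≢ ∣ F ∣ d s≤d ne)) (trans (ℕₚ.*-zeroʳ (𝟙 (does (face? F)))) (cong 𝟙 (sym (sizes-≢ ∣ F ∣ n s≤n ne))))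

      -- The equations are triangular in s with diagonal entries 1, and by `convolution` the numbers
      -- `multichoose M s` solve them too.
      h≡multichoose : ∀ s → s ≤ k → ∣ level s ∣ ≡ multichoose M s
      h≡multichoose s = strong (suc s) s (ℕₚ.n<1+n s)
        where
        open ≡.≡-Reasoning
        last-term : ∀ s (h : ℕ → ℕ) → h s * multichoose (d ∸ s) (s ∸ s) ≡ h s
        last-term s h = trans (cong (λ x → h s * multichoose (d ∸ s) x) (ℕₚ.n∸n≡0 s)) (trans (cong (h s *_) (multichoose-0 (d ∸ s))) (ℕₚ.*-identityʳ (h s)))
        below : ∀ s → (ℕ → ℕ) → ℕ
        below zero    f = 0
        below (suc s) f = sumTo s f
        split : ∀ s f → sumTo s f ≡ below s f + f s
        split zero    f = refl
        split (suc s) f = sumTo-last s f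
        below-cong : ∀ s {f g} → (∀ l → l < s → f l ≡ g l) → below s f ≡ below s g
        below-cong zero    e = refl
        below-cong (suc s) e = sumTo-cong s (λ l le → e l (s≤s le))
        strong : ∀ fuel s → s < fuel → s ≤ k → ∣ level s ∣ ≡ multichoose M s
        strong (suc fuel) s (s≤s s≤fuel) s≤k = ℕₚ.+-cancelˡ-≡ (below s (term (multichoose M))) ∣ level s ∣ (multichoose M s) (begin
          below s (term (multichoose M)) + ∣ level s ∣
            ≡⟨ cong₂ _+_ (below-cong s (λ l l<s → cong (_* multichoose (d ∸ s) (s ∸ l)) (sym (strong fuel l (ℕₚ.<-≤-trans l<s s≤fuel) (ℕₚ.≤-trans (ℕₚ.<⇒≤ l<s) s≤k)))))
                 (sym (last-term s (λ l → ∣ level l ∣))) ⟩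
          below s (term (λ l → ∣ level l ∣)) + term (λ l → ∣ level l ∣) s ≡⟨ sym (split s (term (λ l → ∣ level l ∣))) ⟩
          sumTo s (term (λ l → ∣ level l ∣)) ≡⟨ h-equation s s≤k ⟩
          multichoose (suc (M + (d ∸ s))) s ≡⟨ sym (convolution M (d ∸ s) s) ⟩
          sumTo s (term (multichoose M)) ≡⟨ split s (term (multichoose M)) ⟩
          below s (term (multichoose M)) + term (multichoose M) s ≡⟨ cong (below s (term (multichoose M)) +_) (last-term s (multichoose M)) ⟩
          below s (term (multichoose M)) + multichoose M s ∎)
          where
          term : (ℕ → ℕ) → ℕ → ℕ
          term h l = h l * multichoose (d ∸ s) (s ∸ l)

open FaceCounts

-- From monotone h-numbers to the coefficients of the bound

module NumericalBounds where
  open import Data.Fin.Subset using (∣_∣)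
  open import Data.Nat as ℕ using (ℕ; zero; suc; s≤s; z≤n; _∸_; _+_; _*_; _≤_; _⊓_)
  open import Data.Nat.Solver using (module +-*-Solver)
  open import Relation.Binary.PropositionalEquality using (_≡_; refl; sym; trans; cong; cong₂; subst)

  open +-*-Solver using (solve; _:=_; _:*_)

  le : ℕ → ℕ → Bool
  le zero    _       = true
  le (suc i) zero    = false
  le (suc i) (suc e) = le i e

  le-complete : ∀ {i e} → i ≤ e → le i e ≡ true
  le-complete z≤n     = refl
  le-complete (s≤s h) = le-complete h

  below : ℕ → (ℕ → ℕ) → ℕ
  below zero    f = 0
  below (suc i) f = f 0 + below i (f ∘ suc)

  below-last : ∀ i f → below (suc i) f ≡ below i f + f i
  below-last zero    f = ℕₚ.+-identityʳ (f 0)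
  below-last (suc i) f = trans (cong (f 0 +_) (below-last i (f ∘ suc))) (sym (ℕₚ.+-assoc (f 0) (below i (f ∘ suc)) (f (suc i))))

  below-binom : ∀ i t → below i (λ e → binom e t) ≡ binom i (suc t)
  below-binom zero    t = sym (binom-> (s≤s z≤n))
  below-binom (suc i) t = trans (below-last i (λ e → binom e t)) (trans (cong (_+ binom i t) (below-binom i t))
    (trans (ℕₚ.+-comm (binom i (suc t)) (binom i t)) (sym (pascal i t))))

  sumTo≡below : ∀ s f → sumTo s f ≡ below (suc s) f
  sumTo≡below zero    f = sym (ℕₚ.+-identityʳ (f 0))
  sumTo≡below (suc s) f = cong (f 0 +_) (sumTo≡below s (f ∘ suc))

  sumTo-split : ∀ i x f → sumTo x f ≤ below i f + sumTo x (λ e → 𝟙 (le i e) * f e)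
  sumTo-split zero    x       f = ℕₚ.≤-reflexive (sumTo-cong x (λ e _ → sym (ℕₚ.*-identityˡ (f e))))
  sumTo-split (suc i) zero    f = ℕₚ.≤-trans (ℕₚ.m≤m+n (f 0) (below i (f ∘ suc))) (ℕₚ.m≤m+n (f 0 + below i (f ∘ suc)) 0)
  sumTo-split (suc i) (suc x) f = ℕₚ.≤-trans (ℕₚ.+-monoʳ-≤ (f 0) (sumTo-split i x (f ∘ suc)))
    (ℕₚ.≤-reflexive (sym (ℕₚ.+-assoc (f 0) (below i (f ∘ suc)) (sumTo x (λ e → 𝟙 (le i e) * f (suc e))))))

  sumTo-extend : ∀ {x d} f → x ≤ d → sumTo x f ≤ sumTo d f
  sumTo-extend {zero}  {zero}  f _ = ℕₚ.≤-refl
  sumTo-extend {zero}  {suc d} f _ = ℕₚ.m≤m+n (f 0) (sumTo d (f ∘ suc))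
  sumTo-extend {suc x} {suc d} f (s≤s h) = ℕₚ.+-monoʳ-≤ (f 0) (sumTo-extend (f ∘ suc) h)

  sumTo-cut : ∀ k e g → sumTo k (λ i → 𝟙 (le i e) * g i) ≤ sumTo (k ⊓ e) g
  sumTo-cut zero    e       g = ℕₚ.≤-reflexive (ℕₚ.*-identityˡ (g 0))
  sumTo-cut (suc k) zero    g = ℕₚ.≤-reflexive (trans (cong (1 * g 0 +_) (sumTo-zero k (λ _ _ → refl))) (trans (ℕₚ.+-identityʳ (1 * g 0)) (ℕₚ.*-identityˡ (g 0))))
  sumTo-cut (suc k) (suc e) g = ℕₚ.+-mono-≤ (ℕₚ.≤-reflexive (ℕₚ.*-identityˡ (g 0))) (sumTo-cut k e (g ∘ suc))

  -- For e ≤ d, the indicator of i ≤ e ≤ d - i: the positions at which the i-th difference of the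
  -- h-numbers counts.
  window : ℕ → ℕ → ℕ → ℕ
  window d i e = 𝟙 (le i e) * 𝟙 (le i (d ∸ e))

  windowed : ℕ → ℕ → ℕ → ℕ
  windowed d t i = sumTo d (λ e → window d i e * binom e t)

  -- The hockey-stick identity: C(e, t) summed over e ≤ d - i gives the left side, and its part with
  -- e < i gives C(i, t+1). Stated as an inequality it also covers windows that are empty.
  windowed-bound : ∀ d t i → i ≤ d → binom (suc d ∸ i) (suc t) ≤ binom i (suc t) + windowed d t i
  windowed-bound d t i i≤d = begin
    binom (suc d ∸ i) (suc t) ≡⟨ cong (λ x → binom x (suc t)) (ℕₚ.+-∸-assoc 1 i≤d) ⟩
    binom (suc (d ∸ i)) (suc t) ≡⟨ sym (below-binom (suc (d ∸ i)) t) ⟩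
    below (suc (d ∸ i)) b ≡⟨ sym (sumTo≡below (d ∸ i) b) ⟩
    sumTo (d ∸ i) b ≤⟨ sumTo-split i (d ∸ i) b ⟩
    below i b + sumTo (d ∸ i) (λ e → 𝟙 (le i e) * b e) ≤⟨ ℕₚ.+-mono-≤ (ℕₚ.≤-reflexive (below-binom i t))
        (ℕₚ.≤-trans (ℕₚ.≤-reflexive (sumTo-cong (d ∸ i) inWindow)) (sumTo-extend (λ e → window d i e * b e) (ℕₚ.m∸n≤m d i))) ⟩
    binom i (suc t) + windowed d t i ∎
    where
    open ℕₚ.≤-Reasoning
    b : ℕ → ℕ
    b e = binom e t
    inWindow : ∀ e → e ≤ d ∸ i → 𝟙 (le i e) * b e ≡ window d i e * b e
    inWindow e e≤ = cong (_* b e) (trans (sym (ℕₚ.*-identityʳ (𝟙 (le i e)))) (cong (λ c → 𝟙 (le i e) * 𝟙 c) (sym (le-complete i≤))))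
      where
      i≤ : i ≤ d ∸ e
      i≤ = subst (_≤ d ∸ e) (ℕₚ.m∸[m∸n]≡n i≤d) (ℕₚ.∸-monoʳ-≤ d e≤)

  module LowerBound {d′ n} (shelling : Shelling (suc d′) n) (M k : ℕ) (n≡ : n ≡ suc (suc d′) + suc M) (2k≤d : k + k ≤ suc d′)
    (neighborly : ∀ F → ∣ F ∣ ≤ k → ∃ λ σ → F ⊑ Shelling.facet shelling σ) where
    open Shelling shelling

    d : ℕ
    d = suc d′

    k≤d : k ≤ d
    k≤d = ℕₚ.≤-trans (ℕₚ.m≤m+n k k) 2k≤d

    increasing : ∀ a c → (a + c) + (a + c) ≤ d → ∣ level a ∣ ≤ ∣ level (a + c) ∣
    increasing a zero    _ = ℕₚ.≤-reflexive (cong (∣_∣ ∘ level) (sym (ℕₚ.+-identityʳ a)))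
    increasing a (suc c) h = ℕₚ.≤-trans (increasing a c (ℕₚ.m≤n⇒m≤1+n smaller))
      (subst (λ x → ∣ level (a + c) ∣ ≤ ∣ level x ∣) (sym (ℕₚ.+-suc a c)) (h-increasing shelling (a + c) smaller))
      where
      smaller : (a + c) + (a + c) ≤ d′
      smaller = ℕₚ.≤-trans (ℕₚ.+-monoʳ-≤ (a + c) (ℕₚ.n≤1+n (a + c))) (ℕₚ.≤-pred (subst (λ x → x + x ≤ d) (ℕₚ.+-suc a c) h))

    -- Up to k the h-numbers are known exactly; from min(k, e) on, monotonicity carries the value to
    -- e.
    h-lower : ∀ e → e + e ≤ d → multichoose (suc M) (k ⊓ e) ≤ ∣ level e ∣
    h-lower e 2e≤d = begin
      multichoose (suc M) (k ⊓ e) ≡⟨ sym (FaceNumbers.h≡multichoose shelling (suc M) k n≡ k≤d neighborly (k ⊓ e) (ℕₚ.m⊓n≤m k e)) ⟩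
      ∣ level (k ⊓ e) ∣ ≤⟨ increasing (k ⊓ e) (e ∸ k ⊓ e) (subst (λ x → x + x ≤ d) (sym restore) 2e≤d) ⟩
      ∣ level ((k ⊓ e) + (e ∸ k ⊓ e)) ∣ ≡⟨ cong (∣_∣ ∘ level) restore ⟩
      ∣ level e ∣ ∎
      where
      open ℕₚ.≤-Reasoning
      restore : (k ⊓ e) + (e ∸ k ⊓ e) ≡ e
      restore = ℕₚ.m+[n∸m]≡n (ℕₚ.m⊓n≤n k e)

  module FaceBound {d′ n} (shelling : Shelling (suc d′) n) (M k : ℕ) (n≡ : n ≡ suc (suc d′) + suc M) (2k≤d : k + k ≤ suc d′)
    (neighborly : ∀ F → ∣ F ∣ ≤ k → ∃ λ σ → F ⊑ Shelling.facet shelling σ) where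
    open Shelling shelling
    private
      module Rev = Shelling (reverse-shelling shelling)
      d = suc d′
      g = multichoose M

    reversed-level : ∀ e → e ≤ d → ∣ Rev.level e ∣ ≡ ∣ level (d ∸ e) ∣
    reversed-level e e≤d = cong ∣_∣ (Vecₚ.tabulate-cong same)
      where
      same : ∀ σ → does (∣ S σ ∣ ℕ.≟ e) ≡ does (∣ R σ ∣ ℕ.≟ d ∸ e)
      same σ = go (∣ S σ ∣ ℕ.≟ e)
        where
        go : (x : Dec (∣ S σ ∣ ≡ e)) → does x ≡ does (∣ R σ ∣ ℕ.≟ d ∸ e)
        go (yes eq) = sym (dec-true (∣ R σ ∣ ℕ.≟ d ∸ e) (trans (sym (ℕₚ.m+n∸n≡m ∣ R σ ∣ ∣ S σ ∣)) (cong₂ _∸_ (R+S σ) eq)))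
        go (no ne) = sym (dec-false (∣ R σ ∣ ℕ.≟ d ∸ e) (λ eq → ne (trans (sym (ℕₚ.m+n∸m≡n ∣ R σ ∣ ∣ S σ ∣))
          (trans (cong₂ _∸_ (R+S σ) eq) (ℕₚ.m∸[m∸n]≡n e≤d)))))

    -- The numbers `g i` are the successive differences of `multichoose (suc M)`, so the sum
    -- telescopes.
    truncated : ∀ e → sumTo k (λ i → 𝟙 (le i e) * g i) ≤ multichoose (suc M) (k ⊓ e)
    truncated e = ℕₚ.≤-trans (sumTo-cut k e g) (ℕₚ.≤-reflexive (multichoose-sum M (k ⊓ e)))

    𝟙≤1 : ∀ b → 𝟙 b ≤ 1
    𝟙≤1 true  = ℕₚ.≤-refl
    𝟙≤1 false = z≤n

    -- For 2e ≤ d the lower bound is applied to the reversed shelling at e, otherwise to the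
    -- original one at d - e. In each case one of the two conditions of the window is relaxed and
    -- the other truncates the sum.
    level-bound : ∀ e → e ≤ d → sumTo k (λ i → window d i e * g i) ≤ ∣ Rev.level e ∣
    level-bound e e≤d with e + e ℕ.≤? d
    ... | yes 2e≤d = ℕₚ.≤-trans (sumTo-mono k (λ i _ → ℕₚ.*-monoˡ-≤ (g i)
            (ℕₚ.≤-trans (ℕₚ.*-monoʳ-≤ (𝟙 (le i e)) (𝟙≤1 (le i (d ∸ e)))) (ℕₚ.≤-reflexive (ℕₚ.*-identityʳ (𝟙 (le i e)))))))
          (ℕₚ.≤-trans (truncated e) (LowerBound.h-lower (reverse-shelling shelling) M k n≡ 2k≤d neighborly e 2e≤d))
    ... | no ≰ = ℕₚ.≤-trans (sumTo-mono k (λ i _ → ℕₚ.*-monoˡ-≤ (g i)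
            (ℕₚ.≤-trans (ℕₚ.*-monoˡ-≤ (𝟙 (le i (d ∸ e))) (𝟙≤1 (le i e))) (ℕₚ.≤-reflexive (ℕₚ.*-identityˡ (𝟙 (le i (d ∸ e))))))))
          (ℕₚ.≤-trans (truncated (d ∸ e)) (ℕₚ.≤-trans (LowerBound.h-lower shelling M k n≡ 2k≤d neighborly (d ∸ e) small)
            (ℕₚ.≤-reflexive (sym (reversed-level e e≤d)))))
      where
      small : (d ∸ e) + (d ∸ e) ≤ d
      small = ℕₚ.≤-trans (ℕₚ.+-monoʳ-≤ (d ∸ e) (ℕₚ.m≤n+o⇒m∸n≤o d e (ℕₚ.<⇒≤ (ℕₚ.≰⇒> ≰)))) (ℕₚ.≤-reflexive (ℕₚ.m∸n+n≡m e≤d))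

    -- Exchange the two sums: for fixed e, the differences whose window contains e add up to at most
    -- the number of facets with ∣S σ∣ = e, each of which contributes C(e, t) faces.
    face-bound : ∀ t → sumTo k (λ i → windowed d t i * g i) ≤ FaceNumbers.faceCount shelling t
    face-bound t = begin
      sumTo k (λ i → windowed d t i * g i) ≡⟨ sumTo-cong k (λ i _ → trans (ℕₚ.*-comm (windowed d t i) (g i)) (trans (sym (sumTo-* d (g i) (λ e → window d i e * binom e t)))
          (sumTo-cong d (λ e _ → solve 3 (λ g w b → g :* (w :* b) := b :* (w :* g)) refl (g i) (window d i e) (binom e t))))) ⟩
      sumTo k (λ i → sumTo d (λ e → binom e t * (window d i e * g i))) ≡⟨ sumTo-comm k d (λ i e → binom e t * (window d i e * g i)) ⟩
      sumTo d (λ e → sumTo k (λ i → binom e t * (window d i e * g i))) ≡⟨ sumTo-cong d (λ e _ → trans (sumTo-* k (binom e t) (λ i → window d i e * g i)) (ℕₚ.*-comm (binom e t) (sumTo k (λ i → window d i e * g i)))) ⟩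
      sumTo d (λ e → sumTo k (λ i → window d i e * g i) * binom e t) ≤⟨ sumTo-mono d (λ e e≤d → ℕₚ.*-monoˡ-≤ (binom e t) (level-bound e e≤d)) ⟩
      sumTo d (λ e → ∣ Rev.level e ∣ * binom e t) ≡⟨ sym (FaceNumbers.by-level (reverse-shelling shelling) (λ x → binom x t)) ⟩
      sumF (λ σ → binom ∣ S σ ∣ t) ≡⟨ sym (FaceNumbers.faceCount≡ shelling t) ⟩
      FaceNumbers.faceCount shelling t ∎
      where open ℕₚ.≤-Reasoning

open NumericalBounds

-- Assembly of the lower bounds in the integers

module LowerBounds where
  open import Defs
  open import Data.Fin.Subset using (Subset; ∣_∣; ⊤)
  open import Data.Integer as ℤ using (ℤ; +_)
  open import Data.Nat as ℕ using (ℕ; zero; suc; s≤s; z≤n; _∸_; _+_; _*_; _≤_; _<_; _≡ᵇ_)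
  open import Data.Nat.Combinatorics using (_C_; nC1≡n)
  open import Data.Nat.Solver using (module +-*-Solver)
  open import Relation.Binary.PropositionalEquality using (_≡_; refl; sym; trans; cong; cong₂; subst)

  open +-*-Solver using (solve; _:=_; _:+_; con)

  sumℤ-mono : ∀ k (G : ℕ → ℤ) (f : ℕ → ℕ) → (∀ i → i ≤ k → G i ℤ.≤ + f i) → sumℤ (suc k) G ℤ.≤ + sumTo k f
  sumℤ-mono zero    G f e = ℤₚ.≤-trans (ℤₚ.≤-reflexive (ℤₚ.+-identityˡ (G 0))) (e 0 z≤n)
  sumℤ-mono (suc k) G f e = ℤₚ.≤-trans (ℤₚ.+-mono-≤ (sumℤ-mono k G f (λ i i≤k → e i (ℕₚ.m≤n⇒m≤1+n i≤k))) (e (suc k) ℕₚ.≤-refl))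
    (ℤₚ.≤-reflexive (trans (sym (ℤₚ.pos-+ (sumTo k f) (f (suc k)))) (cong +_ (sym (sumTo-last k f)))))

  sumℤ-cong : ∀ k {f g : ℕ → ℤ} → (∀ i → i < k → f i ≡ g i) → sumℤ k f ≡ sumℤ k g
  sumℤ-cong zero    e = refl
  sumℤ-cong (suc k) e = cong₂ ℤ._+_ (sumℤ-cong k (λ i i<k → e i (ℕₚ.m≤n⇒m≤1+n i<k))) (e k ℕₚ.≤-refl)

  difference-bound : ∀ {a b w} g → a ≤ b + w → ((+ a) ℤ.- (+ b)) ℤ.* (+ g) ℤ.≤ + (w * g)
  difference-bound {a} {b} {w} g le = ℤₚ.≤-trans (ℤₚ.*-monoʳ-≤-nonNeg (+ g) lemma) (ℤₚ.≤-reflexive (sym (ℤₚ.pos-* w g)))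
    where
    lemma : (+ a) ℤ.- (+ b) ℤ.≤ + w
    lemma = ℤₚ.≤-trans (ℤₚ.+-monoˡ-≤ (ℤ.- (+ b)) (ℤ.+≤+ le)) (ℤₚ.≤-reflexive (trans (cong (ℤ._- (+ b)) (trans (cong +_ (ℕₚ.+-comm b w)) (ℤₚ.pos-+ w b)))
      (trans (ℤₚ.+-assoc (+ w) (+ b) (ℤ.- (+ b))) (trans (cong (λ z → (+ w) ℤ.+ z) (ℤₚ.+-inverseʳ (+ b))) (ℤₚ.+-identityʳ (+ w))))))

  enlarge : ∀ {n} (F : Subset n) k → ∣ F ∣ ≤ k → k ≤ n → ∃ λ S → F ⊑ S × ∣ S ∣ ≡ k
  enlarge [] zero z≤n z≤n = [] , (λ _ m → m) , refl
  enlarge (true ∷ F) (suc k) (s≤s le) (s≤s k≤n) with enlarge F k le k≤n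
  ... | S , s , e = true ∷ S , (λ { zero m → m ; (suc i) m → s i m }) , cong suc e
  enlarge {suc n} (false ∷ F) k le k≤1+n with k ℕ.≤? n
  ... | yes k≤n = let (S , s , e) = enlarge F k le k≤n in false ∷ S , (λ { zero m → m ; (suc i) m → s i m }) , e
  ... | no k≰n = ⊤ , (λ i _ → Vecₚ.lookup-replicate i true) , trans (Subsetₚ.∣⊤∣≡n (suc n)) (ℕₚ.≤-antisym (ℕₚ.≰⇒> k≰n) k≤1+n)

  module Assembly (d′ n k : ℕ) (v : Config (suc d′) n) (2k≤d : 2 * k ≤ suc d′) (d+2≤n : suc d′ + 2 ≤ n)
    (shelling : Shelling (suc d′) n)
    (subface-j : ∀ σ F j → F ⊑ Shelling.facet shelling σ → ∣ F ∣ ≡ suc j → IsJFace v j F)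
    (small-faces : ∀ F → ∣ F ∣ ≤ k → ∃ λ σ → F ⊑ Shelling.facet shelling σ) where
    open Shelling shelling using (facet)

    d M : ℕ
    d = suc d′
    M = n ∸ (d + 2)

    n≡ : n ≡ suc d + suc M
    n≡ = trans (sym (ℕₚ.m+[n∸m]≡n d+2≤n)) (solve 2 (λ d m → (d :+ con 2) :+ m := con 1 :+ d :+ (con 1 :+ m)) refl d M)

    k+k≤d : k + k ≤ d
    k+k≤d = subst (λ x → k + x ≤ d) (ℕₚ.+-identityʳ k) 2k≤d

    open FaceNumbers shelling using (face?; faceCount)

    at-least : ∀ j → j < d → AtLeastJFaces v j (boundJ d n k j)
    at-least j j<d = faces , Uniqueₚ.filter⁺ has-size? (subsets-unique n) , sound , bounded
      where
      -- A j-face has j + 1 vertices and omits t of the d vertices of a facet; the lower index d - j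
      -- of the statement is t + 1.
      t = d ∸ suc j
      t+ : suc j + t ≡ d
      t+ = ℕₚ.m+[n∸m]≡n j<d
      d∸j : d ∸ j ≡ suc t
      d∸j = trans (cong (_∸ j) (trans (sym t+) (sym (ℕₚ.+-suc j t)))) (ℕₚ.m+n∸m≡n j (suc t))
      has-size? : ∀ F → Dec ((∃ λ σ → F ⊑ facet σ) × ∣ F ∣ + t ≡ d)
      has-size? F = face? F ×-dec (∣ F ∣ + t ℕ.≟ d)
      faces : List (Subset n)
      faces = filter has-size? (subsets n)
      sound : ∀ F → F ∈ₗ faces → IsJFace v j F
      sound F m with Membershipₚ.∈-filter⁻ has-size? {xs = subsets n} m
      ... | _ , (σ , F⊑σ) , size = subface-j σ F j F⊑σ (ℕₚ.+-cancelʳ-≡ t ∣ F ∣ (suc j) (trans size (sym t+)))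
      count : length faces ≡ faceCount t
      count = trans (length-filter has-size? (subsets n)) (sumL-cong (subsets n) (λ F → 𝟙-∧ (does (face? F)) (∣ F ∣ + t ≡ᵇ d)))
      term : ∀ i → i ≤ k → ((+ ((suc d ∸ i) C (d ∸ j))) ℤ.- (+ (i C (d ∸ j)))) ℤ.* (+ ((M + i) C i)) ℤ.≤ + (windowed d t i * multichoose M i)
      term i i≤k = subst (λ x → ((+ ((suc d ∸ i) C x)) ℤ.- (+ (i C x))) ℤ.* (+ ((M + i) C i)) ℤ.≤ + (windowed d t i * multichoose M i)) (sym d∸j)
        (subst (λ x → x ℤ.≤ + (windowed d t i * multichoose M i))
          (cong₂ ℤ._*_ (cong₂ (λ x y → (+ x) ℤ.- (+ y)) (binom≡C (suc d ∸ i) (suc t)) (binom≡C i (suc t))) (cong +_ (binom≡C (M + i) i)))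
          (difference-bound {binom (suc d ∸ i) (suc t)} {binom i (suc t)} {windowed d t i} (multichoose M i)
            (windowed-bound d t i (ℕₚ.≤-trans i≤k (ℕₚ.≤-trans (ℕₚ.m≤m+n k k) k+k≤d)))))
      bounded : boundJ d n k j ℤ.≤ + length faces
      bounded = ℤₚ.≤-trans (sumℤ-mono k (λ i → ((+ ((suc d ∸ i) C (d ∸ j))) ℤ.- (+ (i C (d ∸ j)))) ℤ.* (+ ((M + i) C i))) (λ i → windowed d t i * multichoose M i) term)
        (ℤ.+≤+ (subst (sumTo k (λ i → windowed d t i * multichoose M i) ≤_) (sym count)
          (FaceBound.face-bound shelling M k n≡ k+k≤d small-faces t)))

    -- For j = d - 1 the lower index is 1 and C(m, 1) = m. The truncated subtractions are exact
    -- since 2i ≤ 2k ≤ d.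
    facet-bound : boundJ d n k d′ ≡ boundFacet d n k
    facet-bound = sumℤ-cong (suc k) (λ i i<k → cong (ℤ._* (+ ((M + i) C i))) (term i (ℕₚ.≤-pred i<k)))
      where
      term : ∀ i → i ≤ k → (+ ((suc d ∸ i) C (d ∸ d′))) ℤ.- (+ (i C (d ∸ d′))) ≡ + (suc d ∸ 2 * i)
      term i i≤k = trans (cong₂ (λ x y → (+ x) ℤ.- (+ y)) (choose-one (suc d ∸ i)) (choose-one i))
        (trans (ℤₚ.m-n≡m⊖n (suc d ∸ i) i) (trans (ℤₚ.⊖-≥ i≤) (cong +_ (trans (ℕₚ.∸-+-assoc (suc d) i i) (cong (λ x → suc d ∸ (i + x)) (sym (ℕₚ.+-identityʳ i)))))))
        where
        choose-one : ∀ m → m C (d ∸ d′) ≡ m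
        choose-one m = trans (cong (m C_) (ℕₚ.m+n∸n≡m 1 d′)) (nC1≡n m)
        i≤ : i ≤ suc d ∸ i
        i≤ = ℕₚ.m+n≤o⇒m≤o∸n i (ℕₚ.m≤n⇒m≤1+n (ℕₚ.≤-trans (ℕₚ.+-mono-≤ i≤k i≤k) k+k≤d))

    facets : AtLeastJFaces v d′ (boundFacet d n k)
    facets = subst (AtLeastJFaces v d′) facet-bound (at-least d′ (ℕₚ.n<1+n d′))

  module Main (d′ n k : ℕ) (v : Config (suc d′) n) (polytope : IsPolytopeWithVertices v) (simplicial : Simplicial v)
    (neighborly : Neighborly k v) (2k≤d : 2 * k ≤ suc d′) (d+2≤n : suc d′ + 2 ≤ n) where

    d<n : suc d′ < n
    d<n = ℕₚ.<-trans (ℕₚ.n<1+n (suc d′)) (subst (_≤ n) (ℕₚ.+-comm (suc d′) 2) d+2≤n)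

    k<n : k < n
    k<n = ℕₚ.≤-<-trans (ℕₚ.≤-trans (ℕₚ.m≤m+n k (k + 0)) 2k≤d) d<n

    open FacetList d′ n v (proj₁ polytope) simplicial d<n using (facet; shelling)
    open Faces d′ n v (proj₁ polytope) simplicial d<n using (face-in-facet; subface-j)

    outside : ∀ (S : Subset n) → ∣ S ∣ ≡ k → ∃ λ i → lookup S i ≡ false
    outside S size = proj₁ missing , proj₂ (proj₂ missing)
      where
      missing : ∃ λ i → lookup (⊤ {n}) i ≡ true × lookup S i ≡ false
      missing = ⊑-witness S (⊤ {n}) (subst (_< ∣ ⊤ {n} ∣) (sym size) (subst (k <_) (sym (Subsetₚ.∣⊤∣≡n n)) k<n))

    -- Neighborliness speaks of sets of exactly k vertices. A smaller set is enlarged to such a set,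
    -- which is a proper face because k < n and hence lies in a facet.
    small-faces : ∀ F → ∣ F ∣ ≤ k → ∃ λ σ → F ⊑ facet σ
    small-faces F le = enlarged (enlarge F k le (ℕₚ.<⇒≤ k<n))
      where
      enlarged : (∃ λ S → F ⊑ S × ∣ S ∣ ≡ k) → ∃ λ σ → F ⊑ facet σ
      enlarged (S , F⊑S , size) = proj₁ σ , λ i i∈F → proj₂ σ i (F⊑S i i∈F)
        where
        σ : ∃ λ σ → S ⊑ facet σ
        σ = face-in-facet (neighborly S size) (outside S size)

    open Assembly d′ n k v 2k≤d d+2≤n shelling subface-j small-faces public using (at-least; facets)

open import Defs
open import Data.Nat using (ℕ; zero; suc; _≤_; _<_; _+_; _*_; _∸_)

theorem6 : (d n k : ℕ) (v : Config d n) →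
    IsPolytopeWithVertices v → Simplicial v → 1 ≤ k → Neighborly k v →
    2 * k ≤ d → d + 2 ≤ n →
    ((j : ℕ) → j < d → AtLeastJFaces v j (boundJ d n k j)) ×
    AtLeastJFaces v (d ∸ 1) (boundFacet d n k)
theorem6 zero    n (suc k) v polytope simplicial 1≤k neighborly () d+2≤n
theorem6 (suc d) n k v polytope simplicial 1≤k neighborly 2k≤d d+2≤n =
  LowerBounds.Main.at-least d n k v polytope simplicial neighborly 2k≤d d+2≤n ,
  LowerBounds.Main.facets d n k v polytope simplicial neighborly 2k≤d d+2≤n
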